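{- Any quantum algorithm that constructs, for every input text $T[1..n]$ in the class of texts with $z=\Theta(1)$ (respectively $z=\Theta(n)$) LZ77 factors, a data structure supporting suffix array queries in $o(\sqrt{zn})$ time requires $\Omega(\sqrt{zn})$ input queries; similarly, for the classes of texts with $r=\Theta(1)$ (respectively $r=\Theta(n)$) BWT runs, it requires $\Omega(\sqrt{rn})$ input queries.
   Context: Model: the text $T[1..n]$ over an integer alphabet is accessible only through a quantum oracle which on query $i$ returns $T[i]$; the query complexity is the number of oracle calls, and an algorithm must succeed with probability at least $\frac{2}{3}$. Suffix array query: given $i$, return $\mathrm{SA}[i]$, where $T[\mathrm{SA}[i]..n]$ is the $i$-th smallest suffix of $T$ lexicographically. LZ77 factorization (greedy): start with $i=1$; while $i\le n$: if $T[i]$ is the first occurrence of its symbol, $T[i]$ is the next factor and $i\gets i+1$; otherwise take the largest $j\ge i$ such that $T[i..j]$ occurs in $T$ starting at some position $i'<i$, make $T[i..j]$ the next factor and set $i\gets j+1$. $z$ is the number of factors. $r$ is the number of maximal runs of equal symbols in the BWT of $T$, where $\mathrm{BWT}[i]=T[\mathrm{SA}[i]-1]$ (with $T[0]=T[n]$). -}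

module Defs where

open import Algebra.Apartness.Bundles using (HeytingField; HeytingCommutativeRing)
open import Algebra.Bundles using (CommutativeRing; RawMonoid)
import Algebra.Definitions.RawMonoid as RawMonoidOps
open import Data.Bool.Base using (if_then_else_; _∧_)
open import Data.Fin.Base as Fin using (Fin; toℕ; fromℕ; inject₁)
import Data.Fin.Properties as Fin
open import Data.Fin.Subset using (Subset; _∈_; ⁅_⁆)
open import Data.Fin.Subset.Properties using (_∈?_)
open import Data.List.Base using (List; []; _∷_; length; take; drop; map; allFin; lookup; derun)
open import Data.List.Properties using (length-tabulate)
import Data.List.Relation.Binary.Lex.Strict as Lex
open import Data.List.Relation.Binary.Permutation.Propositional.Properties using (↭-length)
import Data.List.Sort as Sort
open import Data.Nat.Base as ℕ using (ℕ; zero; suc; NonZero)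
open import Data.Nat.DivMod using (_mod_)
open import Data.Product.Base using (Σ; ∃; ∃-syntax; _×_; _,_)
open import Data.Sum.Base using (_⊎_)
open import Data.Vec.Functional using (Vector; toList)
open import Level using (Level; _⊔_) renaming (suc to lsuc)
open import Relation.Binary.Bundles using (DecTotalOrder)
import Relation.Binary.Construct.On as On
open import Relation.Binary.Core using (Rel)
open import Relation.Binary.PropositionalEquality using (_≡_; sym; trans)
open import Relation.Binary.Structures using (IsStrictPartialOrder)
open import Relation.Nullary.Decidable.Core using (does)
open import Relation.Nullary.Negation.Core using (¬_)

private
  variable
    n σ : ℕ

------------------------------------------------------------------------
-- Texts.  Positions are 0-based; the alphabet is {0, …, σ - 1}.

Text : ℕ → ℕ → Set
Text σ n = Vector (Fin σ) n

suffix : Text σ n → Fin n → List (Fin σ)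
suffix T i = drop (toℕ i) (toList T)

suffixOrder : Text σ n → DecTotalOrder _ _ _
suffixOrder {σ} T =
  On.decTotalOrder (Lex.≤-decTotalOrder (Fin.<-strictTotalOrder σ)) (suffix T)

sortedSuffixes : Text σ n → List (Fin n)
sortedSuffixes {n = n} T = Sort.sort (suffixOrder T) (allFin n)

length-sortedSuffixes : (T : Text σ n) → length (sortedSuffixes T) ≡ n
length-sortedSuffixes {n = n} T =
  trans (↭-length (Sort.sort-↭ (suffixOrder T) (allFin n))) (length-tabulate _)

SA : Text σ n → Fin n → Fin n
SA T i = lookup (sortedSuffixes T) (Fin.cast (sym (length-sortedSuffixes T)) i)

-- The position read by the BWT: the previous one, with the last position
-- preceding the first.
cyclicPred : Fin n → Fin n
cyclicPred {suc n} Fin.zero    = fromℕ n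
cyclicPred         (Fin.suc i) = inject₁ i

BWT : Text σ n → Text σ n
BWT T i = T (cyclicPred (SA T i))

-- `derun` keeps one symbol of each maximal run.
bwtRuns : Text σ n → ℕ
bwtRuns T = length (derun Fin._≟_ (toList (BWT T)))

substring : {A : Set} → List A → ℕ → ℕ → List A
substring t i ℓ = take ℓ (drop i t)

-- The substring of length ℓ at position i lies within the text and also
-- occurs at an earlier position; the two occurrences may overlap.
OccursBefore : {A : Set} → List A → ℕ → ℕ → Set
OccursBefore t i ℓ =
  i ℕ.+ ℓ ℕ.≤ length t ×
  ∃[ i′ ] (i′ ℕ.< i × substring t i′ ℓ ≡ substring t i ℓ)

-- `LZ77From t i z`: the greedy factorization of t, from position i to the
-- end, has z factors.
data LZ77From {A : Set} (t : List A) : ℕ → ℕ → Set where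
  done    : ∀ {i} → length t ℕ.≤ i → LZ77From t i 0
  literal : ∀ {i z} → i ℕ.< length t → ¬ OccursBefore t i 1 →
            LZ77From t (suc i) z → LZ77From t i (suc z)
  copy    : ∀ {i ℓ z} → 1 ℕ.≤ ℓ → OccursBefore t i ℓ →
            (∀ ℓ′ → OccursBefore t i ℓ′ → ℓ′ ℕ.≤ ℓ) →
            LZ77From t (i ℕ.+ ℓ) z → LZ77From t i (suc z)

-- A numerical parameter of texts, given by its graph.
Parameter : Set₁
Parameter = ∀ {σ n} → Text σ n → ℕ → Set

LZ77Factors : Parameter
LZ77Factors T z = LZ77From (toList T) 0 z

BWTRuns : Parameter
BWTRuns T r = bwtRuns T ≡ r

------------------------------------------------------------------------
-- The real numbers: a Cauchy-complete Archimedean ordered field.  Its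
-- laws are the constructive ones, so classical and constructive reals
-- are both models.

record RealNumbers (c ℓ₁ ℓ₂ ℓ₃ : Level) : Set (lsuc (c ⊔ ℓ₁ ⊔ ℓ₂ ⊔ ℓ₃)) where
  infix 4 _<_ _≤_
  field
    heytingField : HeytingField c ℓ₁ ℓ₂

  open HeytingField heytingField public

  commutativeRing : CommutativeRing c ℓ₁
  commutativeRing = HeytingCommutativeRing.commutativeRing heytingCommutativeRing

  open CommutativeRing commutativeRing public using (+-rawMonoid)
  open RawMonoidOps +-rawMonoid public using (sum) renaming (_×_ to _·_)

  field
    _<_                  : Rel Carrier ℓ₃
    isStrictPartialOrder : IsStrictPartialOrder _≈_ _<_
    #⇒<⊎>                : ∀ {x y} → x # y → x < y ⊎ y < x
    <⇒#                  : ∀ {x y} → x < y → x # y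
    +-monoˡ-<            : ∀ {x y} z → x < y → x + z < y + z
    *-positive           : ∀ {x y} → 0# < x → 0# < y → 0# < x * y
    archimedean          : ∀ x → ∃[ k ] x < k · 1#

  _≤_ : Rel Carrier ℓ₃
  x ≤ y = ¬ (y < x)

  -- |x - y| < 1/(k+1)
  Within : ℕ → Carrier → Carrier → Set ℓ₃
  Within k x y = suc k · (x - y) < 1# × suc k · (y - x) < 1#

  Cauchy : (ℕ → Carrier) → Set ℓ₃
  Cauchy s = ∀ k → ∃[ N ] (∀ i j → N ℕ.≤ i → N ℕ.≤ j → Within k (s i) (s j))

  ConvergesTo : (ℕ → Carrier) → Carrier → Set ℓ₃
  ConvergesTo s l = ∀ k → ∃[ N ] (∀ i → N ℕ.≤ i → Within k (s i) l)

  field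
    complete : ∀ s → Cauchy s → ∃[ l ] ConvergesTo s l

------------------------------------------------------------------------
-- Quantum query algorithms

module Quantum {c ℓ₁ ℓ₂ ℓ₃ : Level} (ℝ : RealNumbers c ℓ₁ ℓ₂ ℓ₃) where

  open RealNumbers ℝ

  record ℂ : Set c where
    constructor _+i_
    field
      re im : Carrier

  open ℂ public

  infix  4 _≈ᶜ_
  infixl 6 _+ᶜ_
  infixl 7 _*ᶜ_

  _≈ᶜ_ : Rel ℂ ℓ₁
  z ≈ᶜ w = re z ≈ re w × im z ≈ im w

  _+ᶜ_ _*ᶜ_ : ℂ → ℂ → ℂ
  z +ᶜ w = (re z + re w) +i (im z + im w)
  z *ᶜ w = (re z * re w - im z * im w) +i (re z * im w + im z * re w)

  0ᶜ 1ᶜ : ℂ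
  0ᶜ = 0# +i 0#
  1ᶜ = 1# +i 0#

  conj : ℂ → ℂ
  conj z = re z +i (- im z)

  ∣_∣² : ℂ → Carrier
  ∣ z ∣² = re z * re z + im z * im z

  +ᶜ-rawMonoid : RawMonoid c ℓ₁
  +ᶜ-rawMonoid = record { Carrier = ℂ ; _≈_ = _≈ᶜ_ ; _∙_ = _+ᶜ_ ; ε = 0ᶜ }

  open RawMonoidOps +ᶜ-rawMonoid using () renaming (sum to sumᶜ)

  -- Computational basis: a position register, an answer register and a
  -- workspace of dimension w.
  Basis : ℕ → ℕ → ℕ → Set
  Basis n σ w = Fin n × Fin σ × Fin w

  module _ {n σ w : ℕ} where

    State : Set c
    State = Basis n σ w → ℂ

    Σᴿ : (Basis n σ w → Carrier) → Carrier
    Σᴿ f = sum λ i → sum λ b → sum λ k → f (i , b , k)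

    Σᶜ : State → ℂ
    Σᶜ f = sumᶜ λ i → sumᶜ λ b → sumᶜ λ k → f (i , b , k)

    δ : Basis n σ w → State
    δ (i , b , k) (i′ , b′ , k′) =
      if does (i Fin.≟ i′) ∧ does (b Fin.≟ b′) ∧ does (k Fin.≟ k′) then 1ᶜ else 0ᶜ

  record Unitary (n σ w : ℕ) : Set (c ⊔ ℓ₁) where
    field
      entry : Basis n σ w → Basis n σ w → ℂ
      U*U≈1 : ∀ x y → Σᶜ (λ k → conj (entry k x) *ᶜ entry k y) ≈ᶜ δ x y
      UU*≈1 : ∀ x y → Σᶜ (λ k → entry x k *ᶜ conj (entry y k)) ≈ᶜ δ x y

  _⊕_ _⊖_ : Fin σ → Fin σ → Fin σ
  _⊕_ {suc σ} a b = (toℕ a ℕ.+ toℕ b) mod suc σ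
  _⊖_ {suc σ} a b = (toℕ a ℕ.+ (suc σ ℕ.∸ toℕ b)) mod suc σ

  -- `query` is the oracle |i, b, k⟩ ↦ |i, b ⊕ T i, k⟩, and `query⁻¹` its
  -- inverse.  On amplitudes, the oracle acts by precomposition with the
  -- inverse permutation of the basis.
  data Step (n σ w : ℕ) : Set (c ⊔ ℓ₁) where
    unitary        : Unitary n σ w → Step n σ w
    query query⁻¹ : Step n σ w

  apply : ∀ {w} → Text σ n → Step n σ w → State {n} {σ} {w} → State {n} {σ} {w}
  apply T (unitary U) ψ x           = Σᶜ (λ y → Unitary.entry U x y *ᶜ ψ y)
  apply T query       ψ (i , b , k) = ψ (i , b ⊖ T i , k)
  apply T query⁻¹     ψ (i , b , k) = ψ (i , b ⊕ T i , k)

  run : ∀ {w} → Text σ n → List (Step n σ w) → State {n} {σ} {w} → State {n} {σ} {w}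
  run T []       ψ = ψ
  run T (s ∷ ss) ψ = run T ss (apply T s ψ)

  -- The final state is measured in the computational basis, and `output`
  -- is applied to the outcome.
  record Algorithm (n σ m : ℕ) : Set (c ⊔ ℓ₁) where
    field
      {w}    : ℕ
      start  : Basis n σ w
      steps  : List (Step n σ w)
      output : Basis n σ w → Fin m

  open Algorithm

  queryCount : ∀ {w} → List (Step n σ w) → ℕ
  queryCount []               = 0
  queryCount (unitary _ ∷ ss) = queryCount ss
  queryCount (query     ∷ ss) = suc (queryCount ss)
  queryCount (query⁻¹   ∷ ss) = suc (queryCount ss)

  queries : ∀ {m} → Algorithm n σ m → ℕ
  queries A = queryCount (steps A)

  -- A query and an arbitrary unitary each cost one unit, so this is at most
  -- the running time in any model built from elementary gates and queries.
  time : ∀ {m} → Algorithm n σ m → ℕ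
  time A = length (steps A)

  Pr : ∀ {m} → Algorithm n σ m → Text σ n → Subset m → Carrier
  Pr A T S = Σᴿ λ x →
    if does (output A x ∈? S) then ∣ run T (steps A) (δ (start A)) x ∣² else 0#

  AtLeast⅔ : Carrier → Set ℓ₃
  AtLeast⅔ p = 2 · 1# ≤ 3 · p

  -- `build` outputs (an encoding of) a data structure; `answer d i` is the
  -- quantum algorithm, with oracle access to the text, which answers the
  -- suffix array query i given the data structure d.
  record SAConstruction (n σ : ℕ) : Set (c ⊔ ℓ₁) where
    field
      {size} : ℕ
      build  : Algorithm n σ size
      answer : Fin size → Fin n → Algorithm n σ n

  open SAConstruction

  SupportsSA : (A : SAConstruction n σ) → Fin (size A) → Text σ n → ℕ → Set ℓ₃
  SupportsSA A d T t =
    ∀ i → time (answer A d i) ℕ.≤ t × AtLeast⅔ (Pr (answer A d i) T ⁅ SA T i ⁆)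

  -- With probability at least 2/3, the output of `build` is a data
  -- structure supporting suffix array queries on T in time t.
  Constructs : SAConstruction n σ → Text σ n → ℕ → Set ℓ₃
  Constructs A T t =
    ∃[ S ] (∀ d → d ∈ S → SupportsSA A d T t) × AtLeast⅔ (Pr (build A) T S)

  ----------------------------------------------------------------------
  -- Asymptotics, over the texts of length n and alphabet size σ n.  All
  -- families are indexed by n ≥ 1, as no algorithm has an empty position
  -- register.

  -- The class of texts with parameter p = Θ(f(n)), with both implied
  -- constants equal to C.
  Θ-Class : Parameter → (f : ℕ → ℕ) → (C : ℕ) → Text σ n → ℕ → Set
  Θ-Class {n = n} μ f C T p = μ T p × p ℕ.≤ C ℕ.* f n × f n ℕ.≤ C ℕ.* p

  TextClass : (ℕ → ℕ) → Set₁
  TextClass σ = ∀ n → Text (σ n) n → ℕ → Set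

  module _ (σ : ℕ → ℕ) (𝒯 : TextClass σ) where

    -- g = o(√(pn)): for every k, eventually √k · g(n) ≤ √(pn).
    o√[p·n] : (∀ n → .{{NonZero n}} → ℕ) → Set
    o√[p·n] g = ∀ k → ∃[ N ] (∀ n → .{{_ : NonZero n}} → N ℕ.≤ n →
      ∀ T p → 𝒯 n T p → k ℕ.* (g n ℕ.* g n) ℕ.≤ p ℕ.* n)

    -- g = Ω(√(pn)): for some K, eventually √(pn) ≤ √K · g(n).
    Ω√[p·n] : (∀ n → .{{NonZero n}} → ℕ) → Set
    Ω√[p·n] g = ∃[ K ] ∃[ N ] (∀ n → .{{_ : NonZero n}} → N ℕ.≤ n →
      ∀ T p → 𝒯 n T p → p ℕ.* n ℕ.≤ K ℕ.* (g n ℕ.* g n))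

    LowerBound : Set (c ⊔ ℓ₁ ⊔ ℓ₃)
    LowerBound =
      (A : ∀ n → .{{NonZero n}} → SAConstruction n (σ n))
      (t : ∀ n → .{{NonZero n}} → ℕ) →
      (∀ n → .{{_ : NonZero n}} → ∀ T p → 𝒯 n T p → Constructs (A n) T (t n)) →
      o√[p·n] t →
      Ω√[p·n] (λ n → queries (build (A n)))

  -- The lower bound for texts with μ = Θ(f(n)), whenever the implied
  -- constants of the class are large enough.  (They cannot be arbitrary:
  -- for instance, only unary texts have a single BWT run.)
  LowerBoundForΘ : (ℕ → ℕ) → Parameter → (ℕ → ℕ) → Set (c ⊔ ℓ₁ ⊔ ℓ₃)
  LowerBoundForΘ σ μ f =
    ∃[ C₀ ] (∀ C → C₀ ℕ.≤ C → LowerBound σ (λ n → Θ-Class μ f C))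

module Submission where

-- The adversary method.  If two texts differ only at position i but have
-- different entries SA[j], then building the data structure and answering the
-- suffix array query j must drive the computations on the two texts apart, and
-- only queries to position i can do so.  Hence each text T has weights
-- W_T(i) ≥ 0, proportional to the total probability with which the run on T
-- queries position i, such that Σᵢ W_T(i) ≤ L := 1944 q + 1296 t for q queries of the
-- construction and answers in time t, while 2 s ≤ s² W_T(i) + W_T′(i) for all s
-- and all such pairs T, T′.
--
-- For z, r = Θ(1), the base text 1 0 … 0 becomes 1 0 … 0 2 0 … 0 by one change
-- in any of n - 1 positions, and each change moves the lexicographically
-- largest suffix; with s² ≈ n this gives √n = O(L).  For z, r = Θ(n), half of
-- the text spells out distinct symbols and each of the other m symbols is
-- smaller or larger than those, which encodes m bits; flipping a bit shifts the
-- middle of the suffix array, and averaging over the hypercube gives m ≤ L.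
-- As t is negligible, L is of the order of q in both cases.

open import Defs
open import Algebra.Bundles using (CommutativeRing; CommutativeSemiring)
import Algebra.Apartness.Properties.HeytingCommutativeRing as HeytingProperties
import Algebra.Properties.CommutativeSemigroup as CommutativeSemigroupProperties
import Algebra.Properties.Ring as RingProperties
import Algebra.Properties.Semiring.Mult as SemiringMult
import Algebra.Properties.Semiring.Sum as SemiringSum
import Algebra.Solver.Ring
open import Algebra.Solver.Ring.AlmostCommutativeRing using (fromCommutativeRing; _-Raw-AlmostCommutative⟶_)
open import Algebra.Structures.Biased using (isCommutativeSemiringˡ)
open import Data.Bool.Base using (Bool; true; false; if_then_else_; _∧_; not)
open import Data.Empty using (⊥-elim)
open import Data.Fin.Base as Fin using (Fin; zero; suc; toℕ; fromℕ; fromℕ<; inject₁; splitAt; _↑ˡ_; _↑ʳ_)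
open import Data.Fin.Permutation using (permutation)
import Data.Fin.Properties as Fin
open import Data.Integer.Base as ℤ using (ℤ)
import Data.Integer.Properties as ℤ
open import Data.List.Base as List using (List; []; _∷_; length)
open import Data.Maybe.Base as Maybe using (Maybe; just)
open import Data.Nat.Base as ℕ using (ℕ; zero; suc)
import Data.Nat.DivMod as ℕ
import Data.Nat.Properties as ℕ
open import Data.Nat.Solver using (module +-*-Solver)
open import Data.Product.Base using (_×_; _,_; proj₁; proj₂; ∃-syntax)
open import Data.Sum.Base using (inj₁; inj₂; [_,_]′)
open import Data.Vec.Base as Vec using (Vec; []; _∷_; updateAt)
open import Function.Base using (_∘_)
open import Relation.Binary.PropositionalEquality as ≡ using (_≡_; _≢_)
import Relation.Binary.Reasoning.Setoid as SetoidReasoning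
open import Relation.Binary.Structures using (IsEquivalence; IsStrictPartialOrder)
open import Relation.Nullary.Decidable using (Dec; does; yes; no; _×-dec_; dec-true; dec-false; dec⇒maybe)
open import Relation.Nullary.Negation using (¬_; contradiction)

-- The obstacle is that the answering algorithms may query the text as well: one data structure can
-- be valid for both texts, so the construction alone need not distinguish them, and `t` has to
-- enter the bound. The measurement after the construction is therefore deferred. Every outcome `z`
-- keeps an unnormalised branch that enters its answering algorithm with the amplitude of `z`, and
-- distances and query masses are summed over all branches. Either the amplitudes of the two
-- constructions already differ, or much weight lies on data structures valid for both texts, whose
-- answers must differ.
--
-- Progress is measured by the squared distance times `s`, so that each oracle call can be bounded
-- by expanding `|s z + w|² ≥ 0` and `|s z - w|² ≥ 0`. This avoids square roots and division over
-- reals whose order is not assumed decidable. The same `s` balances one base text with many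
-- neighbours against neighbours of which only a single weight is used; on the hypercube all texts
-- are alike and `s = 1`.

-- Arithmetic and finite sums in a constructively ordered field

module Reals {c ℓ₁ ℓ₂ ℓ₃} (ℝ : RealNumbers c ℓ₁ ℓ₂ ℓ₃) where

  open import Data.Integer.Base using (+_; -[1+_])

  open RealNumbers ℝ hiding (_·_; zero)
  open CommutativeRing commutativeRing public
    using (ring; semiring)
  open RingProperties ring
    using (-‿involutive; -0#≈0#; x[y-z]≈xy-xz; [y-z]x≈yx-zx; -‿anti-homo-+; -‿distribˡ-*; -‿distribʳ-*)
    renaming (-‿+-comm to -‿+)
  open IsStrictPartialOrder isStrictPartialOrder
    using (<-resp-≈) renaming (irrefl to <-irrefl; trans to <-trans)
  open SemiringMult semiring using (×-homo-+; ×1-homo-*; ×-congʳ; ×-assoc-*) renaming (_×_ to _·_)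
  open HeytingProperties heytingCommutativeRing public using (1#0; x-0≈x)
  open import Relation.Binary.Reasoning.Setoid setoid

  opaque
    -- Opaque, since unfolding a numeral such as `ι 1944` would make the type checker compare sums
    -- with that many terms.
    ι : ℕ → Carrier
    ι k = k · 1#

    ι-def : ∀ k → ι k ≈ k · 1#
    ι-def k = refl

    ·-ι : ∀ k x → k · x ≈ ι k * x
    ·-ι k x = trans (×-congʳ k (sym (*-identityˡ x))) (sym (×-assoc-* k 1# x))

    ι-0 : ι 0 ≈ 0#
    ι-0 = refl

    ι-suc : ∀ k → ι (suc k) ≈ 1# + ι k
    ι-suc k = refl

    ι-+ : ∀ j k → ι (j ℕ.+ k) ≈ ι j + ι k
    ι-+ = ×-homo-+ 1#

    ι-* : ∀ j k → ι (j ℕ.* k) ≈ ι j * ι k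
    ι-* = ×1-homo-*

  ι-1 : ι 1 ≈ 1#
  ι-1 = trans (ι-suc 0) (trans (+-congˡ ι-0) (+-identityʳ 1#))

  -- Lets the ring solver compute with integer coefficients, whose equality is decidable, unlike
  -- that of the reals.
  ιℤ : ℤ → Carrier
  ιℤ (+ k)      = ι k
  ιℤ (-[1+ k ]) = - ι (suc k)

  cancelˡ-minus : ∀ x y z → (x + y) - (x + z) ≈ y - z
  cancelˡ-minus x y z = begin
    (x + y) - (x + z)       ≈⟨ +-congˡ (-‿+ x z) ⟨
    (x + y) + (- x + - z)   ≈⟨ +-congʳ (+-comm x y) ⟩
    (y + x) + (- x + - z)   ≈⟨ +-assoc y x _ ⟩
    y + (x + (- x + - z))   ≈⟨ +-congˡ (+-assoc x (- x) (- z)) ⟨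
    y + ((x - x) + - z)     ≈⟨ +-congˡ (+-congʳ (-‿inverseʳ x)) ⟩
    y + (0# + - z)          ≈⟨ +-congˡ (+-identityˡ (- z)) ⟩
    y - z                   ∎

  ιℤ-⊖ : ∀ j k → ιℤ (j ℤ.⊖ k) ≈ ι j - ι k
  ιℤ-⊖ j zero = begin
    ι j        ≈⟨ x-0≈x (ι j) ⟨
    ι j - 0#   ≈⟨ +-congˡ (-‿cong ι-0) ⟨
    ι j - ι 0  ∎
  ιℤ-⊖ zero (suc k) = sym (trans (+-congʳ ι-0) (+-identityˡ _))
  ιℤ-⊖ (suc j) (suc k) = begin
    ιℤ (suc j ℤ.⊖ suc k)           ≡⟨ ≡.cong ιℤ (ℤ.[1+m]⊖[1+n]≡m⊖n j k) ⟩
    ιℤ (j ℤ.⊖ k)                   ≈⟨ ιℤ-⊖ j k ⟩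
    ι j - ι k                      ≈⟨ cancelˡ-minus 1# (ι j) (ι k) ⟨
    (1# + ι j) - (1# + ι k)        ≈⟨ +-cong (ι-suc j) (-‿cong (ι-suc k)) ⟨
    ι (suc j) - ι (suc k)          ∎

  ιℤ-+ : ∀ i j → ιℤ (i ℤ.+ j) ≈ ιℤ i + ιℤ j
  ιℤ-+ (+ j)      (+ k)      = ι-+ j k
  ιℤ-+ (+ j)      -[1+ k ]   = ιℤ-⊖ j (suc k)
  ιℤ-+ -[1+ j ]   (+ k)      = trans (ιℤ-⊖ k (suc j)) (+-comm _ _)
  ιℤ-+ -[1+ j ]   -[1+ k ]   = begin
    - ι (suc (suc (j ℕ.+ k)))    ≡⟨ ≡.cong (-_ ∘ ι ∘ suc) (ℕ.+-suc j k) ⟨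
    - ι (suc j ℕ.+ suc k)        ≈⟨ -‿cong (ι-+ (suc j) (suc k)) ⟩
    - (ι (suc j) + ι (suc k))    ≈⟨ -‿+ _ _ ⟨
    - ι (suc j) - ι (suc k)      ∎

  ιℤ-neg : ∀ i → ιℤ (ℤ.- i) ≈ - ιℤ i
  ιℤ-neg (+ zero)  = trans ι-0 (sym (trans (-‿cong ι-0) -0#≈0#))
  ιℤ-neg (+ suc k) = refl
  ιℤ-neg -[1+ k ]  = sym (-‿involutive _)

  ιℤ-*⁺ : ∀ j i → ιℤ (+ j ℤ.* i) ≈ ι j * ιℤ i
  ιℤ-*⁺ j (+ k) = trans (reflexive (≡.cong ιℤ (≡.sym (ℤ.pos-* j k)))) (ι-* j k)
  ιℤ-*⁺ j -[1+ k ] = begin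
    ιℤ (+ j ℤ.* (ℤ.- + suc k))    ≡⟨ ≡.cong ιℤ (ℤ.neg-distribʳ-* (+ j) (+ suc k)) ⟨
    ιℤ (ℤ.- (+ j ℤ.* + suc k))    ≈⟨ ιℤ-neg (+ j ℤ.* + suc k) ⟩
    - ιℤ (+ j ℤ.* + suc k)        ≈⟨ -‿cong (trans (reflexive (≡.cong ιℤ (≡.sym (ℤ.pos-* j (suc k))))) (ι-* j (suc k))) ⟩
    - (ι j * ι (suc k))           ≈⟨ -‿distribʳ-* _ _ ⟩
    ι j * - ι (suc k)             ∎

  ιℤ-* : ∀ i j → ιℤ (i ℤ.* j) ≈ ιℤ i * ιℤ j
  ιℤ-* (+ k)    j = ιℤ-*⁺ k j
  ιℤ-* -[1+ k ] j = begin
    ιℤ ((ℤ.- + suc k) ℤ.* j)      ≡⟨ ≡.cong ιℤ (ℤ.neg-distribˡ-* (+ suc k) j) ⟨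
    ιℤ (ℤ.- (+ suc k ℤ.* j))      ≈⟨ ιℤ-neg (+ suc k ℤ.* j) ⟩
    - ιℤ (+ suc k ℤ.* j)          ≈⟨ -‿cong (ιℤ-*⁺ (suc k) j) ⟩
    - (ι (suc k) * ιℤ j)          ≈⟨ -‿distribˡ-* _ _ ⟩
    - ι (suc k) * ιℤ j            ∎

  ιℤ-morphism : ℤ.+-*-rawRing -Raw-AlmostCommutative⟶ fromCommutativeRing commutativeRing
  ιℤ-morphism = record
    { ⟦_⟧ = ιℤ ; +-homo = ιℤ-+ ; *-homo = ιℤ-* ; -‿homo = ιℤ-neg ; 0-homo = ι-0 ; 1-homo = ι-1 }

  open Algebra.Solver.Ring ℤ.+-*-rawRing (fromCommutativeRing commutativeRing) ιℤ-morphism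
    (λ i j → Maybe.map (reflexive ∘ ≡.cong ιℤ) (dec⇒maybe (i ℤ.≟ j))) public
    using (solve; _:=_; _:+_; _:*_; _:-_; :-_; con)

  <-respˡ : ∀ {x y z} → x ≈ y → x < z → y < z
  <-respˡ = proj₂ <-resp-≈

  <-respʳ : ∀ {x y z} → y ≈ z → x < y → x < z
  <-respʳ = proj₁ <-resp-≈

  ≤-reflexive : ∀ {x y} → x ≈ y → x ≤ y
  ≤-reflexive x≈y = <-irrefl (sym x≈y)

  ≤-refl : ∀ {x} → x ≤ x
  ≤-refl = ≤-reflexive refl

  -- As `≤` is a negated strict inequality, `z < x` has to be refuted without trichotomy:
  -- cotransitivity of apartness separates `y` from `z` or from `x`, and either way a hypothesis is
  -- contradicted.
  ≤-trans : ∀ {x y z} → x ≤ y → y ≤ z → x ≤ z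
  ≤-trans {y = y} x≤y y≤z z<x with #-cotrans (<⇒# z<x) y
  ... | inj₁ z#y = [ y≤z , (λ y<z → x≤y (<-trans y<z z<x)) ]′ (#⇒<⊎> z#y)
  ... | inj₂ y#x = [ x≤y , (λ x<y → y≤z (<-trans z<x x<y)) ]′ (#⇒<⊎> y#x)

  <⇒≤ : ∀ {x y} → x < y → x ≤ y
  <⇒≤ x<y y<x = <-irrefl refl (<-trans x<y y<x)

  0≤y-x⇒x≤y : ∀ {x y} → 0# ≤ y - x → x ≤ y
  0≤y-x⇒x≤y {x} {y} 0≤y-x y<x =
    0≤y-x (<-respʳ (-‿inverseʳ x) (+-monoˡ-< (- x) y<x))

  x≤y⇒0≤y-x : ∀ {x y} → x ≤ y → 0# ≤ y - x
  x≤y⇒0≤y-x {x} {y} x≤y y-x<0 = x≤y (<-respˡ y-x+x (<-respʳ (+-identityˡ x) (+-monoˡ-< x y-x<0)))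
    where
    y-x+x : (y - x) + x ≈ y
    y-x+x = solve 2 (λ x y → (y :- x) :+ x := y) refl x y

  -- Every linear inequality below is proved by exhibiting the difference of
  -- its two sides as a sum of terms which are known to be nonnegative.
  ≤-by : ∀ {x y z} → 0# ≤ z → y - x ≈ z → x ≤ y
  ≤-by 0≤z y-x≈z = 0≤y-x⇒x≤y (≤-trans 0≤z (≤-reflexive (sym y-x≈z)))

  +-nonneg : ∀ {x y} → 0# ≤ x → 0# ≤ y → 0# ≤ x + y
  +-nonneg {x} {y} 0≤x 0≤y =
    ≤-trans 0≤x (≤-by 0≤y (solve 2 (λ x y → x :+ y :- x := y) refl x y))

  -- Apartness from zero is invertibility, and a factor of an invertible product is invertible.
  -- Hence, once a product is assumed negative, the signs of its factors can be distinguished by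
  -- cases.
  x*y#0⇒x#0 : ∀ {x y} → x * y # 0# → x # 0#
  x*y#0⇒x#0 {x} {y} xy#0 = invertible⇒# (y * z , yzx , trans (*-comm _ _) yzx)
    where
    z = proj₁ (#⇒invertible xy#0)
    yzx : y * z * (x - 0#) ≈ 1#
    yzx = begin
      y * z * (x - 0#)      ≈⟨ *-congˡ (x-0≈x x) ⟩
      y * z * x             ≈⟨ solve 3 (λ x y z → y :* z :* x := z :* (x :* y)) refl x y z ⟩
      z * (x * y)           ≈⟨ *-congˡ (x-0≈x (x * y)) ⟨
      z * (x * y - 0#)      ≈⟨ proj₁ (proj₂ (#⇒invertible xy#0)) ⟩
      1#                    ∎

  *-nonneg : ∀ {x y} → 0# ≤ x → 0# ≤ y → 0# ≤ x * y
  *-nonneg {x} {y} 0≤x 0≤y xy<0 = [ 0≤x , (λ 0<x → [ 0≤y , both 0<x ]′ (#⇒<⊎> y#0)) ]′ (#⇒<⊎> x#0)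
    where
    x#0 : x # 0#
    x#0 = x*y#0⇒x#0 (<⇒# xy<0)
    y#0 : y # 0#
    y#0 = x*y#0⇒x#0 (<⇒# (<-respˡ (*-comm x y) xy<0))
    both : 0# < x → ¬ (0# < y)
    both 0<x 0<y = <⇒≤ (*-positive 0<x 0<y) xy<0

  square-nonneg : ∀ x → 0# ≤ x * x
  square-nonneg x xx<0 = [ negative , (λ 0<x → <⇒≤ (*-positive 0<x 0<x) xx<0) ]′ (#⇒<⊎> x#0)
    where
    x#0 : x # 0#
    x#0 = x*y#0⇒x#0 (<⇒# xx<0)
    -x*-x : - x * - x ≈ x * x
    -x*-x = solve 1 (λ x → :- x :* :- x := x :* x) refl x
    negative : ¬ (x < 0#)
    negative x<0 = <⇒≤ (<-respʳ -x*-x (*-positive 0<-x 0<-x)) xx<0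
      where
      0<-x : 0# < - x
      0<-x = <-respˡ (-‿inverseʳ x) (<-respʳ (+-identityˡ (- x)) (+-monoˡ-< (- x) x<0))

  0≤1 : 0# ≤ 1#
  0≤1 = ≤-trans (square-nonneg 1#) (≤-reflexive (*-identityˡ 1#))

  0<1 : 0# < 1#
  0<1 = [ ⊥-elim ∘ 0≤1 , (λ 0<1 → 0<1) ]′ (#⇒<⊎> 1#0)

  ι-nonneg : ∀ k → 0# ≤ ι k
  ι-nonneg zero    = ≤-reflexive (sym ι-0)
  ι-nonneg (suc k) = ≤-trans (+-nonneg 0≤1 (ι-nonneg k)) (≤-reflexive (sym (ι-suc k)))

  +-mono-≤ : ∀ {x x′ y y′} → x ≤ x′ → y ≤ y′ → x + y ≤ x′ + y′
  +-mono-≤ {x} {x′} {y} {y′} x≤x′ y≤y′ =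
    ≤-by (+-nonneg (x≤y⇒0≤y-x x≤x′) (x≤y⇒0≤y-x y≤y′))
      (solve 4 (λ x x′ y y′ → (x′ :+ y′) :- (x :+ y) := (x′ :- x) :+ (y′ :- y)) refl x x′ y y′)

  *-monoˡ-≤ : ∀ {x y z} → 0# ≤ z → x ≤ y → z * x ≤ z * y
  *-monoˡ-≤ {x} {y} {z} 0≤z x≤y = ≤-by (*-nonneg 0≤z (x≤y⇒0≤y-x x≤y))
    (solve 3 (λ x y z → z :* y :- z :* x := z :* (y :- x)) refl x y z)

  ι-suc-pos : ∀ k → 0# < ι (suc k)
  ι-suc-pos zero    = <-respʳ (sym ι-1) 0<1
  ι-suc-pos (suc k) = <-respʳ (trans (+-comm _ _) (sym (ι-suc (suc k))))
    (<-trans (<-respʳ (sym (+-identityˡ 1#)) 0<1) (+-monoˡ-< 1# (ι-suc-pos k)))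

  -- The way back from real estimates to natural numbers: the order of ℕ is decidable, so a negated
  -- strict inequality is enough.
  ι-cancel-≤ : ∀ {j k} → ι j ≤ ι k → j ℕ.≤ k
  ι-cancel-≤ {j} {k} ιj≤ιk = ℕ.≮⇒≥ λ k<j →
    let d , j≡ = ℕ.m≤n⇒∃[o]m+o≡n k<j in
    ιj≤ιk (<-respʳ (eq d j≡) (<-respˡ (+-identityˡ _) (+-monoˡ-< (ι k) (ι-suc-pos d))))
    where
    eq : ∀ d → suc k ℕ.+ d ≡ j → ι (suc d) + ι k ≈ ι j
    eq d j≡ = trans (sym (ι-+ (suc d) k))
      (reflexive (≡.cong ι (≡.trans (≡.cong suc (ℕ.+-comm d k)) j≡)))

  open SemiringSum semiring public
    using (sum-cong-≋; ∑-distrib-+; sum-permute; *-distribˡ-sum; sum-replicate-zero)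

  sum-mono-≤ : ∀ {n} {f g : Fin n → Carrier} → (∀ i → f i ≤ g i) → sum f ≤ sum g
  sum-mono-≤ {zero}  f≤g = ≤-refl
  sum-mono-≤ {suc n} f≤g = +-mono-≤ (f≤g zero) (sum-mono-≤ (f≤g ∘ suc))

  sum-nonneg : ∀ {n} {f : Fin n → Carrier} → (∀ i → 0# ≤ f i) → 0# ≤ sum f
  sum-nonneg {n} 0≤f = ≤-trans (≤-reflexive (sym (sum-replicate-zero n))) (sum-mono-≤ 0≤f)

  term≤sum : ∀ {n} {f : Fin n → Carrier} → (∀ i → 0# ≤ f i) → ∀ i → f i ≤ sum f
  term≤sum {suc n} {f} 0≤f zero    = ≤-by (sum-nonneg (0≤f ∘ suc))
    (solve 2 (λ x y → x :+ y :- x := y) refl (f zero) (sum (f ∘ suc)))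
  term≤sum {suc n} {f} 0≤f (suc i) = ≤-trans (term≤sum (0≤f ∘ suc) i)
    (≤-by (0≤f zero) (solve 2 (λ x y → x :+ y :- y := x) refl (f zero) (sum (f ∘ suc))))

  sum-const : ∀ n {x} → sum {n} (λ _ → x) ≈ ι n * x
  sum-const zero    = sym (trans (*-congʳ ι-0) (zeroˡ _))
  sum-const (suc n) {x} = begin
    x + sum {n} (λ _ → x)   ≈⟨ +-congˡ (sum-const n) ⟩
    x + ι n * x             ≈⟨ +-congʳ (*-identityˡ x) ⟨
    1# * x + ι n * x        ≈⟨ distribʳ x 1# (ι n) ⟨
    (1# + ι n) * x          ≈⟨ *-congʳ (ι-suc n) ⟨
    ι (suc n) * x           ∎

-- Sums over the computational basis, shared by the real and the complex numbers

module BasisSum {a ℓ} (R : CommutativeSemiring a ℓ) where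

  open CommutativeSemiring R hiding (zero)
  open SemiringSum semiring
  open SemiringSum semiring public using () renaming (sum to ∑; sum-cong-≋ to ∑-cong)
  open import Relation.Binary.Reasoning.Setoid setoid

  private
    B : ℕ → ℕ → ℕ → Set
    B n σ w = Fin n × Fin σ × Fin w

    variable
      n σ w n′ σ′ w′ : ℕ

  Σᴮ : (B n σ w → Carrier) → Carrier
  Σᴮ f = sum λ i → sum λ b → sum λ k → f (i , b , k)

  Σ-cong : {f g : B n σ w → Carrier} → (∀ x → f x ≈ g x) → Σᴮ f ≈ Σᴮ g
  Σ-cong f≈g = sum-cong-≋ λ i → sum-cong-≋ λ b → sum-cong-≋ λ k → f≈g (i , b , k)

  Σ-+ : (f g : B n σ w → Carrier) → Σᴮ (λ x → f x + g x) ≈ Σᴮ f + Σᴮ g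
  Σ-+ f g = begin
    Σᴮ (λ x → f x + g x)
      ≈⟨ (sum-cong-≋ λ i → sum-cong-≋ λ b → ∑-distrib-+ (λ k → f (i , b , k)) _) ⟩
    (sum λ i → sum λ b → sum (λ k → f (i , b , k)) + sum (λ k → g (i , b , k)))
      ≈⟨ (sum-cong-≋ λ i → ∑-distrib-+ (λ b → sum λ k → f (i , b , k)) _) ⟩
    (sum λ i → sum (λ b → sum λ k → f (i , b , k)) + sum (λ b → sum λ k → g (i , b , k)))
      ≈⟨ ∑-distrib-+ (λ i → sum λ b → sum λ k → f (i , b , k)) _ ⟩
    Σᴮ f + Σᴮ g ∎

  Σ-*ˡ : ∀ c (f : B n σ w → Carrier) → Σᴮ (λ x → c * f x) ≈ c * Σᴮ f
  Σ-*ˡ c f = begin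
    Σᴮ (λ x → c * f x)
      ≈⟨ (sum-cong-≋ λ i → sum-cong-≋ λ b → sym (*-distribˡ-sum c (λ k → f (i , b , k)))) ⟩
    (sum λ i → sum λ b → c * sum (λ k → f (i , b , k)))
      ≈⟨ (sum-cong-≋ λ i → sym (*-distribˡ-sum c (λ b → sum λ k → f (i , b , k)))) ⟩
    (sum λ i → c * sum (λ b → sum λ k → f (i , b , k)))
      ≈⟨ *-distribˡ-sum c (λ i → sum λ b → sum λ k → f (i , b , k)) ⟨
    c * Σᴮ f ∎

  Σ-*ʳ : ∀ c (f : B n σ w → Carrier) → Σᴮ (λ x → f x * c) ≈ Σᴮ f * c
  Σ-*ʳ c f = trans (Σ-cong λ x → *-comm (f x) c) (trans (Σ-*ˡ c f) (*-comm c (Σᴮ f)))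

  Σ-sum : ∀ {m} (f : B n σ w → Fin m → Carrier) →
          Σᴮ (λ x → sum (f x)) ≈ sum λ j → Σᴮ λ x → f x j
  Σ-sum f = begin
    Σᴮ (λ x → sum (f x))
      ≈⟨ (sum-cong-≋ λ i → sum-cong-≋ λ b → ∑-comm λ k j → f (i , b , k) j) ⟩
    (sum λ i → sum λ b → sum λ j → sum λ k → f (i , b , k) j)
      ≈⟨ (sum-cong-≋ λ i → ∑-comm λ b j → sum λ k → f (i , b , k) j) ⟩
    (sum λ i → sum λ j → sum λ b → sum λ k → f (i , b , k) j)
      ≈⟨ (∑-comm λ i j → sum λ b → sum λ k → f (i , b , k) j) ⟩
    (sum λ j → Σᴮ λ x → f x j) ∎

  Σ-comm : (f : B n σ w → B n′ σ′ w′ → Carrier) →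
           Σᴮ (λ x → Σᴮ (f x)) ≈ Σᴮ λ y → Σᴮ λ x → f x y
  Σ-comm f = begin
    Σᴮ (λ x → Σᴮ (f x))
      ≈⟨ Σ-sum (λ x i → sum λ b → sum λ k → f x (i , b , k)) ⟩
    (sum λ i → Σᴮ λ x → sum λ b → sum λ k → f x (i , b , k))
      ≈⟨ (sum-cong-≋ λ i → Σ-sum λ x b → sum λ k → f x (i , b , k)) ⟩
    (sum λ i → sum λ b → Σᴮ λ x → sum λ k → f x (i , b , k))
      ≈⟨ (sum-cong-≋ λ i → sum-cong-≋ λ b → Σ-sum λ x k → f x (i , b , k)) ⟩
    Σᴮ (λ y → Σᴮ λ x → f x y) ∎

  indicator : Bool → Carrier
  indicator b = if b then 1# else 0#

  indicator-∧ : ∀ a b → indicator (a ∧ b) ≈ indicator a * indicator b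
  indicator-∧ true  b = sym (*-identityˡ _)
  indicator-∧ false b = sym (zeroˡ _)

  sum-indicator : (i : Fin n) (f : Fin n → Carrier) →
                  sum (λ j → indicator (does (i Fin.≟ j)) * f j) ≈ f i
  sum-indicator {suc n} zero f = begin
    1# * f zero + sum (λ j → 0# * f (suc j))
      ≈⟨ +-cong (*-identityˡ _) (sum-cong-≋ λ j → zeroˡ (f (suc j))) ⟩
    f zero + sum {n} (λ _ → 0#)   ≈⟨ +-congˡ (sum-replicate-zero n) ⟩
    f zero + 0#                   ≈⟨ +-identityʳ _ ⟩
    f zero                        ∎
  sum-indicator {suc n} (suc i) f = begin
    0# * f zero + sum (λ j → indicator (does (i Fin.≟ j)) * f (suc j))
      ≈⟨ +-cong (zeroˡ _) (sum-indicator i (f ∘ suc)) ⟩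
    0# + f (suc i)   ≈⟨ +-identityˡ _ ⟩
    f (suc i)        ∎

  δᴮ : B n σ w → B n σ w → Carrier
  δᴮ (i , b , k) (i′ , b′ , k′) =
    indicator (does (i Fin.≟ i′) ∧ does (b Fin.≟ b′) ∧ does (k Fin.≟ k′))

  Σ-δ : ∀ (x : B n σ w) (f : B n σ w → Carrier) → Σᴮ (λ y → δᴮ x y * f y) ≈ f x
  Σ-δ {n} {σ} {w} (i , b , k) f = begin
    Σᴮ (λ y → δᴮ (i , b , k) y * f y)
      ≈⟨ (Σ-cong {n} {σ} {w} λ (i′ , b′ , k′) →
            split (does (i Fin.≟ i′)) (does (b Fin.≟ b′)) (does (k Fin.≟ k′)) (f (i′ , b′ , k′))) ⟩
    (sum λ i′ → sum λ b′ → sum λ k′ → I i i′ * (I b b′ * (I k k′ * f (i′ , b′ , k′))))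
      ≈⟨ (sum-cong-≋ {n} λ i′ → sum-cong-≋ {σ} λ b′ →
            pull (I i i′) (I b b′) (λ k′ → I k k′ * f (i′ , b′ , k′))) ⟩
    (sum λ i′ → sum λ b′ → I i i′ * (I b b′ * sum λ k′ → I k k′ * f (i′ , b′ , k′)))
      ≈⟨ (sum-cong-≋ {n} λ i′ → sum-cong-≋ {σ} λ b′ →
            *-congˡ (*-congˡ (sum-indicator k λ k′ → f (i′ , b′ , k′)))) ⟩
    (sum λ i′ → sum λ b′ → I i i′ * (I b b′ * f (i′ , b′ , k)))
      ≈⟨ (sum-cong-≋ {n} λ i′ → *-distribˡ-sum (I i i′) (λ b′ → I b b′ * f (i′ , b′ , k))) ⟨
    (sum λ i′ → I i i′ * sum λ b′ → I b b′ * f (i′ , b′ , k))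
      ≈⟨ (sum-cong-≋ {n} λ i′ → *-congˡ (sum-indicator b λ b′ → f (i′ , b′ , k))) ⟩
    (sum λ i′ → I i i′ * f (i′ , b , k))
      ≈⟨ sum-indicator i (λ i′ → f (i′ , b , k)) ⟩
    f (i , b , k) ∎
    where
    I : ∀ {m} → Fin m → Fin m → Carrier
    I i j = indicator (does (i Fin.≟ j))
    split : ∀ a b c z → indicator (a ∧ b ∧ c) * z ≈ indicator a * (indicator b * (indicator c * z))
    split a b c z = begin
      indicator (a ∧ b ∧ c) * z                      ≈⟨ *-congʳ (indicator-∧ a (b ∧ c)) ⟩
      indicator a * indicator (b ∧ c) * z            ≈⟨ *-assoc _ _ _ ⟩
      indicator a * (indicator (b ∧ c) * z)          ≈⟨ *-congˡ (*-congʳ (indicator-∧ b c)) ⟩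
      indicator a * (indicator b * indicator c * z)  ≈⟨ *-congˡ (*-assoc _ _ _) ⟩
      indicator a * (indicator b * (indicator c * z)) ∎
    pull : ∀ {m} c d (g : Fin m → Carrier) → sum (λ k → c * (d * g k)) ≈ c * (d * sum g)
    pull c d g = sym (trans (*-congˡ (*-distribˡ-sum d g)) (*-distribˡ-sum c (λ k → d * g k)))

-- Complex amplitudes, and preservation of the norm by unitaries

module Norms {c ℓ₁ ℓ₂ ℓ₃} (ℝ : RealNumbers c ℓ₁ ℓ₂ ℓ₃) where

  open RealNumbers ℝ hiding (_·_; zero)
  open Reals ℝ
  open Quantum ℝ
  open import Relation.Binary.Reasoning.Setoid setoid

  ℂ-commutativeSemiring : CommutativeSemiring c ℓ₁
  ℂ-commutativeSemiring = record
    { Carrier = ℂ ; _≈_ = _≈ᶜ_ ; _+_ = _+ᶜ_ ; _*_ = _*ᶜ_ ; 0# = 0ᶜ ; 1# = 1ᶜ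
    ; isCommutativeSemiring = isCommutativeSemiringˡ record
      { +-isCommutativeMonoid = record
        { isMonoid = record
          { isSemigroup = record
            { isMagma = record
              { isEquivalence = ≈ᶜ-isEquivalence
              ; ∙-cong = λ (p , q) (r , s) → +-cong p r , +-cong q s }
            ; assoc = λ _ _ _ → +-assoc _ _ _ , +-assoc _ _ _ }
          ; identity = (λ _ → +-identityˡ _ , +-identityˡ _) , (λ _ → +-identityʳ _ , +-identityʳ _) }
        ; comm = λ _ _ → +-comm _ _ , +-comm _ _ }
      ; *-isCommutativeMonoid = record
        { isMonoid = record
          { isSemigroup = record
            { isMagma = record
              { isEquivalence = ≈ᶜ-isEquivalence
              ; ∙-cong = λ (p , q) (r , s) →
                  +-cong (*-cong p r) (-‿cong (*-cong q s)) , +-cong (*-cong p s) (*-cong q r) }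
            ; assoc = λ (a +i b) (c +i d) (e +i f) →
                solve 6 (λ a b c d e f → (a :* c :- b :* d) :* e :- (a :* d :+ b :* c) :* f
                                      := a :* (c :* e :- d :* f) :- b :* (c :* f :+ d :* e)) refl a b c d e f ,
                solve 6 (λ a b c d e f → (a :* c :- b :* d) :* f :+ (a :* d :+ b :* c) :* e
                                      := a :* (c :* f :+ d :* e) :+ b :* (c :* e :- d :* f)) refl a b c d e f }
          ; identity = 1ᶜ-identityˡ , λ z → trans′ (*ᶜ-comm z 1ᶜ) (1ᶜ-identityˡ z) }
        ; comm = *ᶜ-comm }
      ; distribʳ = λ (a +i b) (c +i d) (e +i f) →
          solve 6 (λ a b c d e f → (c :+ e) :* a :- (d :+ f) :* b
                                := (c :* a :- d :* b) :+ (e :* a :- f :* b)) refl a b c d e f ,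
          solve 6 (λ a b c d e f → (c :+ e) :* b :+ (d :+ f) :* a
                                := (c :* b :+ d :* a) :+ (e :* b :+ f :* a)) refl a b c d e f
      ; zeroˡ = λ (a +i b) →
          trans (+-cong (zeroˡ a) (-‿cong (zeroˡ b))) (-‿inverseʳ 0#) ,
          trans (+-cong (zeroˡ b) (zeroˡ a)) (+-identityˡ 0#)
      } }
    where
    trans′ : ∀ {x y z} → x ≈ᶜ y → y ≈ᶜ z → x ≈ᶜ z
    trans′ (p , q) (r , s) = trans p r , trans q s
    ≈ᶜ-isEquivalence : IsEquivalence _≈ᶜ_
    ≈ᶜ-isEquivalence = record
      { refl = refl , refl ; sym = λ (p , q) → sym p , sym q ; trans = trans′ }
    *ᶜ-comm : ∀ z w → z *ᶜ w ≈ᶜ w *ᶜ z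
    *ᶜ-comm (a +i b) (c +i d) =
      solve 4 (λ a b c d → a :* c :- b :* d := c :* a :- d :* b) refl a b c d ,
      solve 4 (λ a b c d → a :* d :+ b :* c := c :* b :+ d :* a) refl a b c d
    1ᶜ-identityˡ : ∀ z → 1ᶜ *ᶜ z ≈ᶜ z
    1ᶜ-identityˡ (a +i b) =
      trans (+-cong (*-identityˡ a) (-‿cong (zeroˡ b))) (x-0≈x a) ,
      trans (+-cong (*-identityˡ b) (zeroˡ a)) (+-identityʳ b)

  module ΣR = BasisSum (CommutativeRing.commutativeSemiring commutativeRing)
  module ΣC = BasisSum ℂ-commutativeSemiring
  module ℂR = CommutativeSemiring ℂ-commutativeSemiring

  private variable
    n σ w : ℕ

  infixl 6 _-ᶜ_

  _-ᶜ_ : ℂ → ℂ → ℂ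
  z -ᶜ w = (re z - re w) +i (im z - im w)

  ∣∣²-cong : ∀ {z w} → z ≈ᶜ w → ∣ z ∣² ≈ ∣ w ∣²
  ∣∣²-cong (p , q) = +-cong (*-cong p p) (*-cong q q)

  ∣∣²-nonneg : ∀ z → 0# ≤ ∣ z ∣²
  ∣∣²-nonneg z = +-nonneg (square-nonneg (re z)) (square-nonneg (im z))

  ∣∣²-* : ∀ z w → ∣ z *ᶜ w ∣² ≈ ∣ z ∣² * ∣ w ∣²
  ∣∣²-* (a +i b) (c +i d) = solve 4 (λ a b c d →
    (a :* c :- b :* d) :* (a :* c :- b :* d) :+ (a :* d :+ b :* c) :* (a :* d :+ b :* c)
    := (a :* a :+ b :* b) :* (c :* c :+ d :* d)) refl a b c d

  ‖_‖² : State {n} {σ} {w} → Carrier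
  ‖ ψ ‖² = Σᴿ λ x → ∣ ψ x ∣²

  dist² : State {n} {σ} {w} → State {n} {σ} {w} → Carrier
  dist² φ ψ = ‖ (λ x → φ x -ᶜ ψ x) ‖²

  conj-* : ∀ z w → conj (z *ᶜ w) ≈ᶜ conj z *ᶜ conj w
  conj-* (a +i b) (c +i d) =
    solve 4 (λ a b c d → a :* c :- b :* d := a :* c :- (:- b) :* (:- d)) refl a b c d ,
    solve 4 (λ a b c d → :- (a :* d :+ b :* c) := a :* (:- d) :+ (:- b) :* c) refl a b c d

  re-sum : ∀ {m} (f : Fin m → ℂ) → re (ΣC.∑ f) ≡ sum (re ∘ f)
  re-sum {zero}  f = ≡.refl
  re-sum {suc m} f = ≡.cong (λ x → re (f zero) + x) (re-sum (f ∘ suc))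

  conj-sum : ∀ {m} (f : Fin m → ℂ) → conj (ΣC.∑ f) ≈ᶜ ΣC.∑ (conj ∘ f)
  conj-sum {zero}  f = refl , trans (sym (+-identityˡ _)) (-‿inverseʳ 0#)
  conj-sum {suc m} f =
    +-congˡ (proj₁ (conj-sum (f ∘ suc))) ,
    trans (solve 2 (λ x y → :- (x :+ y) := :- x :+ :- y) refl _ _) (+-congˡ (proj₂ (conj-sum (f ∘ suc))))

  re-Σ : (f : State {n} {σ} {w}) → re (Σᶜ f) ≈ Σᴿ (re ∘ f)
  re-Σ {n} {σ} f = begin
    re (Σᶜ f)   ≡⟨ re-sum {n} _ ⟩
    (sum λ i → re (ΣC.∑ λ b → ΣC.∑ λ k → f (i , b , k)))  ≈⟨ (sum-cong-≋ {n} λ i → reflexive (re-sum {σ} _)) ⟩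
    (sum λ i → sum λ b → re (ΣC.∑ λ k → f (i , b , k)))
      ≈⟨ (sum-cong-≋ {n} λ i → sum-cong-≋ {σ} λ b → reflexive (re-sum λ k → f (i , b , k))) ⟩
    Σᴿ (re ∘ f) ∎

  conj-Σ : (f : State {n} {σ} {w}) → conj (Σᶜ f) ≈ᶜ Σᶜ (conj ∘ f)
  conj-Σ {n} {σ} f = ℂR.trans (conj-sum {n} λ i → ΣC.∑ λ b → ΣC.∑ λ k → f (i , b , k))
    (ΣC.∑-cong {n} λ i → ℂR.trans (conj-sum {σ} λ b → ΣC.∑ λ k → f (i , b , k))
    (ΣC.∑-cong {σ} λ b → conj-sum λ k → f (i , b , k)))

  actOn : Unitary n σ w → State {n} {σ} {w} → State {n} {σ} {w}
  actOn U ψ x = Σᶜ λ y → Unitary.entry U x y *ᶜ ψ y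

  inner : State {n} {σ} {w} → ℂ
  inner ψ = Σᶜ λ x → conj (ψ x) *ᶜ ψ x

  ‖‖²-inner : (ψ : State {n} {σ} {w}) → ‖ ψ ‖² ≈ re (inner ψ)
  ‖‖²-inner {n} {σ} {w} ψ = trans
    (ΣR.Σ-cong {n} {σ} {w} λ x → solve 2 (λ a b → a :* a :+ b :* b := a :* a :- (:- b) :* b) refl (re (ψ x)) (im (ψ x)))
    (sym (re-Σ {n} {σ} {w} λ x → conj (ψ x) *ᶜ ψ x))

  -- Expand both copies of `actOn U ψ`, move the sum over the row index `x` innermost, and collapse
  -- it by the orthonormality of the columns.
  inner-unitary : (U : Unitary n σ w) (ψ : State) → inner (actOn U ψ) ≈ᶜ inner ψ
  inner-unitary {n} {σ} {w} U v = R.begin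
    inner (actOn U v)
      R.≈⟨ (ΣC.Σ-cong {n} {σ} {w} λ x → ℂR.*-congʳ {actOn U v x} (conj-act x)) ⟩
    Σᶜ (λ x → Σᶜ (λ y → conj (u x y) *ᶜ conj (v y)) *ᶜ actOn U v x)
      R.≈⟨ (ΣC.Σ-cong {n} {σ} {w} λ x → ΣC.Σ-*ʳ {n} {σ} {w} (actOn U v x) λ y → conj (u x y) *ᶜ conj (v y)) ⟨
    Σᶜ (λ x → Σᶜ (λ y → conj (u x y) *ᶜ conj (v y) *ᶜ actOn U v x))
      R.≈⟨ (ΣC.Σ-cong {n} {σ} {w} λ x → ΣC.Σ-cong {n} {σ} {w} λ y →
             ΣC.Σ-*ˡ {n} {σ} {w} (conj (u x y) *ᶜ conj (v y)) λ y′ → u x y′ *ᶜ v y′) ⟨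
    Σᶜ (λ x → Σᶜ (λ y → Σᶜ λ y′ → conj (u x y) *ᶜ conj (v y) *ᶜ (u x y′ *ᶜ v y′)))
      R.≈⟨ (ΣC.Σ-cong {n} {σ} {w} λ x → ΣC.Σ-cong {n} {σ} {w} λ y → ΣC.Σ-cong {n} {σ} {w} λ y′ →
             interchange (conj (u x y)) (conj (v y)) (u x y′) (v y′)) ⟩
    Σᶜ (λ x → Σᶜ (λ y → Σᶜ λ y′ → conj (v y) *ᶜ v y′ *ᶜ (conj (u x y) *ᶜ u x y′)))
      R.≈⟨ (ΣC.Σ-comm {n} {σ} {w} {n} {σ} {w} λ x y → Σᶜ λ y′ → conj (v y) *ᶜ v y′ *ᶜ (conj (u x y) *ᶜ u x y′)) ⟩
    Σᶜ (λ y → Σᶜ (λ x → Σᶜ λ y′ → conj (v y) *ᶜ v y′ *ᶜ (conj (u x y) *ᶜ u x y′)))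
      R.≈⟨ (ΣC.Σ-cong {n} {σ} {w} λ y → ΣC.Σ-comm {n} {σ} {w} {n} {σ} {w} λ x y′ → conj (v y) *ᶜ v y′ *ᶜ (conj (u x y) *ᶜ u x y′)) ⟩
    Σᶜ (λ y → Σᶜ (λ y′ → Σᶜ λ x → conj (v y) *ᶜ v y′ *ᶜ (conj (u x y) *ᶜ u x y′)))
      R.≈⟨ (ΣC.Σ-cong {n} {σ} {w} λ y → ΣC.Σ-cong {n} {σ} {w} λ y′ →
             ℂR.trans (ΣC.Σ-*ˡ {n} {σ} {w} (conj (v y) *ᶜ v y′) λ x → conj (u x y) *ᶜ u x y′)
               (ℂR.trans (ℂR.*-congˡ {conj (v y) *ᶜ v y′} (Unitary.U*U≈1 U y y′))
                 (ℂR.*-comm (conj (v y) *ᶜ v y′) (δ y y′)))) ⟩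
    Σᶜ (λ y → Σᶜ (λ y′ → δ y y′ *ᶜ (conj (v y) *ᶜ v y′)))
      R.≈⟨ (ΣC.Σ-cong {n} {σ} {w} λ y → ΣC.Σ-δ {n} {σ} {w} y λ y′ → conj (v y) *ᶜ v y′) ⟩
    inner v R.∎
    where
    module R = SetoidReasoning ℂR.setoid
    u = Unitary.entry U
    conj-act : ∀ x → conj (actOn U v x) ≈ᶜ Σᶜ λ y → conj (u x y) *ᶜ conj (v y)
    conj-act x = ℂR.trans (conj-Σ {n} {σ} {w} λ y → u x y *ᶜ v y)
      (ΣC.Σ-cong {n} {σ} {w} λ y → conj-* (u x y) (v y))
    interchange : ∀ a b c d → a *ᶜ b *ᶜ (c *ᶜ d) ≈ᶜ b *ᶜ d *ᶜ (a *ᶜ c)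
    interchange a b c d = R.begin
      a *ᶜ b *ᶜ (c *ᶜ d)     R.≈⟨ ℂM.interchange a b c d ⟩
      a *ᶜ c *ᶜ (b *ᶜ d)     R.≈⟨ ℂR.*-comm (a *ᶜ c) (b *ᶜ d) ⟩
      b *ᶜ d *ᶜ (a *ᶜ c)     R.∎
      where module ℂM = CommutativeSemigroupProperties ℂR.*-commutativeSemigroup

  ‖‖²-unitary : (U : Unitary n σ w) (ψ : State) → ‖ actOn U ψ ‖² ≈ ‖ ψ ‖²
  ‖‖²-unitary U ψ = begin
    ‖ actOn U ψ ‖²          ≈⟨ ‖‖²-inner (actOn U ψ) ⟩
    re (inner (actOn U ψ))  ≈⟨ proj₁ (inner-unitary U ψ) ⟩
    re (inner ψ)            ≈⟨ ‖‖²-inner ψ ⟨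
    ‖ ψ ‖²                  ∎

-- Growth of the distance between runs on two texts

module Progress {c ℓ₁ ℓ₂ ℓ₃} (ℝ : RealNumbers c ℓ₁ ℓ₂ ℓ₃) where

  open RealNumbers ℝ hiding (_·_; zero)
  open Reals ℝ
  open Quantum ℝ
  open Norms ℝ
  open RingProperties ring using (-1*x≈-x; -0#≈0#)

  private variable
    n σ w : ℕ

  module _ {σ : ℕ} where
    open ≡.≡-Reasoning

    private
      N = suc σ

      reduce : ∀ x y → (x ℕ.% N ℕ.+ y) ℕ.% N ≡ (x ℕ.+ y) ℕ.% N
      reduce x y = begin
        (x ℕ.% N ℕ.+ y) ℕ.% N                    ≡⟨ ℕ.%-distribˡ-+ (x ℕ.% N) y N ⟩
        (x ℕ.% N ℕ.% N ℕ.+ y ℕ.% N) ℕ.% N        ≡⟨ ≡.cong (λ z → (z ℕ.+ y ℕ.% N) ℕ.% N) (ℕ.m%n%n≡m%n x N) ⟩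
        (x ℕ.% N ℕ.+ y ℕ.% N) ℕ.% N              ≡⟨ ℕ.%-distribˡ-+ x y N ⟨
        (x ℕ.+ y) ℕ.% N                          ∎

      full-turn : ∀ (b : Fin N) → (toℕ b ℕ.+ N) ℕ.% N ≡ toℕ b
      full-turn b = ≡.trans (ℕ.[m+n]%n≡m%n (toℕ b) N) (ℕ.m<n⇒m%n≡m (Fin.toℕ<n b))

    ⊖-⊕ : ∀ (b a : Fin N) → (b ⊖ a) ⊕ a ≡ b
    ⊖-⊕ b a = Fin.toℕ-injective (begin
      toℕ ((b ⊖ a) ⊕ a)                                        ≡⟨ Fin.toℕ-fromℕ< _ ⟩
      (toℕ (b ⊖ a) ℕ.+ toℕ a) ℕ.% N                            ≡⟨ ≡.cong (λ z → (z ℕ.+ toℕ a) ℕ.% N) (Fin.toℕ-fromℕ< (ℕ.m%n<n (toℕ b ℕ.+ (N ℕ.∸ toℕ a)) N)) ⟩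
      ((toℕ b ℕ.+ (N ℕ.∸ toℕ a)) ℕ.% N ℕ.+ toℕ a) ℕ.% N        ≡⟨ reduce (toℕ b ℕ.+ (N ℕ.∸ toℕ a)) (toℕ a) ⟩
      (toℕ b ℕ.+ (N ℕ.∸ toℕ a) ℕ.+ toℕ a) ℕ.% N                ≡⟨ ≡.cong (ℕ._% N) (ℕ.+-assoc (toℕ b) _ _) ⟩
      (toℕ b ℕ.+ (N ℕ.∸ toℕ a ℕ.+ toℕ a)) ℕ.% N                ≡⟨ ≡.cong (λ z → (toℕ b ℕ.+ z) ℕ.% N) (ℕ.m∸n+n≡m (Fin.toℕ≤n a)) ⟩
      (toℕ b ℕ.+ N) ℕ.% N                                      ≡⟨ full-turn b ⟩
      toℕ b                                                    ∎)

    ⊕-⊖ : ∀ (b a : Fin N) → (b ⊕ a) ⊖ a ≡ b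
    ⊕-⊖ b a = Fin.toℕ-injective (begin
      toℕ ((b ⊕ a) ⊖ a)                                        ≡⟨ Fin.toℕ-fromℕ< _ ⟩
      (toℕ (b ⊕ a) ℕ.+ (N ℕ.∸ toℕ a)) ℕ.% N                    ≡⟨ ≡.cong (λ z → (z ℕ.+ (N ℕ.∸ toℕ a)) ℕ.% N) (Fin.toℕ-fromℕ< (ℕ.m%n<n (toℕ b ℕ.+ toℕ a) N)) ⟩
      ((toℕ b ℕ.+ toℕ a) ℕ.% N ℕ.+ (N ℕ.∸ toℕ a)) ℕ.% N        ≡⟨ reduce (toℕ b ℕ.+ toℕ a) (N ℕ.∸ toℕ a) ⟩
      (toℕ b ℕ.+ toℕ a ℕ.+ (N ℕ.∸ toℕ a)) ℕ.% N                ≡⟨ ≡.cong (ℕ._% N) (ℕ.+-assoc (toℕ b) _ _) ⟩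
      (toℕ b ℕ.+ (toℕ a ℕ.+ (N ℕ.∸ toℕ a))) ℕ.% N              ≡⟨ ≡.cong (λ z → (toℕ b ℕ.+ z) ℕ.% N) (ℕ.m+[n∸m]≡n (Fin.toℕ≤n a)) ⟩
      (toℕ b ℕ.+ N) ℕ.% N                                      ≡⟨ full-turn b ⟩
      toℕ b                                                    ∎)

  sum-⊖ : ∀ (a : Fin σ) (f : Fin σ → Carrier) → sum (λ b → f (b ⊖ a)) ≈ sum f
  sum-⊖ {suc σ} a f = sym (sum-permute f (permutation (_⊖ a) (_⊕ a) (λ b → ⊕-⊖ b a) (λ b → ⊖-⊕ b a)))

  sum-⊕ : ∀ (a : Fin σ) (f : Fin σ → Carrier) → sum (λ b → f (b ⊕ a)) ≈ sum f
  sum-⊕ {suc σ} a f = sym (sum-permute f (permutation (_⊕ a) (_⊖ a) (λ b → ⊖-⊕ b a) (λ b → ⊕-⊖ b a)))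

  -- The common form of `query` and `query⁻¹`.
  oracle : (Fin n → Fin σ → Fin σ) → State {n} {σ} {w} → State {n} {σ} {w}
  oracle π ψ (i , b , k) = ψ (i , π i b , k)

  -- Stands for the bijectivity of each `π i`, in the form in which it is applied: reindexing a sum
  -- over the answer register.
  SumPreserving : (Fin n → Fin σ → Fin σ) → Set _
  SumPreserving {σ = σ} π = ∀ i (f : Fin σ → Carrier) → sum (λ b → f (π i b)) ≈ sum f

  massAt : State {n} {σ} {w} → Fin n → Carrier
  massAt ψ i = sum λ b → sum λ k → ∣ ψ (i , b , k) ∣²

  massAt-nonneg : ∀ (ψ : State {n} {σ} {w}) i → 0# ≤ massAt ψ i
  massAt-nonneg {n} {σ} {w} ψ i = sum-nonneg {σ} λ b → sum-nonneg {w} λ k → ∣∣²-nonneg (ψ (i , b , k))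

  massAt-oracle : ∀ (π : Fin n → Fin σ → Fin σ) → SumPreserving π →
                  ∀ (ψ : State {n} {σ} {w}) i → massAt (oracle π ψ) i ≈ massAt ψ i
  massAt-oracle π π-sum ψ i = π-sum i λ b → sum λ k → ∣ ψ (i , b , k) ∣²

  private
    sum₂ : (Fin σ → Fin w → Carrier) → Carrier
    sum₂ f = sum λ b → sum (f b)

    sum₂-linear : ∀ (u v : Fin σ → Fin w → Carrier) α β →
                  sum₂ (λ b k → α * u b k + β * v b k) ≈ α * sum₂ u + β * sum₂ v
    sum₂-linear {σ} {w} u v α β = trans (sum-cong-≋ {σ} λ b → linear (u b) (v b))
      (linear (λ b → sum (u b)) (λ b → sum (v b)))
      where
      linear : ∀ {m} (f g : Fin m → Carrier) → sum (λ i → α * f i + β * g i) ≈ α * sum f + β * sum g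
      linear {m} f g = trans (∑-distrib-+ (λ i → α * f i) (λ i → β * g i))
        (+-cong (sym (*-distribˡ-sum α f)) (sym (*-distribˡ-sum β g)))

    -- Expands `|s z + w|² ≥ 0`, which bounds the cross term by AM-GM; the factor `s` on the left
    -- takes the place of a division by `s`.
    upper : ∀ s z w → s * ∣ z -ᶜ w ∣² ≤ (s + s * s) * ∣ z ∣² + (s + 1#) * ∣ w ∣²
    upper s z@(a +i b) w@(c +i d) = ≤-by (∣∣²-nonneg ((s * a + c) +i (s * b + d))) (trans (+-congʳ (+-congˡ (*-congʳ (+-congˡ (sym ι-1)))))
      (solve 5 (λ s a b c d →
        (s :+ s :* s) :* (a :* a :+ b :* b) :+ (s :+ con (ℤ.+ 1)) :* (c :* c :+ d :* d)
          :- s :* ((a :- c) :* (a :- c) :+ (b :- d) :* (b :- d))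
        := (s :* a :+ c) :* (s :* a :+ c) :+ (s :* b :+ d) :* (s :* b :+ d)) refl s a b c d))

    -- Expands `|s z - w|² ≥ 0`. This bound falls short of the one in `upper` by exactly
    -- `2 (s² |z|² + |w|²)`, the origin of `gain`.
    lower : ∀ s z w → (s - s * s) * ∣ z ∣² + (s - 1#) * ∣ w ∣² ≤ s * ∣ z -ᶜ w ∣²
    lower s z@(a +i b) w@(c +i d) = ≤-by (∣∣²-nonneg ((s * a - c) +i (s * b - d))) (trans (+-congˡ (-‿cong (+-congˡ (*-congʳ (+-congˡ (-‿cong (sym ι-1)))))))
      (solve 5 (λ s a b c d →
        s :* ((a :- c) :* (a :- c) :+ (b :- d) :* (b :- d))
          :- ((s :- s :* s) :* (a :* a :+ b :* b) :+ (s :- con (ℤ.+ 1)) :* (c :* c :+ d :* d))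
        := (s :* a :- c) :* (s :* a :- c) :+ (s :* b :- d) :* (s :* b :- d)) refl s a b c d))

  module _ (π ρ : Fin n → Fin σ → Fin σ) (π-sum : SumPreserving π) (ρ-sum : SumPreserving ρ)
           (s : Carrier) (φ ψ : State {n} {σ} {w}) where

    private
      distAt : State {n} {σ} {w} → State {n} {σ} {w} → Fin n → Carrier
      distAt φ ψ = massAt (λ x → φ x -ᶜ ψ x)

      φ′ ψ′ : State {n} {σ} {w}
      φ′ = oracle π φ
      ψ′ = oracle ρ ψ

    gain : Fin n → Carrier
    gain i = ι 2 * (s * s * massAt φ i + massAt ψ i)

    distAt-oracle-same : ∀ j → (∀ b → π j b ≡ ρ j b) → distAt φ′ ψ′ j ≈ distAt φ ψ j
    distAt-oracle-same j πj≡ρj = begin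
      distAt φ′ ψ′ j
        ≈⟨ (sum-cong-≋ {σ} λ b → sum-cong-≋ {w} λ k →
              reflexive (≡.cong (λ b′ → ∣ φ (j , π j b , k) -ᶜ ψ (j , b′ , k) ∣²) (≡.sym (πj≡ρj b)))) ⟩
      distAt (oracle π φ) (oracle π ψ) j
        ≈⟨ massAt-oracle π π-sum (λ x → φ x -ᶜ ψ x) j ⟩
      distAt φ ψ j ∎
      where open import Relation.Binary.Reasoning.Setoid setoid

    -- Both masses at `i` survive the oracle call. So the distance after it obeys `upper` and the
    -- distance before it obeys `lower` with the same masses, and the growth is at most the gap
    -- between the two bounds.
    distAt-oracle : ∀ i → s * distAt φ′ ψ′ i ≤ s * distAt φ ψ i + gain i
    distAt-oracle i = ≤-trans after (≤-trans (≤-reflexive algebra) (+-mono-≤ before ≤-refl))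
      where
      u : State {n} {σ} {w} → Fin σ → Fin w → Carrier
      u ψ b k = ∣ ψ (i , b , k) ∣²
      d : State {n} {σ} {w} → State {n} {σ} {w} → Fin σ → Fin w → Carrier
      d φ ψ b k = ∣ φ (i , b , k) -ᶜ ψ (i , b , k) ∣²
      scaled : ∀ φ ψ → sum₂ (λ b k → s * d φ ψ b k) ≈ s * distAt φ ψ i
      scaled φ ψ = trans (sum-cong-≋ {σ} λ b → sym (*-distribˡ-sum s (d φ ψ b)))
        (sym (*-distribˡ-sum s (λ b → sum (d φ ψ b))))
      after : s * distAt φ′ ψ′ i ≤ (s + s * s) * massAt φ i + (s + 1#) * massAt ψ i
      after = ≤-trans (≤-reflexive (sym (scaled φ′ ψ′)))
        (≤-trans (sum-mono-≤ {σ} λ b → sum-mono-≤ {w} λ k → upper s (φ′ (i , b , k)) (ψ′ (i , b , k)))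
        (≤-reflexive (trans (sum₂-linear (u φ′) (u ψ′) _ _)
          (+-cong (*-congˡ (massAt-oracle π π-sum φ i)) (*-congˡ (massAt-oracle ρ ρ-sum ψ i))))))
      before : (s - s * s) * massAt φ i + (s - 1#) * massAt ψ i ≤ s * distAt φ ψ i
      before = ≤-trans (≤-reflexive (sym (sum₂-linear (u φ) (u ψ) _ _)))
        (≤-trans (sum-mono-≤ {σ} λ b → sum-mono-≤ {w} λ k → lower s (φ (i , b , k)) (ψ (i , b , k)))
        (≤-reflexive (scaled φ ψ)))
      algebra : (s + s * s) * massAt φ i + (s + 1#) * massAt ψ i ≈
                ((s - s * s) * massAt φ i + (s - 1#) * massAt ψ i) + gain i
      algebra = begin
        (s + s * s) * p + (s + 1#) * q            ≈⟨ +-congˡ (*-congʳ (+-congˡ (sym ι-1))) ⟩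
        (s + s * s) * p + (s + ι 1) * q
          ≈⟨ solve 3 (λ s p q → (s :+ s :* s) :* p :+ (s :+ con (ℤ.+ 1)) :* q
               := ((s :- s :* s) :* p :+ (s :- con (ℤ.+ 1)) :* q) :+ con (ℤ.+ 2) :* (s :* s :* p :+ q)) refl s p q ⟩
        ((s - s * s) * p + (s - ι 1) * q) + ι 2 * (s * s * p + q)
          ≈⟨ +-congʳ (+-congˡ (*-congʳ (+-congˡ (-‿cong ι-1)))) ⟩
        ((s - s * s) * p + (s - 1#) * q) + ι 2 * (s * s * p + q) ∎
        where
        open import Relation.Binary.Reasoning.Setoid setoid
        p = massAt φ i
        q = massAt ψ i

    dist²-oracle : ∀ i → (∀ j → j ≢ i → ∀ b → π j b ≡ ρ j b) →
                   s * dist² φ′ ψ′ ≤ s * dist² φ ψ + gain i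
    dist²-oracle i agree = ≤-trans (≤-reflexive (*-distribˡ-sum {n} s (distAt φ′ ψ′)))
      (≤-trans (sum-mono-≤ {n} position)
      (≤-reflexive (trans (∑-distrib-+ {n} (λ j → s * distAt φ ψ j) (λ j → I j * gain i))
        (+-cong (sym (*-distribˡ-sum {n} s (distAt φ ψ))) (ΣR.sum-indicator i (λ _ → gain i))))))
      where
      I : Fin n → Carrier
      I j = ΣR.indicator (does (i Fin.≟ j))
      position : ∀ j → s * distAt φ′ ψ′ j ≤ s * distAt φ ψ j + I j * gain i
      position j with i Fin.≟ j
      ... | yes ≡.refl = ≤-trans (distAt-oracle i) (≤-reflexive (+-congˡ (sym (*-identityˡ _))))
      ... | no i≢j     = ≤-reflexive (trans (*-congˡ (distAt-oracle-same j (agree j (i≢j ∘ ≡.sym))))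
                           (trans (sym (+-identityʳ _)) (+-congˡ (sym (zeroˡ _)))))

  -- The query magnitude of position `i` known from the hybrid method, for a start state that may be
  -- unnormalised.
  queryMass : Text σ n → List (Step n σ w) → State {n} {σ} {w} → Fin n → Carrier
  queryMass T []                 ψ i = 0#
  queryMass T (unitary U ∷ ss)   ψ i = queryMass T ss (apply T (unitary U) ψ) i
  queryMass T (query ∷ ss)       ψ i = massAt ψ i + queryMass T ss (apply T query ψ) i
  queryMass T (query⁻¹ ∷ ss)     ψ i = massAt ψ i + queryMass T ss (apply T query⁻¹ ψ) i

  queryMass-nonneg : ∀ (T : Text σ n) ss (ψ : State {n} {σ} {w}) i → 0# ≤ queryMass T ss ψ i
  queryMass-nonneg T []               ψ i = ≤-refl
  queryMass-nonneg T (unitary U ∷ ss) ψ i = queryMass-nonneg T ss _ i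
  queryMass-nonneg T (query ∷ ss)     ψ i = +-nonneg (massAt-nonneg ψ i) (queryMass-nonneg T ss _ i)
  queryMass-nonneg T (query⁻¹ ∷ ss)   ψ i = +-nonneg (massAt-nonneg ψ i) (queryMass-nonneg T ss _ i)

  ‖‖²-oracle : ∀ (π : Fin n → Fin σ → Fin σ) → SumPreserving π →
               ∀ (ψ : State {n} {σ} {w}) → ‖ oracle π ψ ‖² ≈ ‖ ψ ‖²
  ‖‖²-oracle {n} π π-sum ψ = sum-cong-≋ {n} (massAt-oracle π π-sum ψ)

  ‖‖²-apply : ∀ (T : Text σ n) st (ψ : State {n} {σ} {w}) → ‖ apply T st ψ ‖² ≈ ‖ ψ ‖²
  ‖‖²-apply T (unitary U) ψ = ‖‖²-unitary U ψ
  ‖‖²-apply T query       ψ = ‖‖²-oracle (λ i b → b ⊖ T i) (λ i → sum-⊖ (T i)) ψ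
  ‖‖²-apply T query⁻¹     ψ = ‖‖²-oracle (λ i b → b ⊕ T i) (λ i → sum-⊕ (T i)) ψ

  ‖‖²-run : ∀ (T : Text σ n) ss (ψ : State {n} {σ} {w}) → ‖ run T ss ψ ‖² ≈ ‖ ψ ‖²
  ‖‖²-run T []        ψ = refl
  ‖‖²-run T (st ∷ ss) ψ = trans (‖‖²-run T ss (apply T st ψ)) (‖‖²-apply T st ψ)

  private
    add-query : ∀ {m x y} → y ≈ ι m * x → x + y ≈ ι (suc m) * x
    add-query {m} {x} {y} y≈mx = trans (+-cong (sym (*-identityˡ x)) y≈mx)
      (trans (sym (distribʳ x 1# (ι m))) (*-congʳ (sym (ι-suc m))))

  -- At each oracle call the masses of all positions add up to the squared norm, which every step
  -- preserves.
  sum-queryMass : ∀ (T : Text σ n) ss (ψ : State {n} {σ} {w}) →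
                  sum (queryMass T ss ψ) ≈ ι (queryCount ss) * ‖ ψ ‖²
  sum-queryMass {n = n} T [] ψ = trans (sum-replicate-zero n) (trans (sym (zeroˡ _)) (*-congʳ (sym ι-0)))
  sum-queryMass T (unitary U ∷ ss) ψ =
    trans (sum-queryMass T ss (apply T (unitary U) ψ)) (*-congˡ (‖‖²-apply T (unitary U) ψ))
  sum-queryMass {n = n} T (query ∷ ss) ψ = trans
    (∑-distrib-+ {n} (massAt ψ) (queryMass T ss (apply T query ψ)))
    (add-query (trans (sum-queryMass T ss (apply T query ψ)) (*-congˡ (‖‖²-apply T query ψ))))
  sum-queryMass {n = n} T (query⁻¹ ∷ ss) ψ = trans
    (∑-distrib-+ {n} (massAt ψ) (queryMass T ss (apply T query⁻¹ ψ)))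
    (add-query (trans (sum-queryMass T ss (apply T query⁻¹ ψ)) (*-congˡ (‖‖²-apply T query⁻¹ ψ))))

  private
    -1ᶜ : ℂ
    -1ᶜ = (- 1#) +i 0#

    -ᶜ-as-+ᶜ : ∀ z w → z -ᶜ w ≈ᶜ z +ᶜ -1ᶜ *ᶜ w
    -ᶜ-as-+ᶜ (a +i b) (c +i d) =
      +-congˡ (sym (trans (+-cong (-1*x≈-x c) (trans (-‿cong (zeroˡ d)) -0#≈0#)) (+-identityʳ _))) ,
      +-congˡ (sym (trans (+-cong (-1*x≈-x d) (zeroˡ c)) (+-identityʳ _)))

  actOn-cong : ∀ (U : Unitary n σ w) {φ ψ : State {n} {σ} {w}} → (∀ x → φ x ≈ᶜ ψ x) → ∀ x → actOn U φ x ≈ᶜ actOn U ψ x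
  actOn-cong {n} {σ} {w} U φ≈ψ x = ΣC.Σ-cong {n} {σ} {w} λ y → ℂR.*-congˡ {Unitary.entry U x y} (φ≈ψ y)

  actOn-* : ∀ (U : Unitary n σ w) a (ψ : State {n} {σ} {w}) x →
            actOn U (λ y → a *ᶜ ψ y) x ≈ᶜ a *ᶜ actOn U ψ x
  actOn-* {n} {σ} {w} U a ψ x = ℂR.trans
    (ΣC.Σ-cong {n} {σ} {w} λ y → x∙yz≈y∙xz (Unitary.entry U x y) a (ψ y))
    (ΣC.Σ-*ˡ {n} {σ} {w} a λ y → Unitary.entry U x y *ᶜ ψ y)
    where open CommutativeSemigroupProperties ℂR.*-commutativeSemigroup using (x∙yz≈y∙xz)

  actOn-minus : ∀ (U : Unitary n σ w) (φ ψ : State {n} {σ} {w}) x →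
                actOn U φ x -ᶜ actOn U ψ x ≈ᶜ actOn U (λ y → φ y -ᶜ ψ y) x
  actOn-minus {n} {σ} {w} U φ ψ x = begin
    actOn U φ x -ᶜ actOn U ψ x                       ≈⟨ -ᶜ-as-+ᶜ _ _ ⟩
    actOn U φ x +ᶜ -1ᶜ *ᶜ actOn U ψ x                ≈⟨ ℂR.+-congˡ {actOn U φ x} (actOn-* U -1ᶜ ψ x) ⟨
    actOn U φ x +ᶜ actOn U (λ y → -1ᶜ *ᶜ ψ y) x      ≈⟨ ΣC.Σ-+ {n} {σ} {w} (λ y → u y *ᶜ φ y) (λ y → u y *ᶜ (-1ᶜ *ᶜ ψ y)) ⟨
    Σᶜ (λ y → u y *ᶜ φ y +ᶜ u y *ᶜ (-1ᶜ *ᶜ ψ y))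
      ≈⟨ (ΣC.Σ-cong {n} {σ} {w} λ y → ℂR.trans
            (ℂR.sym (ℂR.distribˡ (u y) (φ y) (-1ᶜ *ᶜ ψ y)))
            (ℂR.*-congˡ {u y} (ℂR.sym (-ᶜ-as-+ᶜ (φ y) (ψ y))))) ⟩
    actOn U (λ y → φ y -ᶜ ψ y) x                     ∎
    where
    open import Relation.Binary.Reasoning.Setoid ℂR.setoid
    u = Unitary.entry U x

  dist²-unitary : ∀ (U : Unitary n σ w) (φ ψ : State {n} {σ} {w}) →
                  dist² (actOn U φ) (actOn U ψ) ≈ dist² φ ψ
  dist²-unitary {n} {σ} {w} U φ ψ = trans
    (ΣR.Σ-cong {n} {σ} {w} λ x → ∣∣²-cong (actOn-minus U φ ψ x))
    (‖‖²-unitary U (λ x → φ x -ᶜ ψ x))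

  apply-cong : ∀ (T : Text σ n) st {φ ψ : State {n} {σ} {w}} → (∀ x → φ x ≈ᶜ ψ x) →
               ∀ x → apply T st φ x ≈ᶜ apply T st ψ x
  apply-cong T (unitary U) φ≈ψ x = actOn-cong U φ≈ψ x
  apply-cong T query       φ≈ψ x = φ≈ψ _
  apply-cong T query⁻¹     φ≈ψ x = φ≈ψ _

  run-cong : ∀ (T : Text σ n) ss {φ ψ : State {n} {σ} {w}} → (∀ x → φ x ≈ᶜ ψ x) →
             ∀ x → run T ss φ x ≈ᶜ run T ss ψ x
  run-cong T []        φ≈ψ = φ≈ψ
  run-cong T (st ∷ ss) φ≈ψ = run-cong T ss (apply-cong T st φ≈ψ)

  apply-* : ∀ (T : Text σ n) st a (ψ : State {n} {σ} {w}) x →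
            apply T st (λ y → a *ᶜ ψ y) x ≈ᶜ a *ᶜ apply T st ψ x
  apply-* T (unitary U) a ψ x = actOn-* U a ψ x
  apply-* T query       a ψ x = ℂR.refl
  apply-* T query⁻¹     a ψ x = ℂR.refl

  -- Relates an unnormalised branch, entered with amplitude `a`, to the run from a basis state that
  -- defines `Pr`.
  run-* : ∀ (T : Text σ n) ss a (ψ : State {n} {σ} {w}) x →
          run T ss (λ y → a *ᶜ ψ y) x ≈ᶜ a *ᶜ run T ss ψ x
  run-* T []        a ψ x = ℂR.refl
  run-* T (st ∷ ss) a ψ x = ℂR.trans (run-cong T ss (apply-* T st a ψ) x) (run-* T ss a (apply T st ψ) x)

  -- The hybrid argument: only queries at the position i where the texts differ
  -- drive the two computations apart, and s² : 1 weights them by AM-GM.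
  dist²-run : ∀ s (T T′ : Text σ n) i → (∀ j → j ≢ i → T j ≡ T′ j) →
              ∀ ss (φ ψ : State {n} {σ} {w}) →
              s * dist² (run T ss φ) (run T′ ss ψ) ≤
              s * dist² φ ψ + ι 2 * (s * s * queryMass T ss φ i + queryMass T′ ss ψ i)
  dist²-run {σ} {n} {w} s T T′ i T≡T′ = go
    where
    Bound : List (Step n σ w) → State {n} {σ} {w} → State {n} {σ} {w} → Set _
    Bound ss φ ψ = s * dist² (run T ss φ) (run T′ ss ψ) ≤
      s * dist² φ ψ + ι 2 * (s * s * queryMass T ss φ i + queryMass T′ ss ψ i)

    after-query : ∀ {x y z p q p′ q′} → x ≤ y + ι 2 * (s * s * p + q) → y ≤ z + ι 2 * (s * s * p′ + q′) →
                  x ≤ z + ι 2 * (s * s * (p′ + p) + (q′ + q))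
    after-query {x} {y} {z} {p} {q} {p′} {q′} x≤ y≤ = ≤-by
      (+-nonneg (x≤y⇒0≤y-x x≤) (x≤y⇒0≤y-x y≤))
      (solve 8 (λ s x y z p q p′ q′ →
        z :+ con (ℤ.+ 2) :* (s :* s :* (p′ :+ p) :+ (q′ :+ q)) :- x :=
        (y :+ con (ℤ.+ 2) :* (s :* s :* p :+ q) :- x) :+ (z :+ con (ℤ.+ 2) :* (s :* s :* p′ :+ q′) :- y))
        refl s x y z p q p′ q′)

    go : ∀ ss φ ψ → Bound ss φ ψ
    go [] φ ψ = ≤-reflexive (sym (trans (+-congˡ (trans (*-congˡ (trans (+-congʳ (zeroʳ _)) (+-identityˡ 0#))) (zeroʳ _))) (+-identityʳ _)))
    go (unitary U ∷ ss) φ ψ = ≤-trans (go ss (actOn U φ) (actOn U ψ))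
      (≤-reflexive (+-congʳ (*-congˡ (dist²-unitary U φ ψ))))
    go (query ∷ ss) φ ψ = after-query (go ss (apply T query φ) (apply T′ query ψ))
      (dist²-oracle (λ j b → b ⊖ T j) (λ j b → b ⊖ T′ j) (λ j → sum-⊖ (T j)) (λ j → sum-⊖ (T′ j)) s φ ψ i
        (λ j j≢i b → ≡.cong (b ⊖_) (T≡T′ j j≢i)))
    go (query⁻¹ ∷ ss) φ ψ = after-query (go ss (apply T query⁻¹ φ) (apply T′ query⁻¹ ψ))
      (dist²-oracle (λ j b → b ⊕ T j) (λ j b → b ⊕ T′ j) (λ j → sum-⊕ (T j)) (λ j → sum-⊕ (T′ j)) s φ ψ i
        (λ j j≢i b → ≡.cong (b ⊕_) (T≡T′ j j≢i)))

-- Telling two states apart by a measurement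

module Measurement {c ℓ₁ ℓ₂ ℓ₃} (ℝ : RealNumbers c ℓ₁ ℓ₂ ℓ₃) where

  open RealNumbers ℝ hiding (_·_; zero)
  open Reals ℝ
  open Quantum ℝ
  open Norms ℝ
  open Progress ℝ

  private variable
    n σ w : ℕ

  Σ-mono-≤ : {f g : Basis n σ w → Carrier} → (∀ x → f x ≤ g x) → Σᴿ f ≤ Σᴿ g
  Σ-mono-≤ {n} {σ} {w} f≤g =
    sum-mono-≤ {n} λ i → sum-mono-≤ {σ} λ b → sum-mono-≤ {w} λ k → f≤g (i , b , k)

  Σ-nonneg : {f : Basis n σ w → Carrier} → (∀ x → 0# ≤ f x) → 0# ≤ Σᴿ f
  Σ-nonneg {n} {σ} {w} 0≤f =
    sum-nonneg {n} λ i → sum-nonneg {σ} λ b → sum-nonneg {w} λ k → 0≤f (i , b , k)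

  Σ-linear : ∀ α β (f g : Basis n σ w → Carrier) →
             Σᴿ (λ x → α * f x + β * g x) ≈ α * Σᴿ f + β * Σᴿ g
  Σ-linear α β f g = trans (ΣR.Σ-+ (λ x → α * f x) (λ x → β * g x))
    (+-cong (ΣR.Σ-*ˡ α f) (ΣR.Σ-*ˡ β g))

  when : Bool → Carrier → Carrier
  when b x = if b then x else 0#

  when-* : ∀ b x y → when b (x * y) ≈ x * when b y
  when-* true  x y = refl
  when-* false x y = sym (zeroʳ x)

  when-cong : ∀ b {x y} → x ≈ y → when b x ≈ when b y
  when-cong true  x≈y = x≈y
  when-cong false x≈y = refl

  mass : (Basis n σ w → Bool) → State {n} {σ} {w} → Carrier
  mass p ψ = Σᴿ λ x → when (p x) ∣ ψ x ∣²

  dist²-nonneg : ∀ (φ ψ : State {n} {σ} {w}) → 0# ≤ dist² φ ψ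
  dist²-nonneg φ ψ = Σ-nonneg λ x → ∣∣²-nonneg (φ x -ᶜ ψ x)

  -- Expands `|3 z - 4 w|² ≥ 0`. It is `|z|² ≤ (1 + ε) |w|² + (1 + 1/ε) |z - w|²` with `ε = 1/3`,
  -- cleared of denominators.
  ∣∣²-perturb : ∀ z w → ι 3 * ∣ z ∣² ≤ ι 4 * ∣ w ∣² + ι 12 * ∣ z -ᶜ w ∣²
  ∣∣²-perturb (a +i b) (c +i d) =
    ≤-by (∣∣²-nonneg ((ι 3 * a - ι 4 * c) +i (ι 3 * b - ι 4 * d)))
      (solve 4 (λ a b c d →
        con (ℤ.+ 4) :* (c :* c :+ d :* d) :+ con (ℤ.+ 12) :* ((a :- c) :* (a :- c) :+ (b :- d) :* (b :- d))
          :- con (ℤ.+ 3) :* (a :* a :+ b :* b)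
        := (con (ℤ.+ 3) :* a :- con (ℤ.+ 4) :* c) :* (con (ℤ.+ 3) :* a :- con (ℤ.+ 4) :* c)
          :+ (con (ℤ.+ 3) :* b :- con (ℤ.+ 4) :* d) :* (con (ℤ.+ 3) :* b :- con (ℤ.+ 4) :* d)) refl a b c d)

  ∣∣²-perturb′ : ∀ z w → ι 3 * ∣ w ∣² ≤ ι 4 * ∣ z ∣² + ι 12 * ∣ z -ᶜ w ∣²
  ∣∣²-perturb′ z w = ≤-trans (∣∣²-perturb w z) (≤-reflexive (+-congˡ (*-congˡ
    (solve 4 (λ a b c d → (c :- a) :* (c :- a) :+ (d :- b) :* (d :- b) := (a :- c) :* (a :- c) :+ (b :- d) :* (b :- d))
      refl (re z) (im z) (re w) (im w)))))

  scale : ∀ k {x y} → x ≤ y → 0# ≤ ι k * (y - x)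
  scale k x≤y = *-nonneg (ι-nonneg k) (x≤y⇒0≤y-x x≤y)

  -- The mass of `φ` on `p` is charged to `ψ` at the rate 4/3, plus a multiple of the distance. As
  -- `q` is disjoint from `p`, only the mass of `ψ` outside `q` is charged, at most a third of
  -- `‖ ψ ‖²`. The two norms are kept apart because the branches of one outcome may have different
  -- probabilities under the two texts.
  distinguishable : ∀ (p q : Basis n σ w → Bool) → (∀ x → p x ≡ true → q x ≡ false) →
                    (φ ψ : State {n} {σ} {w}) →
                    ι 2 * ‖ φ ‖² ≤ ι 3 * mass p φ → ι 2 * ‖ ψ ‖² ≤ ι 3 * mass q ψ →
                    ι 6 * ‖ φ ‖² ≤ ι 4 * ‖ ψ ‖² + ι 36 * dist² φ ψ
  distinguishable {n} {σ} {w} p q disjoint φ ψ hφ hψ = ≤-by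
    (+-nonneg (+-nonneg (scale 3 total) (scale 3 hφ)) (scale 4 hψ))
    (solve 5 (λ U V E P Q →
      con (ℤ.+ 4) :* V :+ con (ℤ.+ 36) :* E :- con (ℤ.+ 6) :* U :=
      con (ℤ.+ 3) :* (con (ℤ.+ 4) :* V :+ con (ℤ.+ 12) :* E :- (con (ℤ.+ 3) :* P :+ con (ℤ.+ 4) :* Q))
      :+ con (ℤ.+ 3) :* (con (ℤ.+ 3) :* P :- con (ℤ.+ 2) :* U)
      :+ con (ℤ.+ 4) :* (con (ℤ.+ 3) :* Q :- con (ℤ.+ 2) :* V))
      refl ‖ φ ‖² ‖ ψ ‖² (dist² φ ψ) (mass p φ) (mass q ψ))
    where
    u v e : Basis n σ w → Carrier
    u x = ∣ φ x ∣²
    v x = ∣ ψ x ∣²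
    e x = ∣ φ x -ᶜ ψ x ∣²

    pointwise : ∀ x a b → (a ≡ true → b ≡ false) →
                ι 3 * when a (u x) + ι 4 * when b (v x) ≤ ι 4 * v x + ι 12 * e x
    pointwise x true true a→¬b with () ← a→¬b ≡.refl
    pointwise x true false _ = ≤-trans
      (≤-reflexive (trans (+-congˡ (zeroʳ _)) (+-identityʳ _)))
      (∣∣²-perturb (φ x) (ψ x))
    pointwise x false true _ =
      ≤-by (*-nonneg (ι-nonneg 12) (∣∣²-nonneg (φ x -ᶜ ψ x)))
        (trans (+-congˡ (-‿cong (trans (+-congʳ (zeroʳ _)) (+-identityˡ _))))
          (solve 2 (λ v e → v :+ e :- v := e) refl (ι 4 * v x) (ι 12 * e x)))
    pointwise x false false _ = ≤-trans
      (≤-reflexive (trans (+-cong (zeroʳ _) (zeroʳ _)) (+-identityˡ 0#)))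
      (+-nonneg (*-nonneg (ι-nonneg 4) (∣∣²-nonneg (ψ x))) (*-nonneg (ι-nonneg 12) (∣∣²-nonneg (φ x -ᶜ ψ x))))

    total : ι 3 * mass p φ + ι 4 * mass q ψ ≤ ι 4 * ‖ ψ ‖² + ι 12 * dist² φ ψ
    total = ≤-trans (≤-reflexive (sym (Σ-linear (ι 3) (ι 4) (λ x → when (p x) (u x)) (λ x → when (q x) (v x)))))
      (≤-trans (Σ-mono-≤ λ x → pointwise x (p x) (q x) (disjoint x))
        (≤-reflexive (Σ-linear (ι 4) (ι 12) v e)))

  ∣indicator∣² : ∀ b → ∣ (if b then 1ᶜ else 0ᶜ) ∣² ≈ ΣR.indicator b * 1#
  ∣indicator∣² true  = trans (+-congˡ (zeroˡ 0#)) (+-identityʳ _)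
  ∣indicator∣² false = trans (+-cong (zeroˡ 0#) (zeroˡ 0#)) (trans (+-identityʳ 0#) (sym (zeroˡ 1#)))

  ‖δ‖² : ∀ (x : Basis n σ w) → ‖ δ x ‖² ≈ 1#
  ‖δ‖² {n} {σ} {w} x = trans (ΣR.Σ-cong {n} {σ} {w} λ y → ∣indicator∣² _) (ΣR.Σ-δ x (λ _ → 1#))

  ‖‖²-* : ∀ a (ψ : State {n} {σ} {w}) → ‖ (λ x → a *ᶜ ψ x) ‖² ≈ ∣ a ∣² * ‖ ψ ‖²
  ‖‖²-* {n} {σ} {w} a ψ = trans (ΣR.Σ-cong {n} {σ} {w} λ x → ∣∣²-* a (ψ x)) (ΣR.Σ-*ˡ ∣ a ∣² (λ x → ∣ ψ x ∣²))

  ‖*δ‖² : ∀ a (x : Basis n σ w) → ‖ (λ y → a *ᶜ δ x y) ‖² ≈ ∣ a ∣²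
  ‖*δ‖² a x = trans (‖‖²-* a (δ x)) (trans (*-congˡ (‖δ‖² x)) (*-identityʳ _))

  dist²-*δ : ∀ a b (x : Basis n σ w) → dist² (λ y → a *ᶜ δ x y) (λ y → b *ᶜ δ x y) ≈ ∣ a -ᶜ b ∣²
  dist²-*δ {n} {σ} {w} a b x = trans
    (ΣR.Σ-cong {n} {σ} {w} λ y → ∣∣²-cong (factor a b (δ x y))) (‖*δ‖² (a -ᶜ b) x)
    where
    factor : ∀ a b z → a *ᶜ z -ᶜ b *ᶜ z ≈ᶜ (a -ᶜ b) *ᶜ z
    factor (a +i b) (c +i d) (e +i f) =
      solve 6 (λ a b c d e f → (a :* e :- b :* f) :- (c :* e :- d :* f) := (a :- c) :* e :- (b :- d) :* f) refl a b c d e f ,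
      solve 6 (λ a b c d e f → (a :* f :+ b :* e) :- (c :* f :+ d :* e) := (a :- c) :* f :+ (b :- d) :* e) refl a b c d e f

  dist²-self : ∀ (ψ : State {n} {σ} {w}) → dist² ψ ψ ≈ 0#
  dist²-self {n} {σ} {w} ψ = trans (ΣR.Σ-cong {n} {σ} {w} λ x → vanish (ψ x)) (trans (ΣR.Σ-*ˡ {n} {σ} {w} 0# (λ _ → 0#)) (zeroˡ _))
    where
    vanish : ∀ z → ∣ z -ᶜ z ∣² ≈ 0# * 0#
    vanish (a +i b) = trans (solve 2 (λ a b → (a :- a) :* (a :- a) :+ (b :- b) :* (b :- b) := con (ℤ.+ 0)) refl a b)
      (trans ι-0 (sym (zeroˡ 0#)))

  queryCount≤length : ∀ (ss : List (Step n σ w)) → queryCount ss ℕ.≤ length ss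
  queryCount≤length []               = ℕ.z≤n
  queryCount≤length (unitary _ ∷ ss) = ℕ.m≤n⇒m≤1+n (queryCount≤length ss)
  queryCount≤length (query ∷ ss)     = ℕ.s≤s (queryCount≤length ss)
  queryCount≤length (query⁻¹ ∷ ss)   = ℕ.s≤s (queryCount≤length ss)

  ι-mono-≤ : ∀ {j k} → j ℕ.≤ k → ι j ≤ ι k
  ι-mono-≤ {j} {k} j≤k with d , ≡.refl ← ℕ.m≤n⇒∃[o]m+o≡n j≤k =
    ≤-by (ι-nonneg d) (trans (+-congʳ (ι-+ j d)) (solve 2 (λ x y → x :+ y :- x := y) refl (ι j) (ι d)))

  atLeast⅔ : ∀ {p} → AtLeast⅔ p → ι 2 ≤ ι 3 * p
  atLeast⅔ {p} h = ≤-trans (≤-reflexive (ι-def 2)) (≤-trans h (≤-reflexive (·-ι 3 p)))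

-- Adversary weights for a construction followed by one suffix array query

module Weights {c ℓ₁ ℓ₂ ℓ₃} (ℝ : RealNumbers c ℓ₁ ℓ₂ ℓ₃) where

  open import Data.Fin.Subset using (Subset; _∈_; ⁅_⁆)
  open import Data.Fin.Subset.Properties using (_∈?_; x∈⁅y⁆⇒x≡y)

  open RealNumbers ℝ hiding (_·_; zero)
  open Reals ℝ
  open Quantum ℝ
  open Norms ℝ
  open Progress ℝ
  open Measurement ℝ

  module _ {n σ : ℕ} (A : SAConstruction n σ) (t : ℕ) (j : Fin n) where

    open SAConstruction A
    open Algorithm using (start; steps; output)

    private
      wᵇ = Algorithm.w build

      Outcome : Set
      Outcome = Basis n σ wᵇ

      answerTo : Outcome → Algorithm n σ n
      answerTo z = answer (output build z) j

      wᵃ : Outcome → ℕ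
      wᵃ z = Algorithm.w (answerTo z)

      -- Only a data structure which answers in time t is ever run.
      restrict : ∀ {z} → Dec (time (answerTo z) ℕ.≤ t) → List (Step n σ (wᵃ z))
      restrict {z} (yes _) = steps (answerTo z)
      restrict     (no _)  = []

      timely : ∀ z → List (Step n σ (wᵃ z))
      timely z = restrict {z} (time (answerTo z) ℕ.≤? t)

      -- An outcome outside the good set may have an arbitrarily slow answering algorithm; without
      -- the cut-off it would spoil the bound on the total weight.
      length-timely : ∀ z → length (timely z) ℕ.≤ t
      length-timely z = bounded (time (answerTo z) ℕ.≤? t)
        where
        bounded : ∀ d → length (restrict {z} d) ℕ.≤ t
        bounded (yes p) = p
        bounded (no _)  = ℕ.z≤n

      timely-steps : ∀ z → time (answerTo z) ℕ.≤ t → timely z ≡ steps (answerTo z)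
      timely-steps z p = unrestricted (time (answerTo z) ℕ.≤? t)
        where
        unrestricted : ∀ d → restrict {z} d ≡ steps (answerTo z)
        unrestricted (yes _) = ≡.refl
        unrestricted (no ¬p) = contradiction p ¬p

      built : Text σ n → State {n} {σ} {wᵇ}
      built T = run T (steps build) (δ (start build))

      -- Branches are indexed by the measured basis state rather than by the data structure, and
      -- keep its complex amplitude. The squared distances of the entering branches for two texts
      -- thus add up to that of the built states.
      entering leaving : Text σ n → ∀ z → State {n} {σ} {wᵃ z}
      entering T z x = built T z *ᶜ δ (start (answerTo z)) x
      leaving T z    = run T (timely z) (entering T z)

      buildMass answerMass : Text σ n → Fin n → Carrier
      buildMass T  = queryMass T (steps build) (δ (start build))
      answerMass T i = Σᴿ λ z → queryMass T (timely z) (entering T z) i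

      α : Text σ n → Outcome → Carrier
      α T z = ∣ built T z ∣²

    -- Refers to no second text, so that a single weight function serves all neighbours of `T`. The
    -- constants are those that come out of `adversary`.
    weight : Text σ n → Fin n → Carrier
    weight T i = ι 1944 * buildMass T i + ι 1296 * answerMass T i

    weight-nonneg : ∀ T i → 0# ≤ weight T i
    weight-nonneg T i = +-nonneg
      (*-nonneg (ι-nonneg 1944) (queryMass-nonneg T (steps build) (δ (start build)) i))
      (*-nonneg (ι-nonneg 1296) (Σ-nonneg λ z → queryMass-nonneg T (timely z) (entering T z) i))

    ‖built‖² : ∀ T → ‖ built T ‖² ≈ 1#
    ‖built‖² T = trans (‖‖²-run T (steps build) (δ (start build))) (‖δ‖² (start build))

    -- The masses within branch `z` add up to at most `t` times its probability `α T z`. These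
    -- probabilities sum to 1, so all branches together contribute at most `t`.
    sum-weight : ∀ T → sum (weight T) ≤ ι (1944 ℕ.* queries build ℕ.+ 1296 ℕ.* t)
    sum-weight T = ≤-trans (≤-reflexive split)
      (≤-trans (+-mono-≤ (*-monoˡ-≤ (ι-nonneg 1944) build-bound) (*-monoˡ-≤ (ι-nonneg 1296) answer-bound))
        (≤-reflexive (sym (trans (ι-+ _ _) (+-cong (ι-* 1944 (queries build)) (ι-* 1296 t))))))
      where
      split : sum (weight T) ≈ ι 1944 * sum (buildMass T) + ι 1296 * sum (answerMass T)
      split = trans (∑-distrib-+ {n} (λ i → ι 1944 * buildMass T i) (λ i → ι 1296 * answerMass T i))
        (+-cong (sym (*-distribˡ-sum {n} (ι 1944) (buildMass T))) (sym (*-distribˡ-sum {n} (ι 1296) (answerMass T))))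
      build-bound : sum (buildMass T) ≤ ι (queries build)
      build-bound = ≤-reflexive (trans (sum-queryMass T (steps build) (δ (start build)))
        (trans (*-congˡ (‖δ‖² (start build))) (*-identityʳ _)))
      one : ∀ z → sum (queryMass T (timely z) (entering T z)) ≤ ι t * α T z
      one z = ≤-trans (≤-reflexive (trans (sum-queryMass T (timely z) (entering T z))
          (trans (*-congˡ (‖*δ‖² (built T z) (start (answerTo z)))) (*-comm _ _))))
        (≤-trans (*-monoˡ-≤ (∣∣²-nonneg (built T z))
            (ι-mono-≤ (ℕ.≤-trans (queryCount≤length (timely z)) (length-timely z))))
          (≤-reflexive (*-comm _ _)))
      answer-bound : sum (answerMass T) ≤ ι t
      answer-bound = ≤-trans (≤-reflexive (sym (ΣR.Σ-sum λ z i → queryMass T (timely z) (entering T z) i)))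
        (≤-trans (Σ-mono-≤ one) (≤-reflexive (trans (ΣR.Σ-*ˡ (ι t) (α T))
          (trans (*-congˡ (‖built‖² T)) (*-identityʳ _)))))

    ‖leaving‖² : ∀ T z → ‖ leaving T z ‖² ≈ α T z
    ‖leaving‖² T z = trans (‖‖²-run T (timely z) (entering T z)) (‖*δ‖² (built T z) (start (answerTo z)))

    correct : Text σ n → ∀ z → Basis n σ (wᵃ z) → Bool
    correct T z x = does (output (answerTo z) x ∈? ⁅ SA T j ⁆)

    -- The guarantee of 2/3 is about a normalised run; by linearity both sides scale with `α T z`.
    mass-leaving : ∀ T z {S} → output build z ∈ S → (∀ d → d ∈ S → SupportsSA A d T t) →
                   ι 2 * ‖ leaving T z ‖² ≤ ι 3 * mass (correct T z) (leaving T z)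
    mass-leaving T z z∈S supports = ≤-trans
      (≤-reflexive (trans (*-congˡ (‖leaving‖² T z)) (*-comm _ _)))
      (≤-trans (*-monoˡ-≤ (∣∣²-nonneg (built T z)) (atLeast⅔ (proj₂ supported)))
      (≤-reflexive (sym (trans (*-congˡ scaled) (trans (sym (*-assoc _ _ _)) (trans (*-congʳ (*-comm _ _)) (*-assoc _ _ _)))))))
      where
      supported : time (answerTo z) ℕ.≤ t × AtLeast⅔ (Pr (answerTo z) T ⁅ SA T j ⁆)
      supported = supports (output build z) z∈S j
      scaled : mass (correct T z) (leaving T z) ≈ α T z * Pr (answerTo z) T ⁅ SA T j ⁆
      scaled = trans
        (ΣR.Σ-cong {n} {σ} {wᵃ z} λ x → trans
          (when-cong (correct T z x) (trans
            (reflexive (≡.cong (λ ss → ∣ run T ss (entering T z) x ∣²) (timely-steps z (proj₁ supported))))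
            (trans (∣∣²-cong (run-* T (steps (answerTo z)) (built T z) (δ (start (answerTo z))) x))
              (∣∣²-* (built T z) _))))
          (when-* (correct T z x) (α T z) _))
        (ΣR.Σ-*ˡ {n} {σ} {wᵃ z} (α T z) (λ x → when (correct T z x) ∣ run T (steps (answerTo z)) (δ (start (answerTo z))) x ∣²))

    module _ (T T′ : Text σ n) (answers-differ : SA T j ≢ SA T′ j) where

      private
        Δ E : Outcome → Carrier
        Δ z = ∣ built T z -ᶜ built T′ z ∣²
        E z = dist² (leaving T z) (leaving T′ z)

        ΔE-nonneg : ∀ z → 0# ≤ ι 324 * Δ z + ι 648 * E z
        ΔE-nonneg z = +-nonneg (*-nonneg (ι-nonneg 324) (∣∣²-nonneg (built T z -ᶜ built T′ z)))
          (*-nonneg (ι-nonneg 648) (dist²-nonneg (leaving T z) (leaving T′ z)))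

        correct-disjoint : ∀ z x → correct T z x ≡ true → correct T′ z x ≡ false
        correct-disjoint z x hit with output (answerTo z) x ∈? ⁅ SA T j ⁆ | hit
        ... | yes p | _ = dec-false (output (answerTo z) x ∈? ⁅ SA T′ j ⁆)
                (λ q → answers-differ (≡.trans (≡.sym (x∈⁅y⁆⇒x≡y _ p)) (x∈⁅y⁆⇒x≡y _ q)))

      module _ (cT : Constructs A T t) (cT′ : Constructs A T′ t) where

        private
          S S′ : Subset size
          S         = proj₁ cT
          S′        = proj₁ cT′
          supports  = proj₁ (proj₂ cT)
          supports′ = proj₁ (proj₂ cT′)

        -- If z is a valid data structure for both texts, then it must answer
        -- differently; if it is valid for T′ only, then its probabilities differ.
        pointwise : ∀ z → ι 12 * when (does (output build z ∈? S)) (α T z)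
                        + ι 9 * when (does (output build z ∈? S′)) (α T′ z)
                        ≤ (ι 324 * Δ z + ι 648 * E z) + ι 12 * α T z
        pointwise z with output build z ∈? S | output build z ∈? S′
        -- With `a`, `b` the two probabilities, the facts are `6 a ≤ 4 b + 36 e` and
        -- `3 b ≤ 4 a + 12 d`. The multipliers 18 and 27 cancel `a`, since `18 · 6 = 27 · 4`; what
        -- remains is `9 b ≤ 324 d + 648 e`, with `b` surviving because `4/6 · 4/3 < 1`.
        ... | yes p | yes p′ = ≤-by
          (+-nonneg (scale 18 answers) (scale 27 (∣∣²-perturb′ (built T z) (built T′ z))))
          (solve 4 (λ a b d e →
            con (ℤ.+ 324) :* d :+ con (ℤ.+ 648) :* e :+ con (ℤ.+ 12) :* a :- (con (ℤ.+ 12) :* a :+ con (ℤ.+ 9) :* b) :=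
            con (ℤ.+ 18) :* (con (ℤ.+ 4) :* b :+ con (ℤ.+ 36) :* e :- con (ℤ.+ 6) :* a)
            :+ con (ℤ.+ 27) :* (con (ℤ.+ 4) :* a :+ con (ℤ.+ 12) :* d :- con (ℤ.+ 3) :* b))
            refl (α T z) (α T′ z) (Δ z) (E z))
          where
          answers : ι 6 * α T z ≤ ι 4 * α T′ z + ι 36 * E z
          answers = ≤-trans (≤-reflexive (*-congˡ (sym (‖leaving‖² T z)))) (≤-trans
            (distinguishable (correct T z) (correct T′ z) (correct-disjoint z)
              (leaving T z) (leaving T′ z) (mass-leaving T z p supports) (mass-leaving T′ z p′ supports′))
            (≤-reflexive (+-congʳ (*-congˡ (‖leaving‖² T′ z)))))
        ... | yes _ | no _   = ≤-trans (≤-reflexive (trans (+-congˡ (zeroʳ _)) (+-identityʳ _)))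
          (≤-by (ΔE-nonneg z) (solve 2 (λ x y → x :+ y :- y := x) refl _ _))
        ... | no _  | yes _  = ≤-trans (≤-reflexive (trans (+-congʳ (zeroʳ _)) (+-identityˡ _))) (≤-by
          (+-nonneg (scale 3 (∣∣²-perturb′ (built T z) (built T′ z)))
            (+-nonneg (*-nonneg (ι-nonneg 288) (∣∣²-nonneg (built T z -ᶜ built T′ z)))
                      (*-nonneg (ι-nonneg 648) (dist²-nonneg (leaving T z) (leaving T′ z)))))
          (solve 4 (λ a b d e →
            con (ℤ.+ 324) :* d :+ con (ℤ.+ 648) :* e :+ con (ℤ.+ 12) :* a :- con (ℤ.+ 9) :* b :=
            con (ℤ.+ 3) :* (con (ℤ.+ 4) :* a :+ con (ℤ.+ 12) :* d :- con (ℤ.+ 3) :* b)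
            :+ (con (ℤ.+ 288) :* d :+ con (ℤ.+ 648) :* e))
            refl (α T z) (α T′ z) (Δ z) (E z)))
        ... | no _  | no _   = ≤-trans (≤-reflexive (trans (+-cong (zeroʳ _) (zeroʳ _)) (+-identityˡ _)))
          (+-nonneg (ΔE-nonneg z) (*-nonneg (ι-nonneg 12) (∣∣²-nonneg (built T z))))

        -- Sum `pointwise` over all outcomes: the success probabilities make the left side at least
        -- `12 · 2/3 + 9 · 2/3 = 14`, against a constant 12 on the right.
        separation : ι 2 ≤ ι 324 * Σᴿ Δ + ι 648 * Σᴿ E
        separation = ≤-by
          (+-nonneg (x≤y⇒0≤y-x total)
            (+-nonneg (scale 4 (atLeast⅔ {P} (proj₂ (proj₂ cT)))) (scale 3 (atLeast⅔ {P′} (proj₂ (proj₂ cT′))))))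
          (solve 4 (λ d e p p′ →
            con (ℤ.+ 324) :* d :+ con (ℤ.+ 648) :* e :- con (ℤ.+ 2) :=
            (con (ℤ.+ 324) :* d :+ con (ℤ.+ 648) :* e :+ con (ℤ.+ 12) :* con (ℤ.+ 1) :- (con (ℤ.+ 12) :* p :+ con (ℤ.+ 9) :* p′))
            :+ (con (ℤ.+ 4) :* (con (ℤ.+ 3) :* p :- con (ℤ.+ 2)) :+ con (ℤ.+ 3) :* (con (ℤ.+ 3) :* p′ :- con (ℤ.+ 2))))
            refl (Σᴿ Δ) (Σᴿ E) P P′)
          where
          P P′ : Carrier
          P  = Pr build T S
          P′ = Pr build T′ S′
          total : ι 12 * P + ι 9 * P′ ≤ (ι 324 * Σᴿ Δ + ι 648 * Σᴿ E) + ι 12 * ι 1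
          total = ≤-trans
            (≤-reflexive (sym (Σ-linear (ι 12) (ι 9) (λ z → when (does (output build z ∈? S)) (α T z))
                                                     (λ z → when (does (output build z ∈? S′)) (α T′ z)))))
            (≤-trans (Σ-mono-≤ pointwise) (≤-reflexive (trans
              (ΣR.Σ-+ (λ z → ι 324 * Δ z + ι 648 * E z) (λ z → ι 12 * α T z))
              (+-cong (Σ-linear (ι 324) (ι 648) Δ E)
                (trans (ΣR.Σ-*ˡ (ι 12) (α T)) (*-congˡ (trans (‖built‖² T) (sym ι-1))))))))

        -- `s` times `separation` is combined with 648 times the progress of the answers and
        -- `972 = 324 + 648` times that of the construction, which cancels both distances. The
        -- progress bounds carry a factor 2, whence `1296 = 2 · 648` and `1944 = 2 · 972`.
        adversary : ∀ i → (∀ k → k ≢ i → T k ≡ T′ k) → ∀ s →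
                    ι 2 * ι s ≤ ι s * ι s * weight T i + weight T′ i
        adversary i agree s = ≤-by
          (+-nonneg (*-nonneg (ι-nonneg s) (x≤y⇒0≤y-x separation))
            (+-nonneg (scale 648 answer-progress) (scale 972 build-progress)))
          (solve 7 (λ s d e m m′ a a′ →
            s :* s :* (con (ℤ.+ 1944) :* m :+ con (ℤ.+ 1296) :* a)
              :+ (con (ℤ.+ 1944) :* m′ :+ con (ℤ.+ 1296) :* a′) :- con (ℤ.+ 2) :* s :=
            s :* (con (ℤ.+ 324) :* d :+ con (ℤ.+ 648) :* e :- con (ℤ.+ 2))
              :+ (con (ℤ.+ 648) :* ((s :* d :+ con (ℤ.+ 2) :* (s :* s :* a :+ a′)) :- s :* e)
              :+ con (ℤ.+ 972) :* (con (ℤ.+ 2) :* (s :* s :* m :+ m′) :- s :* d)))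
            refl (ι s) (Σᴿ Δ) (Σᴿ E) (buildMass T i) (buildMass T′ i) (answerMass T i) (answerMass T′ i))
          where
          build-progress : ι s * Σᴿ Δ ≤ ι 2 * (ι s * ι s * buildMass T i + buildMass T′ i)
          build-progress = ≤-trans (dist²-run (ι s) T T′ i agree (steps build) (δ (start build)) (δ (start build)))
            (≤-reflexive (trans (+-congʳ (trans (*-congˡ (dist²-self (δ (start build)))) (zeroʳ _))) (+-identityˡ _)))

          m m′ : Outcome → Carrier
          m z  = queryMass T (timely z) (entering T z) i
          m′ z = queryMass T′ (timely z) (entering T′ z) i

          one : ∀ z → ι s * E z ≤ (ι s * Δ z + (ι 2 * (ι s * ι s)) * m z) + ι 2 * m′ z
          one z = ≤-trans (dist²-run (ι s) T T′ i agree (timely z) (entering T z) (entering T′ z))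
            (≤-reflexive (trans (+-congʳ (*-congˡ (dist²-*δ (built T z) (built T′ z) (start (answerTo z)))))
              (solve 4 (λ s x m m′ → s :* x :+ con (ℤ.+ 2) :* (s :* s :* m :+ m′)
                 := (s :* x :+ (con (ℤ.+ 2) :* (s :* s)) :* m) :+ con (ℤ.+ 2) :* m′) refl (ι s) (Δ z) (m z) (m′ z))))

          answer-progress : ι s * Σᴿ E ≤ ι s * Σᴿ Δ + ι 2 * (ι s * ι s * answerMass T i + answerMass T′ i)
          answer-progress = ≤-trans (≤-reflexive (sym (ΣR.Σ-*ˡ (ι s) E)))
            (≤-trans (Σ-mono-≤ one) (≤-reflexive (trans
              (ΣR.Σ-+ (λ z → ι s * Δ z + (ι 2 * (ι s * ι s)) * m z) (λ z → ι 2 * m′ z))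
              (trans (+-cong (Σ-linear (ι s) (ι 2 * (ι s * ι s)) Δ m) (ΣR.Σ-*ˡ (ι 2) m′))
              (solve 4 (λ s x m m′ → (s :* x :+ (con (ℤ.+ 2) :* (s :* s)) :* m) :+ con (ℤ.+ 2) :* m′
                 := s :* x :+ con (ℤ.+ 2) :* (s :* s :* m :+ m′)) refl (ι s) (Σᴿ Δ) (answerMass T i) (answerMass T′ i))))))

-- Averaging the weights over a star and over a hypercube

Bits : ℕ → Set
Bits = Vec Bool

flip : ∀ {m} → Fin m → Bits m → Bits m
flip i b = updateAt b i not

module Averaging {c ℓ₁ ℓ₂ ℓ₃} (ℝ : RealNumbers c ℓ₁ ℓ₂ ℓ₃) where

  open RealNumbers ℝ hiding (_·_; zero)
  open Reals ℝ

  -- Summing over the `m` edges gives `2 m s ≤ s² C + m C ≤ 2 m C`. The centre pays `C` once for all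
  -- its edges but with factor `s²`, while each leaf may pay `C` for its own edge; `s² ≤ m` balances
  -- the two.
  star : ∀ m s C (f : Fin m → Carrier) → .{{_ : ℕ.NonZero m}} → s ℕ.* s ℕ.≤ m →
         (∀ i → ι 2 * ι s ≤ ι s * ι s * f i + ι C) → sum f ≤ ι C → s ℕ.≤ C
  star m s C f s²≤m edge Σf≤C = ℕ.*-cancelˡ-≤ (m ℕ.* 2) (begin
    m ℕ.* 2 ℕ.* s                    ≤⟨ natural ⟩
    s ℕ.* s ℕ.* C ℕ.+ m ℕ.* C        ≤⟨ ℕ.+-monoˡ-≤ (m ℕ.* C) (ℕ.*-monoˡ-≤ C s²≤m) ⟩
    m ℕ.* C ℕ.+ m ℕ.* C              ≡⟨ N.solve 2 (λ m C → m N.:* C N.:+ m N.:* C N.:= m N.:* N.con 2 N.:* C) ≡.refl m C ⟩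
    m ℕ.* 2 ℕ.* C                    ∎)
    where
    module N = +-*-Solver
    open ℕ.≤-Reasoning
    instance
      2m≢0 : ℕ.NonZero (m ℕ.* 2)
      2m≢0 = ℕ.m*n≢0 m 2
    natural : m ℕ.* 2 ℕ.* s ℕ.≤ s ℕ.* s ℕ.* C ℕ.+ m ℕ.* C
    natural = ι-cancel-≤ (≤-trans (≤-reflexive (trans (ι-* (m ℕ.* 2) s) (trans (*-congʳ (ι-* m 2)) (*-assoc _ _ _))))
      (≤-trans (≤-reflexive (sym (sum-const m)))
      (≤-trans (sum-mono-≤ edge)
      (≤-trans (≤-reflexive (trans (∑-distrib-+ (λ i → ι s * ι s * f i) (λ _ → ι C))
        (+-cong (sym (*-distribˡ-sum (ι s * ι s) f)) (sum-const m))))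
      (≤-trans (+-mono-≤ (*-monoˡ-≤ (square-nonneg (ι s)) Σf≤C) ≤-refl)
        (≤-reflexive (sym (trans (ι-+ (s ℕ.* s ℕ.* C) (m ℕ.* C))
          (+-cong (trans (ι-* (s ℕ.* s) C) (*-congʳ (ι-* s s))) (ι-* m C))))))))))

  Σᵇ : ∀ {m} → (Bits m → Carrier) → Carrier
  Σᵇ {zero}  f = f []
  Σᵇ {suc m} f = Σᵇ (f ∘ (false ∷_)) + Σᵇ (f ∘ (true ∷_))

  private variable
    m : ℕ

  Σᵇ-mono-≤ : {f g : Bits m → Carrier} → (∀ b → f b ≤ g b) → Σᵇ f ≤ Σᵇ g
  Σᵇ-mono-≤ {zero}  f≤g = f≤g []
  Σᵇ-mono-≤ {suc m} f≤g = +-mono-≤ (Σᵇ-mono-≤ (f≤g ∘ (false ∷_))) (Σᵇ-mono-≤ (f≤g ∘ (true ∷_)))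

  Σᵇ-+ : (f g : Bits m → Carrier) → Σᵇ (λ b → f b + g b) ≈ Σᵇ f + Σᵇ g
  Σᵇ-+ {zero}  f g = refl
  Σᵇ-+ {suc m} f g = trans (+-cong (Σᵇ-+ (f ∘ (false ∷_)) (g ∘ (false ∷_))) (Σᵇ-+ (f ∘ (true ∷_)) (g ∘ (true ∷_))))
    (solve 4 (λ x y z w → (x :+ y) :+ (z :+ w) := (x :+ z) :+ (y :+ w)) refl _ _ _ _)

  Σᵇ-const : ∀ m x → Σᵇ {m} (λ _ → x) ≈ ι (2 ℕ.^ m) * x
  Σᵇ-const zero    x = sym (trans (*-congʳ ι-1) (*-identityˡ x))
  Σᵇ-const (suc m) x = trans (+-cong (Σᵇ-const m x) (Σᵇ-const m x))
    (trans (solve 2 (λ p x → p :* x :+ p :* x := con (ℤ.+ 2) :* p :* x) refl (ι (2 ℕ.^ m)) x)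
      (*-congʳ (sym (ι-* 2 (2 ℕ.^ m)))))

  Σᵇ-flip : ∀ i (f : Bits m → Carrier) → Σᵇ (f ∘ flip i) ≈ Σᵇ f
  Σᵇ-flip zero    f = +-comm _ _
  Σᵇ-flip (suc i) f = +-cong (Σᵇ-flip i (f ∘ (false ∷_))) (Σᵇ-flip i (f ∘ (true ∷_)))

  Σᵇ-sum : ∀ {k} (f : Bits m → Fin k → Carrier) → Σᵇ (λ b → sum (f b)) ≈ sum λ i → Σᵇ λ b → f b i
  Σᵇ-sum {zero}  f = refl
  Σᵇ-sum {suc m} {k} f = trans (+-cong (Σᵇ-sum (f ∘ (false ∷_))) (Σᵇ-sum (f ∘ (true ∷_))))
    (sym (∑-distrib-+ {k} (λ i → Σᵇ λ b → f (false ∷ b) i) (λ i → Σᵇ λ b → f (true ∷ b) i)))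

  -- Double counting: `flip i` permutes the cube, so every `f b i` occurs in two of the edge
  -- inequalities, and their sum reads `2 · 2^m · m ≤ 2 · 2^m · C`.
  hypercube : ∀ m C (f : Bits m → Fin m → Carrier) →
              (∀ b i → ι 2 ≤ f b i + f (flip i b) i) → (∀ b → sum (f b) ≤ ι C) → m ℕ.≤ C
  hypercube m C f edge vertex = ℕ.*-cancelˡ-≤ (2 ℕ.^ suc m) (≡.subst (ℕ._≤ 2 ℕ.^ suc m ℕ.* C) rearranged natural)
    where
    module N = +-*-Solver
    instance
      2^m≢0 : ℕ.NonZero (2 ℕ.^ suc m)
      2^m≢0 = ℕ.m^n≢0 2 (suc m)
    rearranged : m ℕ.* (2 ℕ.^ m ℕ.* 2) ≡ 2 ℕ.^ suc m ℕ.* m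
    rearranged = N.solve 2 (λ m p → m N.:* (p N.:* N.con 2) N.:= (N.con 2 N.:* p) N.:* m) ≡.refl m (2 ℕ.^ m)
    average : ∀ i → ι (2 ℕ.^ m) * ι 2 ≤ ι 2 * Σᵇ (λ b → f b i)
    average i = ≤-trans (≤-reflexive (sym (Σᵇ-const m (ι 2))))
      (≤-trans (Σᵇ-mono-≤ (λ b → edge b i))
      (≤-reflexive (trans (Σᵇ-+ (λ b → f b i) (λ b → f (flip i b) i))
        (trans (+-congˡ (Σᵇ-flip i (λ b → f b i)))
          (solve 1 (λ x → x :+ x := con (ℤ.+ 2) :* x) refl _)))))
    natural : m ℕ.* (2 ℕ.^ m ℕ.* 2) ℕ.≤ 2 ℕ.^ suc m ℕ.* C
    natural = ι-cancel-≤ (≤-trans (≤-reflexive (trans (ι-* m _) (trans (*-congˡ (ι-* (2 ℕ.^ m) 2)) (sym (sum-const m)))))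
      (≤-trans (sum-mono-≤ average)
      (≤-trans (≤-reflexive (trans (sym (*-distribˡ-sum (ι 2) (λ i → Σᵇ λ b → f b i))) (*-congˡ (sym (Σᵇ-sum f)))))
      (≤-trans (*-monoˡ-≤ (ι-nonneg 2) (≤-trans (Σᵇ-mono-≤ vertex) (≤-reflexive (Σᵇ-const m (ι C)))))
      (≤-reflexive (sym (trans (ι-* (2 ℕ.^ suc m) C) (trans (*-congʳ (ι-* 2 (2 ℕ.^ m))) (*-assoc _ _ _)))))))))

  sum-↑ʳ-≤ : ∀ h {m} (f : Fin (h ℕ.+ m) → Carrier) → (∀ i → 0# ≤ f i) → sum (λ i → f (h ↑ʳ i)) ≤ sum f
  sum-↑ʳ-≤ zero    f 0≤f = ≤-refl
  sum-↑ʳ-≤ (suc h) f 0≤f = ≤-trans (sum-↑ʳ-≤ h (f ∘ suc) (0≤f ∘ suc))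
    (≤-by (0≤f zero) (solve 2 (λ x y → x :+ y :- y := x) refl (f zero) (sum (f ∘ suc))))

-- Cost bounds from families of texts

module QueryBounds {c ℓ₁ ℓ₂ ℓ₃} (ℝ : RealNumbers c ℓ₁ ℓ₂ ℓ₃) where

  open RealNumbers ℝ hiding (_·_; zero)
  open Reals ℝ
  open Quantum ℝ
  open Weights ℝ
  open Averaging ℝ
  open SAConstruction using (build)

  cost : ∀ {n σ} → SAConstruction n σ → ℕ → ℕ
  cost A t = 1944 ℕ.* queries (build A) ℕ.+ 1296 ℕ.* t

  star-bound : ∀ {m σ} .{{_ : ℕ.NonZero m}} (A : SAConstruction (suc m) σ) t j
               (T₀ : Text σ (suc m)) (T : Fin m → Text σ (suc m)) →
               Constructs A T₀ t → (∀ i → Constructs A (T i) t) →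
               (∀ i k → k ≢ suc i → T₀ k ≡ T i k) → (∀ i → SA T₀ j ≢ SA (T i) j) →
               ∀ s → s ℕ.* s ℕ.≤ m → s ℕ.≤ cost A t
  star-bound {m} A t j T₀ T c₀ c agree differ s s²≤m =
    star m s (cost A t) (λ i → weight A t j T₀ (suc i)) s²≤m
      (λ i → ≤-trans (adversary A t j T₀ (T i) (differ i) c₀ (c i) (suc i) (agree i) s)
        -- A changed text is compared with the base text only, so its single weight may be bounded
        -- crudely by its total weight.
        (+-mono-≤ ≤-refl (≤-trans (term≤sum (weight-nonneg A t j (T i)) (suc i)) (sum-weight A t j (T i)))))
      (≤-trans (sum-↑ʳ-≤ 1 (weight A t j T₀) (weight-nonneg A t j T₀)) (sum-weight A t j T₀))

  hypercube-bound : ∀ h {m σ} (A : SAConstruction (h ℕ.+ m) σ) t j (T : Bits m → Text σ (h ℕ.+ m)) →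
                    (∀ b → Constructs A (T b) t) →
                    (∀ b i k → k ≢ h ↑ʳ i → T b k ≡ T (flip i b) k) →
                    (∀ b i → SA (T b) j ≢ SA (T (flip i b)) j) →
                    m ℕ.≤ cost A t
  hypercube-bound h {m} A t j T c agree differ =
    hypercube m (cost A t) (λ b i → weight A t j (T b) (h ↑ʳ i))
      (λ b i → ≤-trans (≤-reflexive (sym (trans (*-congˡ ι-1) (*-identityʳ _))))
        (≤-trans (adversary A t j (T b) (T (flip i b)) (differ b i) (c b) (c (flip i b)) (h ↑ʳ i) (agree b i) 1)
          (≤-reflexive (+-congʳ (trans (*-congʳ (trans (*-cong ι-1 ι-1) (*-identityˡ 1#))) (*-identityˡ _))))))
      (λ b → ≤-trans (sum-↑ʳ-≤ h (weight A t j (T b)) (weight-nonneg A t j (T b))) (sum-weight A t j (T b)))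

open import Data.List.Base using (take; drop; head; map; tabulate; allFin; lookup; derun)
import Data.List.Properties as List
open import Data.List.Membership.Propositional using (_∈_)
open import Data.List.Membership.Propositional.Properties using (∈-lookup; ∈-allFin; ∈-tabulate⁺; ∈-derun⁺)
import Data.List.Relation.Binary.Lex.Core as Lex
open import Data.List.Relation.Binary.Permutation.Propositional as Perm using (_↭_; ↭⇒↭ₛ; ↭-sym; ↭-trans; prep; swap)
open import Data.List.Relation.Binary.Permutation.Propositional.Properties using (map⁺; ∈-resp-↭)
import Data.List.Relation.Binary.Permutation.Setoid.Properties as Permutationₛ
open import Data.List.Relation.Unary.All as All using (All; []; _∷_)
open import Data.List.Relation.Unary.AllPairs as AllPairs using (AllPairs; []; _∷_)
import Data.List.Relation.Unary.Any as Any
import Data.List.Relation.Unary.Any.Properties as Any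
import Data.List.Relation.Unary.Sorted.TotalOrder.Properties as Sorted
open import Data.List.Relation.Unary.Unique.Propositional using (Unique)
import Data.List.Relation.Unary.Unique.Propositional.Properties as Unique
import Data.List.Sort as Sort
open import Data.Maybe.Properties using (just-injective)
open import Data.Nat.Base using (NonZero; _+_; _*_; _∸_; _⊔_; _≤_; _<_; z≤n; s≤s; ⌊_/2⌋)
open import Data.Nat.ListAction using (sum)
open import Data.Nat.ListAction.Properties using (sum-↭)
open import Data.Vec.Functional using (toList)
open import Data.Vec.Properties using (lookup∘updateAt′)
open import Relation.Binary.Bundles using (DecTotalOrder)
open import Relation.Binary.Definitions using (DecidableEquality)
open import Relation.Binary.PropositionalEquality using (refl; sym; trans; cong; cong₂; subst; setoid; module ≡-Reasoning)

-- Existence and number of LZ77 factors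

module LZ {A : Set} where

  private variable
    t xs ys : List A
    i j ℓ z B : ℕ

  occursBefore? : DecidableEquality A → ∀ (t : List A) i ℓ → Dec (OccursBefore t i ℓ)
  occursBefore? _≟_ t i ℓ = (i + ℓ ℕ.≤? length t) ×-dec
    ℕ.anyUpTo? (λ i′ → List.≡-dec _≟_ (substring t i′ ℓ) (substring t i ℓ)) i

  -- Downward search from a bound on all lengths: the first length that occurs is maximal, and
  -- length 1 guarantees a hit.
  longest : DecidableEquality A → ∀ (t : List A) i → OccursBefore t i 1 →
            ∃[ ℓ ] (1 ≤ ℓ × OccursBefore t i ℓ × (∀ ℓ′ → OccursBefore t i ℓ′ → ℓ′ ≤ ℓ))
  longest _≟_ t i occurs₁ = search (length t) λ ℓ (fits , _) → ℕ.≤-trans (ℕ.m≤n+m ℓ i) fits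
    where
    search : ∀ b → (∀ ℓ → OccursBefore t i ℓ → ℓ ≤ b) →
             ∃[ ℓ ] (1 ≤ ℓ × OccursBefore t i ℓ × (∀ ℓ′ → OccursBefore t i ℓ′ → ℓ′ ≤ ℓ))
    search zero    bound = contradiction (bound 1 occurs₁) λ ()
    search (suc b) bound with occursBefore? _≟_ t i (suc b)
    ... | yes occurs = suc b , s≤s z≤n , occurs , bound
    ... | no ¬occurs = search b λ ℓ occurs → ℕ.s≤s⁻¹ (ℕ.≤∧≢⇒< (bound ℓ occurs) λ { refl → ¬occurs occurs })

  -- As the parameter is given by its graph, placing a text in a class takes an actual
  -- factorization. Each factor advances by at least one position, so `length t` is enough fuel.
  factorization : DecidableEquality A → ∀ (t : List A) → ∃[ z ] LZ77From t 0 z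
  factorization _≟_ t = go (length t) 0 ℕ.≤-refl
    where
    go : ∀ fuel i → length t ≤ i + fuel → ∃[ z ] LZ77From t i z
    go zero       i end = 0 , done (subst (length t ≤_) (ℕ.+-identityʳ i) end)
    go (suc fuel) i enough with length t ℕ.≤? i | occursBefore? _≟_ t i 1
    ... | yes end | _ = 0 , done end
    ... | no ¬end | no ¬occurs =
      let z , rest = go fuel (suc i) (subst (length t ≤_) (ℕ.+-suc i fuel) enough)
      in  suc z , literal (ℕ.≰⇒> ¬end) ¬occurs rest
    ... | no ¬end | yes occurs₁ =
      let ℓ , 1≤ℓ , occurs , max = longest _≟_ t i occurs₁
          z , rest = go fuel (i + ℓ) (ℕ.≤-trans enough (ℕ.≤-trans
            (ℕ.≤-reflexive (sym (ℕ.+-assoc i 1 fuel)))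
            (ℕ.+-monoˡ-≤ fuel (ℕ.+-monoʳ-≤ i 1≤ℓ))))
      in  suc z , copy 1≤ℓ occurs max rest

  factors≤length : LZ77From t i z → i ≤ length t → i + z ≤ length t
  factors≤length {t = t} {i = i} (done _) i≤n = subst (_≤ length t) (sym (ℕ.+-identityʳ i)) i≤n
  factors≤length {t = t} {i = i} {z = suc z} (literal i<n _ rest) _ =
    subst (_≤ length t) (sym (ℕ.+-suc i z)) (factors≤length rest i<n)
  factors≤length {t = t} {i = i} {z = suc z} (copy {ℓ = ℓ} 1≤ℓ (fits , _) _ rest) _ = begin
    i + suc z     ≡⟨ ℕ.+-assoc i 1 z ⟨
    i + 1 + z     ≤⟨ ℕ.+-monoˡ-≤ z (ℕ.+-monoʳ-≤ i 1≤ℓ) ⟩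
    i + ℓ + z     ≤⟨ factors≤length rest fits ⟩
    length t      ∎
    where open ℕ.≤-Reasoning

  -- The bounds below assume such a bound at all positions from some point on, because a greedy
  -- factor may run past the end of the block under consideration.
  AtMost : List A → ℕ → ℕ → Set
  AtMost t B i = ∀ z → LZ77From t i z → z ≤ B

  atMost-end : length t ≤ i → AtMost t 0 i
  atMost-end end _ (done _) = z≤n
  atMost-end end _ (literal i<n _ _) = contradiction end (ℕ.<⇒≱ i<n)
  atMost-end {i = i} end _ (copy 1≤ℓ (fits , _) _ _) =
    contradiction (ℕ.≤-trans fits end) (ℕ.<⇒≱ (ℕ.m<m+n i 1≤ℓ))

  atMost-step : (∀ j → i < j → AtMost t B j) → AtMost t (suc B) i
  atMost-step next _ (done _) = z≤n
  atMost-step {i} next _ (literal _ _ rest) = s≤s (next (suc i) ℕ.≤-refl _ rest)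
  atMost-step {i} next _ (copy {ℓ = ℓ} 1≤ℓ _ _ rest) = s≤s (next (i + ℓ) (ℕ.m<m+n i 1≤ℓ) _ rest)

  prefix-occurs : 1 ≤ ℓ → OccursBefore t i ℓ → OccursBefore t i 1
  prefix-occurs {suc ℓ} {t} {i} _ (fits , i′ , i′<i , eq) =
    ℕ.≤-trans (ℕ.+-monoʳ-≤ i (s≤s z≤n)) fits , i′ , i′<i ,
    trans (shorten (drop i′ t)) (trans (cong (take 1) eq) (sym (shorten (drop i t))))
    where
    shorten : ∀ xs → take 1 xs ≡ take 1 (take (suc ℓ) xs)
    shorten []      = refl
    shorten (_ ∷ _) = refl

  -- Greediness: one known earlier occurrence rules out a literal and forces the factor to reach at
  -- least as far.
  atMost-copy : 1 ≤ ℓ → OccursBefore t i ℓ → (∀ j → i + ℓ ≤ j → AtMost t B j) → AtMost t (suc B) i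
  atMost-copy 1≤ℓ occurs next _ (done _) = z≤n
  atMost-copy 1≤ℓ occurs next _ (literal _ ¬occurs _) = contradiction (prefix-occurs 1≤ℓ occurs) ¬occurs
  atMost-copy {i = i} 1≤ℓ occurs next _ (copy {ℓ = ℓ′} _ _ max rest) =
    s≤s (next (i + ℓ′) (ℕ.+-monoʳ-≤ i (max _ occurs)) _ rest)

  at : List A → ℕ → Maybe A
  at t i = head (drop i t)

  take-at : ∀ ℓ xs ys → (∀ k → k < ℓ → at xs k ≡ at ys k) → take ℓ xs ≡ take ℓ ys
  take-at zero    xs       ys       eq = refl
  take-at (suc ℓ) []       []       eq = refl
  take-at (suc ℓ) []       (y ∷ ys) eq = contradiction (eq 0 (s≤s z≤n)) λ ()
  take-at (suc ℓ) (x ∷ xs) []       eq = contradiction (eq 0 (s≤s z≤n)) λ ()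
  take-at (suc ℓ) (x ∷ xs) (y ∷ ys) eq with refl ← just-injective (eq 0 (s≤s z≤n)) =
    cong (x ∷_) (take-at ℓ xs ys λ k k<ℓ → eq (suc k) (s≤s k<ℓ))

  at-drop : ∀ t i k → at (drop i t) k ≡ at t (i + k)
  at-drop t i k = cong head (List.drop-drop i k t)

  substring-at : ∀ t i j ℓ → (∀ k → k < ℓ → at t (i + k) ≡ at t (j + k)) → substring t i ℓ ≡ substring t j ℓ
  substring-at t i j ℓ eq = take-at ℓ (drop i t) (drop j t)
    λ k k<ℓ → trans (at-drop t i k) (trans (eq k k<ℓ) (sym (at-drop t j k)))

  at-substring : ∀ t i j ℓ → 1 ≤ ℓ → substring t i ℓ ≡ substring t j ℓ → at t i ≡ at t j
  at-substring t i j (suc ℓ) _ eq = trans (sym (first (drop i t))) (trans (cong head eq) (first (drop j t)))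
    where
    first : ∀ xs → head (take (suc ℓ) xs) ≡ head xs
    first []      = refl
    first (_ ∷ _) = refl

  atMost-within-run : ∀ {c} a b → b ≤ length t → (∀ k → a ≤ k → k < b → at t k ≡ c) →
                      (∀ j → b ≤ j → AtMost t B j) → ∀ j → a < j → AtMost t (suc B) j
  atMost-within-run {t = t} {B = B} a b b≤n run next (suc j) (s≤s a≤j) with b ℕ.≤? suc j
  ... | yes b≤j = λ z f → ℕ.m≤n⇒m≤1+n (next (suc j) b≤j z f)
  ... | no  b≰j = atMost-copy {ℓ = b ∸ suc j} (ℕ.m<n⇒0<n∸m (ℕ.≰⇒> b≰j))
    ( ℕ.≤-trans (ℕ.≤-reflexive b≡) b≤n , j , ℕ.≤-refl
    , substring-at t j (suc j) (b ∸ suc j) λ k k<ℓ →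
        let j+k<b = ℕ.<-≤-trans (ℕ.+-monoʳ-< (suc j) k<ℓ) (ℕ.≤-reflexive b≡) in
        trans (run (j + k) (ℕ.≤-trans a≤j (ℕ.m≤m+n j k)) (ℕ.<-trans ℕ.≤-refl j+k<b))
          (sym (run (suc j + k) (ℕ.≤-trans a≤j (ℕ.≤-trans (ℕ.n≤1+n j) (ℕ.m≤m+n (suc j) k))) j+k<b)))
    λ i b≤i → next i (ℕ.≤-trans (ℕ.≤-reflexive (sym b≡)) b≤i)
    where
    b≡ : suc j + (b ∸ suc j) ≡ b
    b≡ = ℕ.m+[n∸m]≡n (ℕ.<⇒≤ (ℕ.≰⇒> b≰j))

  -- A run costs at most two factors: its first symbol, and a self-overlapping
  -- copy from one position to the left.
  atMost-run : ∀ {c} a b → b ≤ length t → (∀ k → a ≤ k → k < b → at t k ≡ c) →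
               (∀ j → b ≤ j → AtMost t B j) → ∀ j → a ≤ j → AtMost t (2 + B) j
  atMost-run a b b≤n run next j a≤j with ℕ.m≤n⇒m<n∨m≡n a≤j
  ... | inj₁ a<j  = λ z f → ℕ.m≤n⇒m≤1+n (atMost-within-run a b b≤n run next j a<j z f)
  ... | inj₂ refl = atMost-step (atMost-within-run a b b≤n run next)

  -- The first symbol of a copied factor has occurred before, so no copy starts among the first `h`
  -- positions: each factor there is a literal and advances by one.
  fresh≤factors : ∀ h → h ≤ length t → (∀ i j → j < i → i < h → at t j ≢ at t i) →
                  LZ77From t i z → i ≤ h → h ≤ i + z
  fresh≤factors h h≤n fresh (done end) i≤h = ℕ.≤-trans h≤n (ℕ.≤-trans end (ℕ.m≤m+n _ 0))
  fresh≤factors {i = i} {suc z} h h≤n fresh f i≤h with ℕ.m≤n⇒m<n∨m≡n i≤h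
  fresh≤factors {i = i} {suc z} h h≤n fresh f i≤h | inj₂ refl = ℕ.m≤m+n i (suc z)
  fresh≤factors {i = i} {suc z} h h≤n fresh (literal _ _ rest) _ | inj₁ i<h =
    subst (h ≤_) (sym (ℕ.+-suc i z)) (fresh≤factors h h≤n fresh rest i<h)
  fresh≤factors {t = t} {i = i} {suc z} h h≤n fresh (copy {ℓ = ℓ} 1≤ℓ (_ , i′ , i′<i , eq) _ _) _ | inj₁ i<h =
    contradiction (at-substring t i′ i ℓ 1≤ℓ eq) (fresh i i′ i′<i i<h)

at-toList : ∀ {n} {A : Set} (f : Fin n → A) i → LZ.at (toList f) (toℕ i) ≡ just (f i)
at-toList f zero    = refl
at-toList f (suc i) = at-toList (f ∘ suc) i

-- Counting positions by a predicate

private variable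
  A : Set
  n σ : ℕ

bit : Bool → ℕ
bit b = if b then 1 else 0

count : (A → Bool) → List A → ℕ
count P xs = sum (map (bit ∘ P) xs)

count-↭ : ∀ (P : A → Bool) {xs ys} → xs ↭ ys → count P xs ≡ count P ys
count-↭ P xs↭ys = sum-↭ (map⁺ (bit ∘ P) xs↭ys)

countFin : (Fin n → Bool) → ℕ
countFin P = count P (allFin _)

countFin-suc : ∀ (P : Fin (suc n) → Bool) → countFin P ≡ bit (P zero) + countFin (P ∘ suc)
countFin-suc P = cong (bit (P zero) +_) (cong sum (trans (List.map-tabulate suc (bit ∘ P))
  (sym (List.map-tabulate (λ i → i) (bit ∘ P ∘ suc)))))

countFin-cong : ∀ {P Q : Fin n → Bool} → (∀ i → P i ≡ Q i) → countFin P ≡ countFin Q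
countFin-cong P≗Q = cong sum (List.map-cong (cong bit ∘ P≗Q) (allFin _))

count-tabulate : ∀ (P : A → Bool) (f : Fin n → A) → count P (tabulate f) ≡ countFin (P ∘ f)
count-tabulate P f = cong sum (trans (List.map-tabulate f (bit ∘ P))
  (sym (List.map-tabulate (λ i → i) (bit ∘ P ∘ f))))

countFin-+ : ∀ m (P : Fin (m + n) → Bool) → countFin P ≡ countFin (P ∘ (_↑ˡ n)) + countFin (P ∘ (m ↑ʳ_))
countFin-+ zero    P = refl
countFin-+ {n} (suc m) P = begin
  countFin P                              ≡⟨ countFin-suc P ⟩
  bit (P zero) + countFin (P ∘ suc)       ≡⟨ cong (bit (P zero) +_) (countFin-+ m (P ∘ suc)) ⟩
  bit (P zero) + (countFin (P ∘ suc ∘ (_↑ˡ n)) + countFin (P ∘ suc ∘ (m ↑ʳ_)))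
                                          ≡⟨ ℕ.+-assoc (bit (P zero)) _ _ ⟨
  bit (P zero) + countFin (P ∘ suc ∘ (_↑ˡ n)) + countFin (P ∘ suc ∘ (m ↑ʳ_))
                                          ≡⟨ cong (_+ countFin (P ∘ suc ∘ (m ↑ʳ_))) (countFin-suc (P ∘ (_↑ˡ n))) ⟨
  countFin (P ∘ (_↑ˡ n)) + countFin (P ∘ (suc m ↑ʳ_)) ∎
  where open ≡-Reasoning

countFin-false : (P : Fin n → Bool) → (∀ i → P i ≡ false) → countFin P ≡ 0
countFin-false {zero}  P never = refl
countFin-false {suc n} P never =
  trans (countFin-suc P) (cong₂ _+_ (cong bit (never zero)) (countFin-false (P ∘ suc) (never ∘ suc)))

countFin-true : (P : Fin n → Bool) → (∀ i → P i ≡ true) → countFin P ≡ n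
countFin-true {zero}  P always = refl
countFin-true {suc n} P always =
  trans (countFin-suc P) (cong₂ _+_ (cong bit (always zero)) (countFin-true (P ∘ suc) (always ∘ suc)))

countFin-others : ∀ (P : Fin (suc n) → Bool) p → P p ≡ false → (∀ i → i ≢ p → P i ≡ true) → countFin P ≡ n
countFin-others P zero ¬p others =
  trans (countFin-suc P) (cong₂ _+_ (cong bit ¬p) (countFin-true (P ∘ suc) λ i → others (suc i) λ ()))
countFin-others {suc n} P (suc p) ¬p others =
  trans (countFin-suc P) (cong₂ _+_ (cong bit (others zero λ ()))
    (countFin-others (P ∘ suc) p ¬p λ i i≢p → others (suc i) (i≢p ∘ Fin.suc-injective)))

countFin-unique : ∀ (P : Fin n → Bool) p → (∀ i → i ≢ p → P i ≡ false) → countFin P ≤ 1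
countFin-unique {suc n} P zero others = ℕ.≤-trans (ℕ.≤-reflexive (trans (countFin-suc P)
  (cong (bit (P zero) +_) (countFin-false (P ∘ suc) λ i → others (suc i) λ ()))))
  (ℕ.≤-trans (ℕ.≤-reflexive (ℕ.+-identityʳ _)) (bit≤1 (P zero)))
  where
  bit≤1 : ∀ b → bit b ≤ 1
  bit≤1 true  = ℕ.≤-refl
  bit≤1 false = z≤n
countFin-unique {suc n} P (suc p) others = ℕ.≤-trans (ℕ.≤-reflexive (trans (countFin-suc P)
  (cong (_+ countFin (P ∘ suc)) (cong bit (others zero λ ())))))
  (countFin-unique (P ∘ suc) p λ i i≢p → others (suc i) (i≢p ∘ Fin.suc-injective))

countFin-below : ∀ k → k ≤ n → countFin {n} (λ i → does (toℕ i ℕ.<? k)) ≡ k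
countFin-below {n}     zero    _         = countFin-false {n} (λ i → does (toℕ i ℕ.<? 0)) λ i → dec-false (toℕ i ℕ.<? 0) λ ()
countFin-below {suc n} (suc k) (s≤s k≤n) = trans (countFin-suc {n} (λ i → does (toℕ i ℕ.<? suc k)))
  (cong suc (countFin-below k k≤n))

-- The relation on pairs says that everything in front of `p` satisfies `P` and everything behind it
-- does not, so `P` cuts the list exactly at `p`.
count-before : ∀ (P : A → Bool) {p} → P p ≡ false → ∀ {xs} →
               AllPairs (λ a b → (b ≡ p → P a ≡ true) × (a ≡ p → P b ≡ false)) xs →
               ∀ k → lookup xs k ≡ p → count P xs ≡ toℕ k
count-before P ¬Pp {x ∷ xs} (x-rel ∷ _) zero refl = cong₂ _+_ (cong bit ¬Pp) (count-false xs x-rel)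
  where
  count-false : ∀ ys → All (λ b → (b ≡ x → P x ≡ true) × (x ≡ x → P b ≡ false)) ys → count P ys ≡ 0
  count-false []       []              = refl
  count-false (y ∷ ys) ((_ , ¬y) ∷ rs) = cong₂ _+_ (cong bit (¬y refl)) (count-false ys rs)
count-before P ¬Pp {x ∷ xs} (x-rel ∷ rel) (suc k) refl =
  cong₂ _+_ (cong bit (proj₁ (All.lookup x-rel (∈-lookup k)) refl)) (count-before P ¬Pp rel k refl)

-- Suffix array entries and BWT runs

drop-tabulate : ∀ (f : Fin n → A) i → drop (toℕ i) (tabulate f) ≡ f i ∷ drop (suc (toℕ i)) (tabulate f)
drop-tabulate f zero    = refl
drop-tabulate f (suc i) = drop-tabulate (f ∘ suc) i

suffix-≤⇒symbol-≤ : ∀ (T : Text σ n) {a b} → DecTotalOrder._≤_ (suffixOrder T) a b → T a Fin.≤ T b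
suffix-≤⇒symbol-≤ T {a} {b} le with suffix T a | suffix T b | drop-tabulate T a | drop-tabulate T b
... | _ | _ | refl | refl with le
...   | Lex.this Ta<Tb = ℕ.<⇒≤ Ta<Tb
...   | Lex.next Ta≡Tb _ = ℕ.≤-reflexive (cong toℕ Ta≡Tb)

Unique-sortedSuffixes : ∀ (T : Text σ n) → Unique (sortedSuffixes T)
Unique-sortedSuffixes {n = n} T = Permutationₛ.Unique-resp-↭ (setoid (Fin n))
  (↭⇒↭ₛ (↭-sym (Sort.sort-↭ (suffixOrder T) (allFin n)))) (Unique.allFin⁺ n)

-- A suffix whose first symbol is unique in the text is ranked by first symbols alone. The count of
-- smaller symbols is invariant under permutation, so it may be evaluated on the sorted list, where
-- it is the index of `p`.
SA-rank : ∀ (T : Text σ n) p → (∀ q → T q ≡ T p → q ≡ p) →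
          ∀ k → countFin (λ q → does (T q Fin.<? T p)) ≡ toℕ k → SA T k ≡ p
SA-rank {n = n} T p unique k rank = trans (cong (lookup sorted) same-index) (sym (Any.lookup-index p∈sorted))
  where
  sorted = sortedSuffixes T
  P : Fin n → Bool
  P q = does (T q Fin.<? T p)
  p∈sorted : p ∈ sorted
  p∈sorted = ∈-resp-↭ (↭-sym (Sort.sort-↭ (suffixOrder T) (allFin n))) (∈-allFin p)
  related : ∀ {a b} → a ≢ b × DecTotalOrder._≤_ (suffixOrder T) a b →
            (b ≡ p → P a ≡ true) × (a ≡ p → P b ≡ false)
  related {a} {b} (a≢b , a≤b) =
    (λ { refl → dec-true (T a Fin.<? T p) (ℕ.≤∧≢⇒< (suffix-≤⇒symbol-≤ T {a} {b} a≤b) (a≢b ∘ unique a ∘ Fin.toℕ-injective)) }) ,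
    (λ { refl → dec-false (T b Fin.<? T p) (ℕ.≤⇒≯ (suffix-≤⇒symbol-≤ T {a} {b} a≤b)) })
  same-index : Fin.cast (sym (length-sortedSuffixes T)) k ≡ Any.index p∈sorted
  same-index = Fin.toℕ-injective (begin
    toℕ (Fin.cast (sym (length-sortedSuffixes T)) k)  ≡⟨ Fin.toℕ-cast _ k ⟩
    toℕ k                                             ≡⟨ rank ⟨
    countFin P                                        ≡⟨ count-↭ P (Sort.sort-↭ (suffixOrder T) (allFin n)) ⟨
    count P sorted                                    ≡⟨ count-before P (dec-false (T p Fin.<? T p) ℕ.1+n≰n)
                                                           (AllPairs.zipWith related (Unique-sortedSuffixes T ,
                                                             Sorted.Sorted⇒AllPairs (DecTotalOrder.totalOrder (suffixOrder T))
                                                               (Sort.sort-↗ (suffixOrder T) (allFin n))))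
                                                           (Any.index p∈sorted) (sym (Any.lookup-index p∈sorted)) ⟩
    toℕ (Any.index p∈sorted)                          ∎)
    where open ≡-Reasoning

tabulate-lookup-cast : ∀ {B : Set} (xs : List A) (n≡ : n ≡ length xs) (f : A → B) →
                       tabulate (λ i → f (lookup xs (Fin.cast n≡ i))) ≡ map f xs
tabulate-lookup-cast []       refl f = refl
tabulate-lookup-cast (x ∷ xs) refl f = cong (f x ∷_) (tabulate-lookup-cast xs refl f)

rotate-↭ : ∀ (f : Fin (suc n) → A) → f (fromℕ n) ∷ tabulate (f ∘ inject₁) ↭ tabulate f
rotate-↭ {zero}  f = Perm.refl
rotate-↭ {suc n} f = ↭-trans (swap (f (fromℕ (suc n))) (f zero) Perm.refl) (prep (f zero) (rotate-↭ (f ∘ suc)))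

-- The suffix array permutes the positions and `cyclicPred` rotates them. Bounds on the number of
-- runs thereby reduce to symbol counts of `T`, without determining the order of the BWT.
BWT-↭ : ∀ (T : Text σ n) → toList (BWT T) ↭ toList T
BWT-↭ {n = zero}  T = Perm.refl
BWT-↭ {n = suc n} T = begin
  toList (BWT T)
    ≡⟨ tabulate-lookup-cast (sortedSuffixes T) (sym (length-sortedSuffixes T)) (T ∘ cyclicPred) ⟩
  map (T ∘ cyclicPred) (sortedSuffixes T)
    ↭⟨ map⁺ (T ∘ cyclicPred) (Sort.sort-↭ (suffixOrder T) (allFin (suc n))) ⟩
  map (T ∘ cyclicPred) (allFin (suc n))
    ≡⟨ List.map-tabulate (λ i → i) (T ∘ cyclicPred) ⟩
  T (fromℕ n) ∷ tabulate (T ∘ inject₁)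
    ↭⟨ rotate-↭ T ⟩
  toList T ∎
  where open Perm.PermutationReasoning

bwtRuns≤length : ∀ (T : Text σ n) → bwtRuns T ≤ n
bwtRuns≤length T = ℕ.≤-trans (List.length-derun Fin._≟_ (toList (BWT T))) (ℕ.≤-reflexive (List.length-tabulate (BWT T)))

-- Every symbol of the text survives `derun`, and distinct symbols sit at distinct indices of the
-- result.
distinct≤bwtRuns : ∀ (T : Text σ n) {h} (p : Fin h → Fin n) → (∀ i j → T (p i) ≡ T (p j) → i ≡ j) → h ≤ bwtRuns T
distinct≤bwtRuns T p distinct = Fin.injective⇒≤ {f = λ i → Any.index (occurs i)} λ {i} {j} eq →
  distinct i j (trans (Any.lookup-index (occurs i)) (trans (cong (lookup (derun Fin._≟_ (toList (BWT T)))) eq) (sym (Any.lookup-index (occurs j)))))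
  where
  occurs : ∀ i → T (p i) ∈ derun Fin._≟_ (toList (BWT T))
  occurs i = ∈-derun⁺ Fin._≟_ (∈-resp-↭ (↭-sym (BWT-↭ T)) (∈-tabulate⁺ (p i)))

-- Every other run consists of symbols different from c.
runs≤ : ∀ (c : Fin σ) xs → length (derun Fin._≟_ xs) ≤ 1 + 2 * count (λ x → not (does (x Fin.≟ c))) xs
runs≤ c []       = z≤n
runs≤ {σ} c (x ∷ xs) = ℕ.≤-trans (go x xs) (s≤s (begin
  N x + 2 * count P xs            ≤⟨ ℕ.+-monoˡ-≤ (2 * count P xs) (ℕ.m≤m+n (N x) (N x + 0)) ⟩
  2 * N x + 2 * count P xs        ≡⟨ ℕ.*-distribˡ-+ 2 (N x) (count P xs) ⟨
  2 * (N x + count P xs)          ∎))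
  where
  open ℕ.≤-Reasoning
  P : Fin σ → Bool
  P x = not (does (x Fin.≟ c))
  N : Fin σ → ℕ
  N x = bit (P x)
  step : ∀ x y → x ≢ y → 1 ≤ N x + N y
  step x y x≢y with x Fin.≟ c | y Fin.≟ c
  ... | yes refl | yes refl = contradiction refl x≢y
  ... | yes _    | no _     = ℕ.≤-refl
  ... | no _     | _        = s≤s z≤n
  -- Each border between runs is charged to an adjacent symbol other than `c`. A symbol can have two
  -- borders, but the head has only one, hence `N x` without the factor 2.
  go : ∀ x xs → length (derun Fin._≟_ (x ∷ xs)) ≤ suc (N x + 2 * count P xs)
  go x [] = s≤s z≤n
  go x (y ∷ ys) with x Fin.≟ y
  ... | yes refl = ℕ.≤-trans (go x ys) (s≤s (ℕ.+-monoʳ-≤ (N x) (ℕ.*-monoʳ-≤ 2 (ℕ.m≤n+m (count P ys) (N x)))))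
  ... | no x≢y   = s≤s (begin
    length (derun Fin._≟_ (y ∷ ys))              ≤⟨ go y ys ⟩
    1 + (N y + 2 * count P ys)                   ≤⟨ ℕ.+-monoˡ-≤ (N y + 2 * count P ys) (step x y x≢y) ⟩
    N x + N y + (N y + 2 * count P ys)           ≡⟨ solve 3 (λ a b k → a :+ b :+ (b :+ con 2 :* k) := a :+ con 2 :* (b :+ k)) refl (N x) (N y) (count P ys) ⟩
    N x + 2 * (N y + count P ys)                 ∎)
    where open +-*-Solver

bwtRuns≤ : ∀ (c : Fin σ) (T : Text σ n) → bwtRuns T ≤ 1 + 2 * countFin (λ i → not (does (T i Fin.≟ c)))
bwtRuns≤ c T = ℕ.≤-trans (runs≤ c (toList (BWT T))) (ℕ.≤-reflexive (cong (λ k → 1 + 2 * k)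
  (trans (count-↭ (λ x → not (does (x Fin.≟ c))) (BWT-↭ T)) (count-tabulate (λ x → not (does (x Fin.≟ c))) T))))

-- Texts given by numerical symbols

module _ {n σ : ℕ} (v : Fin n → ℕ) (v<σ : ∀ q → v q < σ) where

  encode : Text σ n
  encode q = fromℕ< (v<σ q)

  toℕ-encode : ∀ q → toℕ (encode q) ≡ v q
  toℕ-encode q = Fin.toℕ-fromℕ< (v<σ q)

  encode-injective : ∀ {p q} → encode p ≡ encode q → v p ≡ v q
  encode-injective {p} {q} eq = trans (sym (toℕ-encode p)) (trans (cong toℕ eq) (toℕ-encode q))

  encode-< : ∀ {p q} → v p < v q → encode p Fin.< encode q
  encode-< {p} {q} = subst (_< _) (sym (toℕ-encode p)) ∘ subst (v p <_) (sym (toℕ-encode q))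

  encode-≮ : ∀ {p q} → ¬ (v p < v q) → ¬ (encode p Fin.< encode q)
  encode-≮ {p} {q} ≮ lt = ≮ (subst (_< v q) (toℕ-encode p) (subst (_ <_) (toℕ-encode q) lt))

  encode-≡ : ∀ {q} {c : Fin σ} → v q ≡ toℕ c → encode q ≡ c
  encode-≡ {q} eq = Fin.toℕ-injective (trans (toℕ-encode q) eq)

length-toList : ∀ {n σ} (T : Text σ n) → length (toList T) ≡ n
length-toList T = List.length-tabulate T

at-text : ∀ {n σ} (T : Text σ n) k (k<n : k < n) → LZ.at (toList T) k ≡ just (T (fromℕ< k<n))
at-text T k k<n = trans (cong (LZ.at (toList T)) (sym (Fin.toℕ-fromℕ< k<n))) (at-toList T (fromℕ< k<n))

SA-last : ∀ {m σ} (T : Text σ (suc m)) p → (∀ q → q ≢ p → T q Fin.< T p) → SA T (fromℕ m) ≡ p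
SA-last {m} T p max = SA-rank T p unique (fromℕ m) (trans
  (countFin-others (λ q → does (T q Fin.<? T p)) p (dec-false (T p Fin.<? T p) ℕ.1+n≰n)
    λ q q≢p → dec-true (T q Fin.<? T p) (max q q≢p))
  (sym (Fin.toℕ-fromℕ m)))
  where
  unique : ∀ q → T q ≡ T p → q ≡ p
  unique q Tq≡Tp with q Fin.≟ p
  ... | yes q≡p = q≡p
  ... | no  q≢p = contradiction (max q q≢p) (ℕ.<-irrefl (cong toℕ Tq≡Tp))

-- The star of texts with boundedly many factors and runs

module Spike {m σ : ℕ} (3≤σ : 3 ≤ σ) where

  height : Fin (suc m) → Fin (suc m) → ℕ
  height e zero    = 1
  height e (suc q) = if does (suc q Fin.≟ e) then 2 else 0

  height<σ : ∀ e q → height e q < σ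
  height<σ e zero = ℕ.≤-trans (s≤s (s≤s z≤n)) 3≤σ
  height<σ e (suc q) with does (suc q Fin.≟ e)
  ... | true  = 3≤σ
  ... | false = ℕ.≤-trans (s≤s z≤n) 3≤σ

  -- 1 0 … 0 2 0 … 0 with the 2 at position e, except that there is no 2 when
  -- e = 0; in both cases e carries the unique largest symbol.
  spike : Fin (suc m) → Text σ (suc m)
  spike e = encode (height e) (height<σ e)

  private
    off-spike : ∀ e q → suc q ≢ e → height e (suc q) ≡ 0
    off-spike e q q≢e = cong (if_then 2 else 0) (dec-false (suc q Fin.≟ e) q≢e)

    on-spike : ∀ q → height (suc q) (suc q) ≡ 2
    on-spike q = cong (if_then 2 else 0) (dec-true (suc q Fin.≟ suc q) refl)

    0ₛ : Fin σ
    0ₛ = fromℕ< (ℕ.≤-trans (s≤s z≤n) 3≤σ)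

    spike≡0ₛ : ∀ e q → suc q ≢ e → spike e (suc q) ≡ 0ₛ
    spike≡0ₛ e q q≢e = encode-≡ (height e) (height<σ e) {suc q} (trans (off-spike e q q≢e) (sym (Fin.toℕ-fromℕ< _)))

  spike-agree : ∀ i k → k ≢ suc i → spike zero k ≡ spike (suc i) k
  spike-agree i zero    _   = refl
  spike-agree i (suc k) k≢i = trans (spike≡0ₛ zero k λ ()) (sym (spike≡0ₛ (suc i) k k≢i))

  SA-spike : ∀ e → SA (spike e) (fromℕ m) ≡ e
  SA-spike e = SA-last (spike e) e λ q q≢e → encode-< (height e) (height<σ e) {q} {e} (smaller e q q≢e)
    where
    smaller : ∀ e q → q ≢ e → height e q < height e e
    smaller zero    zero    q≢e = contradiction refl q≢e
    smaller zero    (suc q) q≢e rewrite off-spike zero q q≢e = s≤s z≤n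
    smaller (suc e) zero    q≢e rewrite on-spike e = s≤s (s≤s z≤n)
    smaller (suc e) (suc q) q≢e rewrite on-spike e | off-spike (suc e) q q≢e = s≤s z≤n

  -- The bound is `6 = 1 + 2 + 1 + 2`: the leading symbol, a block of zeros, the spike and another
  -- block of zeros, each block costing two factors.
  spike-LZ77 : ∀ e → ∃[ z ] (LZ77Factors (spike e) z × 1 ≤ z × z ≤ 6)
  spike-LZ77 e = let z , f = LZ.factorization Fin._≟_ t in z , f , positive f , at-start z f
    where
    t = toList (spike e)
    n≡ : length t ≡ suc m
    n≡ = length-toList (spike e)
    positive : ∀ {z} → LZ77From t 0 z → 1 ≤ z
    positive (done end)       = contradiction (subst (_≤ 0) n≡ end) λ ()
    positive (literal _ _ _)  = s≤s z≤n
    positive (copy _ _ _ _)   = s≤s z≤n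
    zeros : ∀ k → 1 ≤ k → k ≢ toℕ e → k < suc m → LZ.at t k ≡ just 0ₛ
    zeros (suc k) _ k≢e (s≤s k<m) = trans (at-text (spike e) (suc k) (s≤s k<m))
      (cong just (spike≡0ₛ e (fromℕ< k<m) λ { refl → k≢e (cong suc (sym (Fin.toℕ-fromℕ< k<m))) }))
    beyond : ∀ j → suc (toℕ e) ≤ j → LZ.AtMost t 2 j
    beyond = LZ.atMost-run (suc (toℕ e)) (suc m) (ℕ.≤-reflexive (sym n≡))
      (λ k e<k k<n → zeros k (ℕ.≤-trans (s≤s z≤n) e<k) (ℕ.>⇒≢ e<k) k<n)
      (λ j n≤j → LZ.atMost-end (subst (_≤ j) (sym n≡) n≤j))
    from-spike : ∀ j → toℕ e ≤ j → LZ.AtMost t 3 j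
    from-spike j e≤j = LZ.atMost-step λ i j<i → beyond i (ℕ.≤-<-trans e≤j j<i)
    -- For `e = 0` the block before the spike is empty; its hypothesis is vacuous and `from-spike`
    -- covers every position.
    from-1 : ∀ j → 1 ≤ j → LZ.AtMost t 5 j
    from-1 = LZ.atMost-run 1 (toℕ e) (ℕ.≤-trans (ℕ.<⇒≤ (Fin.toℕ<n e)) (ℕ.≤-reflexive (sym n≡)))
      (λ k 1≤k k<e → zeros k 1≤k (ℕ.<⇒≢ k<e) (ℕ.<-trans k<e (Fin.toℕ<n e)))
      from-spike
    at-start : LZ.AtMost t 6 0
    at-start = LZ.atMost-step from-1

  spike-BWT : ∀ e → ∃[ r ] (BWTRuns (spike e) r × 1 ≤ r × r ≤ 6)
  spike-BWT e = bwtRuns (spike e) , refl ,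
    distinct≤bwtRuns (spike e) {1} (λ _ → zero) (λ { zero zero _ → refl }) ,
    -- Two nonzero symbols allow `1 + 2 · 2 = 5` runs, relaxed to the 6 of the LZ77 bound so that
    -- both parameters share a constant.
    ℕ.≤-trans (bwtRuns≤ 0ₛ (spike e)) (ℕ.≤-trans (s≤s (ℕ.*-monoʳ-≤ 2 few)) (ℕ.n≤1+n 5))
    where
    P : Fin (suc m) → Bool
    P q = not (does (spike e q Fin.≟ 0ₛ))
    off : ∀ q → suc q ≢ e → P (suc q) ≡ false
    off q q≢e = cong not (dec-true (spike e (suc q) Fin.≟ 0ₛ) (spike≡0ₛ e q q≢e))
    bit≤1 : ∀ b → bit b ≤ 1
    bit≤1 true  = ℕ.≤-refl
    bit≤1 false = z≤n
    rest : ∀ e → (∀ q → suc q ≢ e → P (suc q) ≡ false) → countFin (P ∘ suc) ≤ 1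
    rest zero    off = ℕ.≤-trans (ℕ.≤-reflexive (countFin-false (P ∘ suc) λ q → off q λ ())) z≤n
    rest (suc e) off = countFin-unique (P ∘ suc) e λ q q≢e → off q (q≢e ∘ Fin.suc-injective)
    few : countFin P ≤ 2
    few = ℕ.≤-trans (ℕ.≤-reflexive (countFin-suc P)) (ℕ.+-mono-≤ (bit≤1 (P zero)) (rest e off))

-- The hypercube of texts with linearly many factors and runs

module Cube {h m σ : ℕ} (m<h : m < h) (h+2≤σ : h + 2 ≤ σ) where

  level : Bits m → Fin (h + m) → ℕ
  level b q = [ (λ i → suc (toℕ i)) , (λ i → if Vec.lookup b i then suc h else 0) ]′ (splitAt h q)

  level<σ : ∀ b q → level b q < σ
  level<σ b q = ℕ.<-≤-trans (bounded (splitAt h q)) h+2≤σ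
    where
    bounded : ∀ s → [ (λ (i : Fin h) → suc (toℕ i)) , (λ i → if Vec.lookup b i then suc h else 0) ]′ s < h + 2
    bounded (inj₁ i) = ℕ.≤-trans (s≤s (Fin.toℕ<n i)) (ℕ.≤-trans (ℕ.≤-reflexive (ℕ.+-comm 1 h)) (ℕ.+-monoʳ-≤ h (s≤s z≤n)))
    bounded (inj₂ i) with Vec.lookup b i
    ... | true  = ℕ.≤-reflexive (ℕ.+-comm 2 h)
    ... | false = ℕ.≤-trans (s≤s z≤n) (ℕ.m≤n+m 2 h)

  -- h distinct symbols, then one symbol per bit, which is smaller or larger
  -- than all of them: the number of zero bits shifts the ranks of the former.
  cube : Bits m → Text σ (h + m)
  cube b = encode (level b) (level<σ b)

  private
    level-↑ˡ : ∀ b i → level b (i ↑ˡ m) ≡ suc (toℕ i)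
    level-↑ˡ b i = cong [ _ , _ ]′ (Fin.splitAt-↑ˡ h i m)

    level-↑ʳ : ∀ b i → level b (h ↑ʳ i) ≡ (if Vec.lookup b i then suc h else 0)
    level-↑ʳ b i = cong [ _ , _ ]′ (Fin.splitAt-↑ʳ h m i)

  data Side : Fin (h + m) → Set where
    left  : ∀ i → Side (i ↑ˡ m)
    right : ∀ i → Side (h ↑ʳ i)

  side : ∀ q → Side q
  side q = subst Side (Fin.join-splitAt h m q) (joined (splitAt h q))
    where
    joined : ∀ s → Side (Fin.join h m s)
    joined (inj₁ i) = left i
    joined (inj₂ i) = right i

  cube-agree : ∀ b i k → k ≢ h ↑ʳ i → cube b k ≡ cube (flip i b) k
  cube-agree b i k k≢i = Fin.toℕ-injective (trans (toℕ-encode (level b) (level<σ b) k)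
    (trans (same (side k) k≢i) (sym (toℕ-encode (level (flip i b)) (level<σ (flip i b)) k))))
    where
    same : ∀ {k} → Side k → k ≢ h ↑ʳ i → level b k ≡ level (flip i b) k
    same (left j)  _   = trans (level-↑ˡ b j) (sym (level-↑ˡ (flip i b) j))
    same (right j) k≢i = trans (level-↑ʳ b j) (trans
      (cong (if_then suc h else 0) (sym (lookup∘updateAt′ j i (k≢i ∘ cong (h ↑ʳ_)) b)))
      (sym (level-↑ʳ (flip i b) j)))

  ones : ∀ {m} → Bits m → ℕ
  ones []      = 0
  ones (x ∷ b) = bit x + ones b

  ones-flip : ∀ {m} (i : Fin m) b → ones (flip i b) ≢ ones b
  ones-flip zero    (true  ∷ b) eq = ℕ.1+n≢n (sym eq)
  ones-flip zero    (false ∷ b) eq = ℕ.1+n≢n eq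
  ones-flip (suc i) (x ∷ b)     eq = ones-flip i b (ℕ.+-cancelˡ-≡ (bit x) _ _ eq)

  ones+zeros : ∀ {m} (b : Bits m) → ones b + countFin (not ∘ Vec.lookup b) ≡ m
  ones+zeros []          = refl
  ones+zeros (true ∷ b)  = cong suc (trans (cong (ones b +_) (countFin-suc (not ∘ Vec.lookup (true ∷ b)))) (ones+zeros b))
  ones+zeros (false ∷ b) = trans (cong (ones b +_) (countFin-suc (not ∘ Vec.lookup (false ∷ b))))
    (trans (ℕ.+-suc (ones b) _) (cong suc (ones+zeros b)))

  ones<h : ∀ b → ones b < h
  ones<h b = ℕ.≤-<-trans (ℕ.≤-trans (ℕ.m≤m+n (ones b) _) (ℕ.≤-reflexive (ones+zeros b))) m<h

  middle : Fin (h + m)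
  middle = fromℕ< (ℕ.<-≤-trans m<h (ℕ.m≤m+n h m))

  -- The zero bits take the first `m - ones b` ranks, and the `h` distinct symbols follow in the
  -- order of their positions. So rank `m` falls on position `ones b`, which `m < h` keeps inside
  -- the first block.
  SA-cube : ∀ b → SA (cube b) middle ≡ fromℕ< (ones<h b) ↑ˡ m
  SA-cube b = SA-rank (cube b) p (λ q eq → unique (side q) (encode-injective (level b) (level<σ b) {q} {p} eq)) middle rank
    where
    i₀ : Fin h
    i₀ = fromℕ< (ones<h b)
    p : Fin (h + m)
    p = i₀ ↑ˡ m
    level-p : level b p ≡ suc (ones b)
    level-p = trans (level-↑ˡ b i₀) (cong suc (Fin.toℕ-fromℕ< (ones<h b)))
    unique : ∀ {q} → Side q → level b q ≡ level b p → q ≡ p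
    unique (left i) eq = cong (_↑ˡ m) (Fin.toℕ-injective (ℕ.suc-injective
      (trans (sym (level-↑ˡ b i)) (trans eq (level-↑ˡ b i₀)))))
    unique (right i) eq with Vec.lookup b i | trans (sym (level-↑ʳ b i)) (trans eq level-p)
    ... | true  | h≡ones = contradiction (ones<h b) (ℕ.<-irrefl (sym (ℕ.suc-injective h≡ones)))
    P : Fin (h + m) → Bool
    P q = does (cube b q Fin.<? cube b p)
    P-true : ∀ {q} → level b q < level b p → P q ≡ true
    P-true {q} lt = dec-true (cube b q Fin.<? cube b p) (encode-< (level b) (level<σ b) {q} {p} lt)
    P-false : ∀ {q} → ¬ (level b q < level b p) → P q ≡ false
    P-false {q} ≮ = dec-false (cube b q Fin.<? cube b p) (encode-≮ (level b) (level<σ b) {q} {p} ≮)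
    P-left : ∀ i → P (i ↑ˡ m) ≡ does (toℕ i ℕ.<? ones b)
    P-left i with toℕ i ℕ.<? ones b
    ... | yes lt = trans (P-true {i ↑ˡ m} (subst₂′ (s≤s lt))) (sym (dec-true (toℕ i ℕ.<? ones b) lt))
      where
      subst₂′ : suc (toℕ i) < suc (ones b) → level b (i ↑ˡ m) < level b p
      subst₂′ = subst (_< level b p) (sym (level-↑ˡ b i)) ∘ subst (suc (toℕ i) <_) (sym level-p)
    ... | no ≮   = trans (P-false {i ↑ˡ m} (λ lt → ≮ (ℕ.s<s⁻¹ (subst (_< suc (ones b)) (level-↑ˡ b i) (subst (level b (i ↑ˡ m) <_) level-p lt)))))
                     (sym (dec-false (toℕ i ℕ.<? ones b) ≮))
    P-right : ∀ i → P (h ↑ʳ i) ≡ not (Vec.lookup b i)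
    P-right i with Vec.lookup b i | level-↑ʳ b i
    ... | true  | eq = P-false {h ↑ʳ i} λ lt → ℕ.<-asym (ones<h b) (ℕ.s<s⁻¹ (subst (_< suc (ones b)) eq (subst (level b (h ↑ʳ i) <_) level-p lt)))
    ... | false | eq = P-true {h ↑ʳ i} (subst (_< level b p) (sym eq) (subst (0 <_) (sym level-p) (s≤s z≤n)))
    rank : countFin P ≡ toℕ middle
    rank = begin
      countFin P                                              ≡⟨ countFin-+ h P ⟩
      countFin (P ∘ (_↑ˡ m)) + countFin (P ∘ (h ↑ʳ_))         ≡⟨ cong₂ _+_ (countFin-cong P-left) (countFin-cong P-right) ⟩
      countFin {h} (λ i → does (toℕ i ℕ.<? ones b)) + countFin (not ∘ Vec.lookup b)
                                                              ≡⟨ cong (_+ countFin (not ∘ Vec.lookup b)) (countFin-below (ones b) (ℕ.<⇒≤ (ones<h b))) ⟩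
      ones b + countFin (not ∘ Vec.lookup b)                      ≡⟨ ones+zeros b ⟩
      m                                                       ≡⟨ Fin.toℕ-fromℕ< _ ⟨
      toℕ middle                                              ∎
      where open ≡-Reasoning

  SA-flip : ∀ b i → SA (cube b) middle ≢ SA (cube (flip i b)) middle
  SA-flip b i eq = ones-flip i b (sym (begin
    ones b                                    ≡⟨ Fin.toℕ-fromℕ< (ones<h b) ⟨
    toℕ (fromℕ< (ones<h b))                   ≡⟨ Fin.toℕ-↑ˡ _ m ⟨
    toℕ (fromℕ< (ones<h b) ↑ˡ m)              ≡⟨ cong toℕ (trans (sym (SA-cube b)) (trans eq (SA-cube (flip i b)))) ⟩
    toℕ (fromℕ< (ones<h (flip i b)) ↑ˡ m)     ≡⟨ Fin.toℕ-↑ˡ _ m ⟩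
    toℕ (fromℕ< (ones<h (flip i b)))          ≡⟨ Fin.toℕ-fromℕ< (ones<h (flip i b)) ⟩
    ones (flip i b)                           ∎))
    where open ≡-Reasoning

  cube-distinct : ∀ b i j → cube b (i ↑ˡ m) ≡ cube b (j ↑ˡ m) → i ≡ j
  cube-distinct b i j eq = Fin.toℕ-injective (ℕ.suc-injective (trans (sym (level-↑ˡ b i))
    (trans (encode-injective (level b) (level<σ b) {i ↑ˡ m} {j ↑ˡ m} eq) (level-↑ˡ b j))))

  cube-BWT : ∀ b → ∃[ r ] (BWTRuns (cube b) r × h ≤ r × r ≤ h + m)
  cube-BWT b = bwtRuns (cube b) , refl ,
    distinct≤bwtRuns (cube b) (_↑ˡ m) (cube-distinct b) , bwtRuns≤length (cube b)

  cube-LZ77 : ∀ b → ∃[ z ] (LZ77Factors (cube b) z × h ≤ z × z ≤ h + m)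
  cube-LZ77 b = let z , f = LZ.factorization Fin._≟_ t in
    z , f , LZ.fresh≤factors h (ℕ.≤-trans (ℕ.m≤m+n h m) (ℕ.≤-reflexive (sym n≡))) fresh f z≤n ,
    ℕ.≤-trans (LZ.factors≤length f z≤n) (ℕ.≤-reflexive n≡)
    where
    t = toList (cube b)
    n≡ : length t ≡ h + m
    n≡ = length-toList (cube b)
    at-left : ∀ i (i<h : i < h) → LZ.at t i ≡ just (cube b (fromℕ< i<h ↑ˡ m))
    at-left i i<h = trans (cong (LZ.at t) (sym (trans (Fin.toℕ-↑ˡ (fromℕ< i<h) m) (Fin.toℕ-fromℕ< i<h))))
      (at-toList (cube b) (fromℕ< i<h ↑ˡ m))
    fresh : ∀ i j → j < i → i < h → LZ.at t j ≢ LZ.at t i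
    fresh i j j<i i<h eq = ℕ.<-irrefl (trans (sym (Fin.toℕ-fromℕ< j<h)) (trans (cong toℕ same) (Fin.toℕ-fromℕ< i<h))) j<i
      where
      j<h : j < h
      j<h = ℕ.<-trans j<i i<h
      same : fromℕ< j<h ≡ fromℕ< i<h
      same = cube-distinct b _ _ (just-injective (trans (sym (at-left j j<h)) (trans eq (at-left i i<h))))

-- Arithmetic of the asymptotic bounds

⌊√_⌋ : ∀ m → ∃[ s ] (s * s ≤ m × m < suc s * suc s)
⌊√ zero ⌋ = 0 , z≤n , s≤s z≤n
⌊√ suc m ⌋ with ⌊√ m ⌋
... | s , s²≤m , m<[1+s]² with suc s * suc s ℕ.≤? suc m
...   | yes [1+s]²≤1+m = suc s , [1+s]²≤1+m , ℕ.≤-<-trans m<[1+s]² (ℕ.*-mono-< {suc s} {2 + s} {suc s} {2 + s} ℕ.≤-refl ℕ.≤-refl)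
...   | no  [1+s]²≰1+m = s , ℕ.m≤n⇒m≤1+n s²≤m , ℕ.≰⇒> [1+s]²≰1+m

*-self-cancel-≤ : ∀ {x y} → x * x ≤ y * y → x ≤ y
*-self-cancel-≤ x²≤y² = ℕ.≮⇒≥ λ y<x → ℕ.<⇒≱ (ℕ.*-mono-< y<x y<x) x²≤y²

module _ where
  open ℕ.≤-Reasoning
  open +-*-Solver

  -- If t is so small that b t ≤ L / 2, then the b t term of L ≤ a q + b t can
  -- be absorbed.
  absorb : ∀ a b R {P L q t} → P ≤ R * (L * L) → L ≤ a * q + b * t →
           R * ((2 * b) * (2 * b)) * (t * t) ≤ P → P ≤ R * ((2 * a) * (2 * a)) * (q * q)
  -- With `R = 0` the factor `R` cannot be cancelled, but then both bounds say that `P` is 0.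
  absorb a b zero P≤ _ _ = P≤
  absorb a b R@(suc _) {P} {L} {q} {t} P≤ L≤ ≤P = begin
    P                                      ≤⟨ P≤ ⟩
    R * (L * L)                            ≤⟨ ℕ.*-monoʳ-≤ R (ℕ.*-mono-≤ L≤2aq L≤2aq) ⟩
    R * ((2 * a * q) * (2 * a * q))        ≡⟨ square a R q ⟨
    R * ((2 * a) * (2 * a)) * (q * q)      ∎
    where
    square : ∀ a R q → R * ((2 * a) * (2 * a)) * (q * q) ≡ R * ((2 * a * q) * (2 * a * q))
    square = solve 3 (λ a R q → R :* ((con 2 :* a) :* (con 2 :* a)) :* (q :* q)
                             := R :* ((con 2 :* a :* q) :* (con 2 :* a :* q))) refl
    2bt≤L : 2 * b * t ≤ L
    2bt≤L = *-self-cancel-≤ (ℕ.*-cancelˡ-≤ R (begin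
      R * ((2 * b * t) * (2 * b * t))      ≡⟨ square b R t ⟨
      R * ((2 * b) * (2 * b)) * (t * t)    ≤⟨ ≤P ⟩
      P                                    ≤⟨ P≤ ⟩
      R * (L * L)                          ∎))
    L≤2aq : L ≤ 2 * a * q
    L≤2aq = ℕ.+-cancelʳ-≤ L L (2 * a * q) (begin
      L + L                                ≤⟨ ℕ.+-mono-≤ L≤ L≤ ⟩
      (a * q + b * t) + (a * q + b * t)    ≡⟨ solve 4 (λ a b q t → (a :* q :+ b :* t) :+ (a :* q :+ b :* t)
                                                := con 2 :* a :* q :+ con 2 :* b :* t) refl a b q t ⟩
      2 * a * q + 2 * b * t                ≤⟨ ℕ.+-monoʳ-≤ (2 * a * q) 2bt≤L ⟩
      2 * a * q + L                        ∎)

  -- `1 ≤ m` excludes `s = 0`, and then `s + 1 ≤ 2 s` absorbs the rounding of the square root.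
  1+m≤4s² : ∀ {m s} → 1 ≤ m → m < suc s * suc s → suc m ≤ 4 * (s * s)
  1+m≤4s² {m} {zero}  1≤m m<1 = contradiction m<1 (ℕ.≤⇒≯ 1≤m)
  1+m≤4s² {m} {suc s} 1≤m m<  = begin
    suc m                       ≤⟨ m< ⟩
    (2 + s) * (2 + s)           ≤⟨ ℕ.*-mono-≤ (grow s) (grow s) ⟩
    (2 * suc s) * (2 * suc s)   ≡⟨ solve 1 (λ s → (con 2 :* s) :* (con 2 :* s) := con 4 :* (s :* s)) refl (suc s) ⟩
    4 * (suc s * suc s)         ∎
    where
    grow : ∀ s → 2 + s ≤ 2 * suc s
    grow s = ℕ.≤-trans (ℕ.+-monoʳ-≤ 2 (ℕ.m≤m+n s (s + 0))) (ℕ.≤-reflexive (solve 1 (λ s → con 2 :+ con 2 :* s := con 2 :* (con 1 :+ s)) refl s))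

  -- `5 ≤ n` gives `2 ≤ m`. This yields `h + 2 ≤ n`, leaving room in the alphabet for the two
  -- symbols outside the distinct block, and keeps `h` within a constant multiple of `m`.
  halve : ∀ n → 5 ≤ n → ∃[ h ] ∃[ m ] (n ≡ h + m × m < h × h ≤ 3 * m × 2 ≤ m)
  halve (suc n) (s≤s 4≤n) = suc n ∸ m , m , sym (ℕ.m∸n+n≡m (ℕ.m≤n⇒m≤1+n m≤n)) , m<h , h≤3m , 2≤m
    where
    m = ⌊ n /2⌋
    m≤n : m ≤ n
    m≤n = ℕ.⌊n/2⌋≤n n
    2≤m : 2 ≤ m
    2≤m = ℕ.⌊n/2⌋-mono 4≤n
    m+m≤n : m + m ≤ n
    m+m≤n = ℕ.≤-trans (ℕ.+-monoʳ-≤ m (ℕ.⌊n/2⌋≤⌈n/2⌉ n)) (ℕ.≤-reflexive (ℕ.⌊n/2⌋+⌈n/2⌉≡n n))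
    m<h : m < suc n ∸ m
    m<h = ℕ.m+n≤o⇒m≤o∸n (suc m) (s≤s m+m≤n)
    h≤3m : suc n ∸ m ≤ 3 * m
    h≤3m = ℕ.m≤n+o⇒m∸n≤o (suc n) m (begin
      suc n                ≡⟨ cong suc (ℕ.⌊n/2⌋+⌈n/2⌉≡n n) ⟨
      suc (m + ⌊ suc n /2⌋) ≤⟨ s≤s (ℕ.+-monoʳ-≤ m (ceil n)) ⟩
      suc (m + suc m)      ≤⟨ ℕ.m≤m+n _ (2 * m ∸ 2) ⟩
      suc (m + suc m) + (2 * m ∸ 2) ≡⟨ solve 2 (λ m k → con 1 :+ (m :+ (con 1 :+ m)) :+ k := m :+ (m :+ (con 2 :+ k))) refl m (2 * m ∸ 2) ⟩
      m + (m + (2 + (2 * m ∸ 2)))   ≡⟨ cong (λ k → m + (m + k)) (ℕ.m+[n∸m]≡n (ℕ.≤-trans 2≤m (ℕ.m≤m+n m (m + 0)))) ⟩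
      m + (m + 2 * m)      ≡⟨ solve 1 (λ m → m :+ (m :+ con 2 :* m) := m :+ con 3 :* m) refl m ⟩
      m + 3 * m            ∎)
      where
      ceil : ∀ n → ⌊ suc n /2⌋ ≤ suc ⌊ n /2⌋
      ceil zero          = z≤n
      ceil (suc zero)    = ℕ.≤-refl
      ceil (suc (suc n)) = s≤s (ceil n)

-- The lower bounds for the four classes

module Assembly {c ℓ₁ ℓ₂ ℓ₃} (ℝ : RealNumbers c ℓ₁ ℓ₂ ℓ₃) (σ : ℕ → ℕ) (n≤σ : ∀ n → n ≤ σ n) where

  open Quantum ℝ
  open QueryBounds ℝ
  open SAConstruction using (build)

  -- The spikes lie in the class as soon as `C` is at least their common bound 6. The conclusion
  -- reaches every text of the class through `p ≤ C`; with `n ≤ 4 s²` this gives the factor `4 C`.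
  constantBound : (μ : Parameter) →
    (∀ {m σ} (3≤σ : 3 ≤ σ) e → ∃[ p ] (μ (Spike.spike {m} 3≤σ e) p × 1 ≤ p × p ≤ 6)) →
    LowerBoundForΘ σ μ (λ n → 1)
  constantBound μ value = 6 , bound
    where
    bound : ∀ C → 6 ≤ C → LowerBound σ (λ n → Θ-Class μ (λ n → 1) C)
    bound C 6≤C A t constructs o =
      -- `3 ≤ n` supplies the three symbols of a spike and makes the number `m = n - 1` of its
      -- places positive.
      4 * C * ((2 * 1944) * (2 * 1944)) , N ⊔ 3 , conclude
      where
      N : ℕ
      -- The smallness of `t` is invoked with exactly the constant that `absorb` asks for when
      -- `b = 1296`.
      N = proj₁ (o (4 * C * ((2 * 1296) * (2 * 1296))))
      conclude : ∀ n → .{{_ : NonZero n}} → N ⊔ 3 ≤ n → ∀ T p → Θ-Class μ (λ n → 1) C T p →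
                 p * n ≤ 4 * C * ((2 * 1944) * (2 * 1944)) * (queries (build (A n)) * queries (build (A n)))
      conclude (suc m) N≤n T p T∈ with ⌊√ m ⌋
      ... | s , s²≤m , m<[1+s]² = absorb 1944 1296 (4 * C) {L = s} {q = queries (build (A (suc m)))} {t = t (suc m)}
        size s≤cost (proj₂ (o (4 * C * ((2 * 1296) * (2 * 1296)))) (suc m) (ℕ.≤-trans (ℕ.m≤m⊔n N 3) N≤n) T p T∈)
        where
        3≤n : 3 ≤ suc m
        3≤n = ℕ.≤-trans (ℕ.m≤n⊔m N 3) N≤n
        3≤σ : 3 ≤ σ (suc m)
        3≤σ = ℕ.≤-trans 3≤n (n≤σ (suc m))
        1≤m : 1 ≤ m
        1≤m = ℕ.≤-trans (s≤s z≤n) (ℕ.s≤s⁻¹ 3≤n)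
        open Spike {m} 3≤σ
        built : ∀ e → Constructs (A (suc m)) (spike e) (t (suc m))
        built e with value 3≤σ e
        ... | p , μp , 1≤p , p≤6 = constructs (suc m) (spike e) p
          (μp , ℕ.≤-trans p≤6 (ℕ.≤-trans 6≤C (ℕ.≤-reflexive (sym (ℕ.*-identityʳ C))))
              , ℕ.*-mono-≤ (ℕ.≤-trans (s≤s z≤n) 6≤C) 1≤p)
        s≤cost : s ≤ cost (A (suc m)) (t (suc m))
        s≤cost = star-bound {{ℕ.>-nonZero 1≤m}} (A (suc m)) (t (suc m)) (fromℕ m) (spike zero) (λ i → spike (suc i))
          (built zero) (λ i → built (suc i)) spike-agree
          (λ i eq → contradiction (trans (sym (SA-spike zero)) (trans eq (SA-spike (suc i)))) λ ()) s s²≤m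
        size : p * suc m ≤ 4 * C * (s * s)
        size = begin
          p * suc m              ≤⟨ ℕ.*-mono-≤ (ℕ.≤-trans (proj₁ (proj₂ T∈)) (ℕ.≤-reflexive (ℕ.*-identityʳ C))) (1+m≤4s² {s = s} 1≤m m<[1+s]²) ⟩
          C * (4 * (s * s))      ≡⟨ solve 2 (λ C k → C :* (con 4 :* k) := con 4 :* C :* k) refl C (s * s) ⟩
          4 * C * (s * s)        ∎
          where
          open ℕ.≤-Reasoning
          open +-*-Solver

  -- `C ≥ 2` is what places the cube in the class, as `n = h + m ≤ 2 h ≤ 2 p`. The factor `16 C`
  -- comes from `p ≤ C n` and `n ≤ 4 m`, the latter used twice.
  linearBound : (μ : Parameter) →
    (∀ {h m σ} (m<h : m < h) (h+2≤σ : h + 2 ≤ σ) b → ∃[ p ] (μ (Cube.cube m<h h+2≤σ b) p × h ≤ p × p ≤ h + m)) →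
    LowerBoundForΘ σ μ (λ n → n)
  linearBound μ value = 2 , bound
    where
    bound : ∀ C → 2 ≤ C → LowerBound σ (λ n → Θ-Class μ (λ n → n) C)
    bound C 2≤C A t constructs o =
      16 * C * ((2 * 1944) * (2 * 1944)) , N ⊔ 5 , conclude
      where
      N : ℕ
      N = proj₁ (o (16 * C * ((2 * 1296) * (2 * 1296))))
      conclude : ∀ n → .{{_ : NonZero n}} → N ⊔ 5 ≤ n → ∀ T p → Θ-Class μ (λ n → n) C T p →
                 p * n ≤ 16 * C * ((2 * 1944) * (2 * 1944)) * (queries (build (A n)) * queries (build (A n)))
      conclude n N≤n T p T∈ with halve n (ℕ.≤-trans (ℕ.m≤n⊔m N 5) N≤n)
      ... | h , m , refl , m<h , h≤3m , 2≤m = absorb 1944 1296 (16 * C) {L = m} {q = queries (build (A (h + m)))} {t = t (h + m)}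
        size m≤cost (proj₂ (o (16 * C * ((2 * 1296) * (2 * 1296)))) (h + m) (ℕ.≤-trans (ℕ.m≤m⊔n N 5) N≤n) T p T∈)
        where
        h+2≤σ : h + 2 ≤ σ (h + m)
        h+2≤σ = ℕ.≤-trans (ℕ.+-monoʳ-≤ h 2≤m) (n≤σ (h + m))
        open Cube m<h h+2≤σ
        open ℕ.≤-Reasoning
        open +-*-Solver
        built : ∀ b → Constructs (A (h + m)) (cube b) (t (h + m))
        built b with value m<h h+2≤σ b
        ... | p , μp , h≤p , p≤n = constructs (h + m) (cube b) p
          (μp , ℕ.≤-trans p≤n (ℕ.≤-trans (ℕ.≤-reflexive (sym (ℕ.*-identityˡ (h + m)))) (ℕ.*-monoˡ-≤ (h + m) (ℕ.≤-trans (s≤s z≤n) 2≤C)))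
              , (begin
                  h + m   ≤⟨ ℕ.+-monoʳ-≤ h (ℕ.<⇒≤ m<h) ⟩
                  h + h   ≡⟨ solve 1 (λ h → h :+ h := con 2 :* h) refl h ⟩
                  2 * h   ≤⟨ ℕ.*-mono-≤ 2≤C h≤p ⟩
                  C * p   ∎))
        m≤cost : m ≤ cost (A (h + m)) (t (h + m))
        m≤cost = hypercube-bound h (A (h + m)) (t (h + m)) middle cube built cube-agree SA-flip
        n≤4m : h + m ≤ 4 * m
        n≤4m = ℕ.≤-trans (ℕ.+-monoˡ-≤ m h≤3m) (ℕ.≤-reflexive (solve 1 (λ m → con 3 :* m :+ m := con 4 :* m) refl m))
        size : p * (h + m) ≤ 16 * C * (m * m)
        size = begin
          p * (h + m)                  ≤⟨ ℕ.*-mono-≤ (ℕ.≤-trans (proj₁ (proj₂ T∈)) (ℕ.*-monoʳ-≤ C n≤4m)) n≤4m ⟩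
          C * (4 * m) * (4 * m)        ≡⟨ solve 2 (λ C m → C :* (con 4 :* m) :* (con 4 :* m) := con 16 :* C :* (m :* m)) refl C m ⟩
          16 * C * (m * m)             ∎

theorem5 : ∀ {c ℓ₁ ℓ₂ ℓ₃} (ℝ : RealNumbers c ℓ₁ ℓ₂ ℓ₃) →
    let open Quantum ℝ in
    (σ : ℕ → ℕ) → (∀ n → n ≤ σ n) →
    (LowerBoundForΘ σ LZ77Factors (λ n → 1) × LowerBoundForΘ σ LZ77Factors (λ n → n)) ×
    (LowerBoundForΘ σ BWTRuns (λ n → 1) × LowerBoundForΘ σ BWTRuns (λ n → n))
theorem5 ℝ σ n≤σ =
  (constantBound LZ77Factors (λ 3≤σ → Spike.spike-LZ77 3≤σ) , linearBound LZ77Factors (λ m<h h+2≤σ → Cube.cube-LZ77 m<h h+2≤σ)) ,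
  (constantBound BWTRuns (λ 3≤σ → Spike.spike-BWT 3≤σ) , linearBound BWTRuns (λ m<h h+2≤σ → Cube.cube-BWT m<h h+2≤σ))
  where open Assembly ℝ σ n≤σ
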